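{- For $n\ge 1$ let \[ P_{n}^{(\mathrm{pk},\mathrm{ipk},\mathrm{des},\mathrm{ides})}(y,z,s,t)=\sum_{\pi\in\mathfrak{S}_{n}}y^{\mathrm{pk}(\pi)+1}z^{\mathrm{ipk}(\pi)+1}s^{\mathrm{des}(\pi)+1}t^{\mathrm{ides}(\pi)+1}. \] Then, writing $P_n=P_{n}^{(\mathrm{pk},\mathrm{ipk},\mathrm{des},\mathrm{ides})}$, the following hold as formal power series identities: (a) \begin{multline*} \frac{1}{(1-s)(1-t)}+\sum_{n=1}^{\infty}\frac{\left(\frac{(1+ys)(1+zt)}{(1-s)(1-t)}\right)^{n+1}P_{n}\left(\frac{(1+y)^{2}s}{(y+s)(1+ys)},\frac{(1+z)^{2}t}{(z+t)(1+zt)},\frac{y+s}{1+ys},\frac{z+t}{1+zt}\right)}{(1+y)(1+z)}x^{n}\\ =\sum_{i,j=0}^{\infty}\left(\frac{(1+yx)(1+zx)}{(1-yzx)(1-x)}\right)^{ij}s^{i}t^{j}; \end{multline*} (b) for all $n\geq1$, \begin{multline*} \frac{\left(\frac{(1+ys)(1+zt)}{(1-s)(1-t)}\right)^{n+1}P_{n}\left(\frac{(1+y)^{2}s}{(y+s)(1+ys)},\frac{(1+z)^{2}t}{(z+t)(1+zt)},\frac{y+s}{1+ys},\frac{z+t}{1+zt}\right)}{(1+y)(1+z)}\\ =\sum_{\lambda\vdash n}\frac{\prod_{i=1}^{l(\lambda)}(1-(-y)^{\lambda_{i}})(1-(-z)^{\lambda_{i}})}{z_{\lambda}}\frac{A_{l(\lambda)}(s)A_{l(\lambda)}(t)}{(1-s)^{l(\lambda)+1}(1-t)^{l(\lambda)+1}},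 \end{multline*} where $\lambda_1,\dots,\lambda_{l(\lambda)}$ are the parts of $\lambda$.
   Context: $\mathfrak{S}_n$ is the symmetric group on $[n]=\{1,\dots,n\}$. For $\pi\in\mathfrak{S}_n$, $i\in[n-1]$ is a descent if $\pi(i)>\pi(i+1)$; $\mathrm{des}(\pi)$ is the number of descents. An index $i$ with $2\le i\le n-1$ is a peak if $\pi(i-1)<\pi(i)>\pi(i+1)$; $\mathrm{pk}(\pi)$ is the number of peaks. For a statistic $\mathrm{st}$, the inverse statistic is $\mathrm{ist}(\pi)=\mathrm{st}(\pi^{ -1})$ (so $\mathrm{ides}(\pi)=\mathrm{des}(\pi^{ -1})$, $\mathrm{ipk}(\pi)=\mathrm{pk}(\pi^{ -1})$). The Eulerian polynomials are $A_n(t)=\sum_{\pi\in\mathfrak{S}_n}t^{\mathrm{des}(\pi)+1}$ for $n\ge1$ and $A_0(t)=1$. For a partition $\lambda$, $l(\lambda)$ is its number of parts, $\lambda\vdash n$ means $\lambda$ is a partition of $n$, and if $\lambda$ has $m_i$ parts equal to $i$ then $z_\lambda=\prod_i i^{m_i}m_i!$. -}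

module Defs where

open import Data.Bool using (Bool; true; false; if_then_else_; _∧_)
open import Data.Nat as ℕ using (ℕ; zero; suc; _∸_; _⊓_; _<ᵇ_; _≡ᵇ_)
open import Data.Nat using (_!)
import Data.Nat.ListAction as LA
open import Data.Integer using (+_)
open import Data.Rational as Q using (ℚ; 0ℚ; 1ℚ)
open import Data.List as L using (List; []; _∷_; map; concatMap; upTo; applyUpTo; foldr; filterᵇ; length)
open import Data.Vec as V using (Vec; []; _∷_)
open import Data.Fin using (Fin; zero; suc)
open import Relation.Binary.PropositionalEquality using (_≡_)
open import Data.Product using (_×_; _,_; proj₁; proj₂)

ℕtoℚ : ℕ → ℚ
ℕtoℚ n = + n Q./ 1

sumℚ : List ℚ → ℚ
sumℚ = foldr Q._+_ 0ℚ

-- Formal power series over ℚ in the five variables x, y, z, s, t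
-- (in this order).  A series is its coefficient function on
-- exponent vectors.

Exp : Set
Exp = Vec ℕ 5

Series : Set
Series = Exp → ℚ

_≈_ : Series → Series → Set
f ≈ g = ∀ w → f w ≡ g w

splits : ∀ {k} → Vec ℕ k → List (Vec ℕ k × Vec ℕ k)
splits [] = ([] , []) ∷ []
splits (a ∷ w) =
  concatMap (λ i → map (λ p → (i ∷ proj₁ p) , ((a ∸ i) ∷ proj₂ p)) (splits w))
            (upTo (suc a))

isZeroVec : ∀ {k} → Vec ℕ k → Bool
isZeroVec [] = true
isZeroVec (a ∷ w) = (a ≡ᵇ 0) ∧ isZeroVec w

eqVec : ∀ {k} → Vec ℕ k → Vec ℕ k → Bool
eqVec [] [] = true
eqVec (a ∷ u) (b ∷ v) = (a ≡ᵇ b) ∧ eqVec u v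

totalDeg : ∀ {k} → Vec ℕ k → ℕ
totalDeg [] = 0
totalDeg (a ∷ w) = a ℕ.+ totalDeg w

infixl 6 _⊕_ _⊖_
infixl 7 _⊗_
infixl 6 _+F_
infixl 7 _*F_ _/F_
infixr 8 _^F_ _^_

_⊕_ : Series → Series → Series
(f ⊕ g) w = f w Q.+ g w

scale : ℚ → Series → Series
scale c f w = c Q.* f w

_⊖_ : Series → Series → Series
f ⊖ g = f ⊕ scale (Q.- 1ℚ) g

_⊗_ : Series → Series → Series
(f ⊗ g) w = sumℚ (map (λ p → f (proj₁ p) Q.* g (proj₂ p)) (splits w))

const : ℚ → Series
const c w = if isZeroVec w then c else 0ℚ

𝟘 𝟙 : Series
𝟘 = const 0ℚ
𝟙 = const 1ℚ

constℕ : ℕ → Series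
constℕ n = const (ℕtoℚ n)

unitVec : Fin 5 → Exp
unitVec i = V.updateAt (V.replicate 5 0) i (λ _ → 1)

var : Fin 5 → Series
var i w = if eqVec w (unitVec i) then 1ℚ else 0ℚ

X Y Z S T : Series
X = var zero
Y = var (suc zero)
Z = var (suc (suc zero))
S = var (suc (suc (suc zero)))
T = var (suc (suc (suc (suc zero))))

_^_ : Series → ℕ → Series
f ^ zero = 𝟙
f ^ suc n = f ⊗ (f ^ n)

sumS : List Series → Series
sumS = foldr _⊕_ 𝟘

prodS : List Series → Series
prodS = foldr _⊗_ 𝟙

-- 1/(1-g) = Σ_k g^k for a series g with zero constant term; the
-- coefficient at w only receives contributions from k ≤ total degree of w.
geom : Series → Series
geom g w = sumℚ (map (λ k → (g ^ k) w) (upTo (suc (totalDeg w))))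

xCoeff : ℕ → Series → Series
xCoeff n f (a ∷ w) = if a ≡ᵇ 0 then f (n ∷ w) else 0ℚ

-- Fractions of power series (elements of the fraction field of
-- ℚ[[x,y,z,s,t]]), as numerator/denominator pairs.

Frac : Set
Frac = Series × Series

infix 4 _≈F_
_≈F_ : Frac → Frac → Set
(a , b) ≈F (c , d) = (a ⊗ d) ≈ (c ⊗ b)

toF : Series → Frac
toF f = f , 𝟙

_+F_ : Frac → Frac → Frac
(a , b) +F (c , d) = (a ⊗ d ⊕ c ⊗ b) , (b ⊗ d)

_*F_ : Frac → Frac → Frac
(a , b) *F (c , d) = (a ⊗ c) , (b ⊗ d)

_/F_ : Frac → Frac → Frac
(a , b) /F (c , d) = (a ⊗ d) , (b ⊗ c)

_^F_ : Frac → ℕ → Frac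
f ^F zero = toF 𝟙
f ^F suc n = f *F (f ^F n)

sumF : List Frac → Frac
sumF = foldr _+F_ (toF 𝟘)

-- Permutations of [n], in one-line notation as words π(1)…π(n),
-- values shifted to {0,…,n-1} (irrelevant for des/pk).

words : ℕ → ℕ → List (List ℕ)
words n zero = [] ∷ []
words n (suc k) = concatMap (λ w → map (_∷ w) (upTo n)) (words n k)

notElem : ℕ → List ℕ → Bool
notElem a [] = true
notElem a (b ∷ l) = if a ≡ᵇ b then false else notElem a l

distinct : List ℕ → Bool
distinct [] = true
distinct (a ∷ l) = notElem a l ∧ distinct l

𝔖 : ℕ → List (List ℕ)
𝔖 n = filterᵇ distinct (words n n)

indexOf : ℕ → List ℕ → ℕ
indexOf a [] = 0
indexOf a (b ∷ l) = if a ≡ᵇ b then 0 else suc (indexOf a l)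

inverse : List ℕ → List ℕ
inverse π = map (λ j → indexOf j π) (upTo (length π))

b2n : Bool → ℕ
b2n true = 1
b2n false = 0

des : List ℕ → ℕ
des (a ∷ b ∷ l) = b2n (b <ᵇ a) ℕ.+ des (b ∷ l)
des _ = 0

pk : List ℕ → ℕ
pk (a ∷ b ∷ c ∷ l) = b2n ((a <ᵇ b) ∧ (c <ᵇ b)) ℕ.+ pk (b ∷ c ∷ l)
pk _ = 0

ides ipk : List ℕ → ℕ
ides π = des (inverse π)
ipk π = pk (inverse π)

Pn : ℕ → Frac → Frac → Frac → Frac → Frac
Pn n y z s t = sumF (map (λ π →
  (y ^F suc (pk π)) *F (z ^F suc (ipk π)) *F (s ^F suc (des π)) *F (t ^F suc (ides π)))
  (𝔖 n))

Eulerian : ℕ → Series → Series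
Eulerian zero u = 𝟙
Eulerian (suc n) u = sumS (map (λ π → u ^ suc (des π)) (𝔖 (suc n)))

-- Partitions of n: nonincreasing lists of positive parts summing to n.
-- parts fuel n m = partitions of n with all parts ≤ m (fuel ≥ n).

parts : ℕ → ℕ → ℕ → List (List ℕ)
parts _ zero _ = [] ∷ []
parts zero (suc n) _ = []
parts (suc f) (suc n) m =
  concatMap (λ k → map (k ∷_) (parts f (suc n ∸ k) k)) (applyUpTo suc (m ⊓ suc n))

partitions : ℕ → List (List ℕ)
partitions n = parts n n n

count : ℕ → List ℕ → ℕ
count i λ' = length (filterᵇ (i ≡ᵇ_) λ') 

-- z_λ = ∏ i^{m_i} m_i!
zλ : List ℕ → ℕ
zλ λ' = LA.product λ' ℕ.* LA.product (map (λ i → (count i λ') !) (applyUpTo suc (LA.sum λ')))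

oneMinus onePlus : Series → Series
oneMinus u = 𝟙 ⊖ u
onePlus u = 𝟙 ⊕ u

LHSn : ℕ → Frac
LHSn n =
  ((((toF (onePlus (Y ⊗ S) ⊗ onePlus (Z ⊗ T))) /F toF (oneMinus S ⊗ oneMinus T)) ^F suc n)
   *F Pn n ((toF ((onePlus Y ^ 2) ⊗ S)) /F toF ((Y ⊕ S) ⊗ onePlus (Y ⊗ S)))
           ((toF ((onePlus Z ^ 2) ⊗ T)) /F toF ((Z ⊕ T) ⊗ onePlus (Z ⊗ T)))
           (toF (Y ⊕ S) /F toF (onePlus (Y ⊗ S)))
           (toF (Z ⊕ T) /F toF (onePlus (Z ⊗ T))))
  /F toF (onePlus Y ⊗ onePlus Z)

LHSa-coeff : ℕ → Frac
LHSa-coeff zero = toF 𝟙 /F toF (oneMinus S ⊗ oneMinus T)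
LHSa-coeff (suc n) = LHSn (suc n)

Fser : Series
Fser = onePlus (Y ⊗ X) ⊗ onePlus (Z ⊗ X) ⊗ geom (Y ⊗ Z ⊗ X) ⊗ geom X

-- right-hand side of (a): Σ_{i,j} F^{ij} s^i t^j.  Since F involves only
-- x,y,z, its coefficient at x^a y^b z^c s^i t^j is [x^a y^b z^c] F^{ij}.
RHSa : Series
RHSa (a ∷ b ∷ c ∷ i ∷ j ∷ []) = (Fser ^ (i ℕ.* j)) (a ∷ b ∷ c ∷ 0 ∷ 0 ∷ [])

RHSb : ℕ → Frac
RHSb n = sumF (map term (partitions n))
  where
  term : List ℕ → Frac
  term λ' =
    (prodS (map (λ k → oneMinus (scale (Q.- 1ℚ) Y ^ k) ⊗ oneMinus (scale (Q.- 1ℚ) Z ^ k)) λ')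
       ⊗ Eulerian (length λ') S ⊗ Eulerian (length λ') T)
    , (constℕ (zλ λ') ⊗ (oneMinus S ^ suc (length λ')) ⊗ (oneMinus T ^ suc (length λ')))

{-# OPTIONS --safe #-}
module Submission where

-- Both sides of both identities represent the power series G n = Σ_{i,j} [xⁿ] F^{ij} sⁱ tʲ.
--
-- Left-hand side.  Let αᵢ(π) count, by the number of negative labels, the weakly increasing labellings of the
-- letters of π by -1 < 1 < … < -i < i whose positive labels are repeated only at ascents and whose negative
-- labels only at descents.  Scanning π letter by letter shows that Σ αᵢ(π) sⁱ is
-- s^{pk+1} (1+y)^{2pk+1} (y+s)^{des-pk} (1+ys)^{n-1-pk-des} / (1-s)^{n+1}, the monomial of π in the
-- substituted Pₙ.  A labelling of π⁻¹ by signed letters together with π is the same as a word b, by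
-- standardization, and π has its descents where b has them.  So Σ_π αᵢ(π) βⱼ(π⁻¹) is the sum of αᵢ over all words
-- in 2j signed letters.  As αᵢ is a convolution power for concatenation, this is the coefficient of xⁿ in an
-- i-th power, whose base is the generating function F^j of decreasing words followed by increasing ones.
--
-- Partitions.  The logarithmic derivative x F′/F is Σ (1-(-y)ᵏ)(1-(-z)ᵏ) xᵏ, and the sum over partitions satisfies
-- the resulting recurrence because removing one part k from λ divides z_λ by k times its multiplicity.

open import Algebra.Bundles using (CommutativeRing)
open import Data.Bool.Base using (Bool; true; false; if_then_else_; _∧_; not)
open import Data.List.Base using (List; []; _∷_; map; concatMap; upTo; applyUpTo; length)
open import Data.Nat.Base as ℕ using (ℕ; zero; suc; _∸_; _⊓_; _≤ᵇ_; _<ᵇ_; _≡ᵇ_; s≤s; z≤n; NonZero)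
import Data.Nat.Properties as ℕₚ
open import Level using (Level; 0ℓ; _⊔_)
open import Relation.Binary.PropositionalEquality as ≡ using (_≡_; cong; cong₂)

-- Equality of fractions is cross multiplication, so passing through an intermediate fraction would
-- mean cancelling denominators; moreover y + s, which occurs in the denominators of the substituted
-- arguments, is not a unit among power series. Each fraction a/b is therefore compared with a
-- series f through a = f * b. The factor y + s then goes away only because pk ≤ des: the powers of
-- the s-argument bring at least as many copies of it as those of the y-argument demand. Sums over
-- all i and j are never formed as limits. A series is read off from its coefficients, and the
-- arguments use only that this is additive, commutes with y, turns the index shift into
-- multiplication by s and fixes constants. Labels and letters obey one rule, so one count is used
-- twice: for the labellings of π⁻¹ and, on a word with ascents only, for the increasing words.
-- Decreasing words need no count of their own, since their series is the inverse of the increasing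
-- one at negated weight. The logarithmic derivative yields the coefficients after division by n,
-- which rational coefficients permit.

-- Commutative rings: the ring solver and finite sums.

module RingKit {c ℓ : Level} (R : CommutativeRing c ℓ) where

  open import Data.List.Base using (_++_; filterᵇ)
  open import Data.Integer.Base as ℤ using (ℤ; +_; -[1+_]; _⊖_)
  import Data.Integer.Properties as ℤₚ
  open import Data.Maybe.Base using (Maybe; just; nothing)
  open import Function.Base using (id)
  open import Relation.Nullary using (yes; no)
  open import Algebra.Solver.Ring.AlmostCommutativeRing using (fromCommutativeRing; _-Raw-AlmostCommutative⟶_)
  import Algebra.Solver.Ring

  open CommutativeRing R public hiding (zero)
  open import Algebra.Properties.Ring ring public using (-‿distribˡ-*; -‿distribʳ-*; -0#≈0#; -‿involutive; -‿+-comm)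
  open import Algebra.Properties.CommutativeSemiring.Exp commutativeSemiring public
  open import Relation.Binary.Reasoning.Setoid setoid public
  open import Algebra.Properties.Semiring.Mult semiring public using (_×_; ×-homo-+; ×1-homo-*; ×-congʳ; ×-assoc-*; ×-comm-*; ×-assocˡ)
  open import Algebra.Properties.CommutativeMonoid.Mult +-commutativeMonoid public using (×-distrib-+)
  open import Algebra.Properties.Semiring.Mult.TCOptimised semiring using () renaming (_×_ to _×′_)

  private
    -- The optimised multiple sends 0 and 1 to `0#` and `1#` by computation, so that the solver
    -- constants `con (pos 0)` and `con (pos 1)` match the constants of the ring directly.
    ιℕ : ℕ → Carrier
    ιℕ n = n ×′ 1#

    ιℤ : ℤ → Carrier
    ιℤ (+ n) = ιℕ n
    ιℤ -[1+ n ] = - ιℕ (suc n)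

    open import Algebra.Properties.Semiring.Mult.TCOptimised semiring using () renaming (×-homo-+ to ×′-homo-+; ×1-homo-* to ×′1-homo-*; 1+× to 1+×′)

    cancel : ∀ a b → (1# + a) - (1# + b) ≈ a - b
    cancel a b = begin
      (1# + a) + - (1# + b)     ≈⟨ +-congˡ (sym (-‿+-comm 1# b)) ⟩
      (1# + a) + (- 1# + - b)   ≈⟨ +-congʳ (+-comm 1# a) ⟩
      (a + 1#) + (- 1# + - b)   ≈⟨ +-assoc a 1# _ ⟩
      a + (1# + (- 1# + - b))   ≈⟨ +-congˡ (sym (+-assoc 1# (- 1#) (- b))) ⟩
      a + ((1# + - 1#) + - b)   ≈⟨ +-congˡ (+-congʳ (-‿inverseʳ 1#)) ⟩
      a + (0# + - b)            ≈⟨ +-congˡ (+-identityˡ _) ⟩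
      a - b                     ∎

    ⊖-homo : ∀ m n → ιℤ (m ⊖ n) ≈ ιℕ m - ιℕ n
    ⊖-homo zero zero = sym (-‿inverseʳ 0#)
    ⊖-homo zero (suc n) = sym (+-identityˡ _)
    ⊖-homo (suc m) zero = sym (trans (+-congˡ -0#≈0#) (+-identityʳ _))
    ⊖-homo (suc m) (suc n) = begin
      ιℤ (suc m ⊖ suc n)                ≡⟨ ≡.cong ιℤ (ℤₚ.[1+m]⊖[1+n]≡m⊖n m n) ⟩
      ιℤ (m ⊖ n)                        ≈⟨ ⊖-homo m n ⟩
      ιℕ m - ιℕ n                       ≈⟨ cancel _ _ ⟨
      (1# + ιℕ m) - (1# + ιℕ n)         ≈⟨ +-cong (1+×′ m 1#) (-‿cong (1+×′ n 1#)) ⟨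
      ιℕ (suc m) - ιℕ (suc n)           ∎

    +-homoℤ : ∀ i j → ιℤ (i ℤ.+ j) ≈ ιℤ i + ιℤ j
    +-homoℤ (+ m) (+ n) = ×′-homo-+ 1# m n
    +-homoℤ (+ m) -[1+ n ] = ⊖-homo m (suc n)
    +-homoℤ -[1+ m ] (+ n) = trans (⊖-homo n (suc m)) (+-comm _ _)
    +-homoℤ -[1+ m ] -[1+ n ] = begin
      - ιℕ (suc (suc (m ℕ.+ n)))       ≡⟨ ≡.cong (λ k → - ιℕ (suc k)) (≡.sym (ℕₚ.+-suc m n)) ⟩
      - ιℕ (suc m ℕ.+ suc n)           ≈⟨ -‿cong (×′-homo-+ 1# (suc m) (suc n)) ⟩
      - (ιℕ (suc m) + ιℕ (suc n))      ≈⟨ -‿+-comm _ _ ⟨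
      - ιℕ (suc m) + - ιℕ (suc n)      ∎

    -‿homoℤ : ∀ i → ιℤ (ℤ.- i) ≈ - ιℤ i
    -‿homoℤ (+ zero) = sym -0#≈0#
    -‿homoℤ (+ suc n) = refl
    -‿homoℤ -[1+ n ] = sym (-‿involutive _)

    *-homo-neg : ∀ n j → (∀ m → ιℤ (+ m ℤ.* j) ≈ ιℕ m * ιℤ j) → ιℤ (-[1+ n ] ℤ.* j) ≈ - ιℕ (suc n) * ιℤ j
    *-homo-neg n j pos = begin
      ιℤ (-[1+ n ] ℤ.* j)          ≡⟨ ≡.cong ιℤ (≡.sym (ℤₚ.neg-distribˡ-* (+ suc n) j)) ⟩
      ιℤ (ℤ.- (+ suc n ℤ.* j))     ≈⟨ -‿homoℤ (+ suc n ℤ.* j) ⟩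
      - ιℤ (+ suc n ℤ.* j)         ≈⟨ -‿cong (pos (suc n)) ⟩
      - (ιℕ (suc n) * ιℤ j)        ≈⟨ -‿distribˡ-* _ _ ⟩
      - ιℕ (suc n) * ιℤ j          ∎

    *-homo-pos : ∀ m j → ιℤ (+ m ℤ.* j) ≈ ιℕ m * ιℤ j
    *-homo-pos m (+ n) = trans (reflexive (≡.cong ιℤ (≡.sym (ℤₚ.pos-* m n)))) (×′1-homo-* m n)
    *-homo-pos m -[1+ n ] = begin
      ιℤ (+ m ℤ.* -[1+ n ])        ≡⟨ ≡.cong ιℤ (≡.sym (ℤₚ.neg-distribʳ-* (+ m) (+ suc n))) ⟩
      ιℤ (ℤ.- (+ m ℤ.* + suc n))   ≈⟨ -‿homoℤ (+ m ℤ.* + suc n) ⟩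
      - ιℤ (+ m ℤ.* + suc n)       ≈⟨ -‿cong (*-homo-pos m (+ suc n)) ⟩
      - (ιℕ m * ιℕ (suc n))        ≈⟨ -‿distribʳ-* _ _ ⟩
      ιℕ m * - ιℕ (suc n)          ∎

    *-homoℤ : ∀ i j → ιℤ (i ℤ.* j) ≈ ιℤ i * ιℤ j
    *-homoℤ (+ m) j = *-homo-pos m j
    *-homoℤ -[1+ m ] j = *-homo-neg m j (λ n → *-homo-pos n j)

    ℤ⟶R : ℤ.+-*-rawRing -Raw-AlmostCommutative⟶ fromCommutativeRing R
    ℤ⟶R = record
      { ⟦_⟧ = ιℤ ; +-homo = +-homoℤ ; *-homo = *-homoℤ ; -‿homo = -‿homoℤ ; 0-homo = refl ; 1-homo = refl }

    _≟ιℤ_ : ∀ i j → Maybe (ιℤ i ≈ ιℤ j)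
    i ≟ιℤ j with i ℤₚ.≟ j
    ... | yes i≡j = just (reflexive (≡.cong ιℤ i≡j))
    ... | no _ = nothing

  module Solver = Algebra.Solver.Ring ℤ.+-*-rawRing (fromCommutativeRing R) ℤ⟶R _≟ιℤ_

  open Solver public using (solve; _:=_; _:+_; _:*_; _:-_; :-_; con)

  open import Data.Integer.Base public using () renaming (+_ to pos)

  ∑ : ∀ {a} {A : Set a} → List A → (A → Carrier) → Carrier
  ∑ [] f = 0#
  ∑ (x ∷ xs) f = f x + ∑ xs f

  [_]· : Bool → Carrier → Carrier
  [ true ]· x = x
  [ false ]· x = 0#

  module _ {a} {A : Set a} where

    ∑-cong : (xs : List A) {f g : A → Carrier} → (∀ x → f x ≈ g x) → ∑ xs f ≈ ∑ xs g
    ∑-cong [] e = refl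
    ∑-cong (x ∷ xs) e = +-cong (e x) (∑-cong xs e)

    ∑-0 : (xs : List A) {f : A → Carrier} → (∀ x → f x ≈ 0#) → ∑ xs f ≈ 0#
    ∑-0 [] e = refl
    ∑-0 (x ∷ xs) e = trans (+-cong (e x) (∑-0 xs e)) (+-identityˡ 0#)

    ∑-+ : (xs : List A) (f g : A → Carrier) → ∑ xs (λ x → f x + g x) ≈ ∑ xs f + ∑ xs g
    ∑-+ [] f g = sym (+-identityˡ 0#)
    ∑-+ (x ∷ xs) f g = trans (+-congˡ (∑-+ xs f g))
      (solve 4 (λ p q r s → (p :+ q) :+ (r :+ s) := (p :+ r) :+ (q :+ s)) refl _ _ _ _)

    ∑-*ˡ : (xs : List A) (k : Carrier) (f : A → Carrier) → ∑ xs (λ x → k * f x) ≈ k * ∑ xs f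
    ∑-*ˡ [] k f = sym (zeroʳ k)
    ∑-*ˡ (x ∷ xs) k f = trans (+-congˡ (∑-*ˡ xs k f)) (sym (distribˡ k _ _))

    ∑-*ʳ : (xs : List A) (k : Carrier) (f : A → Carrier) → ∑ xs (λ x → f x * k) ≈ ∑ xs f * k
    ∑-*ʳ xs k f = trans (∑-cong xs (λ x → *-comm _ _)) (trans (∑-*ˡ xs k f) (*-comm _ _))

    ∑-++ : (xs ys : List A) (f : A → Carrier) → ∑ (xs ++ ys) f ≈ ∑ xs f + ∑ ys f
    ∑-++ [] ys f = sym (+-identityˡ _)
    ∑-++ (x ∷ xs) ys f = trans (+-congˡ (∑-++ xs ys f)) (sym (+-assoc _ _ _))

    ∑-filter : (p : A → Bool) (xs : List A) (f : A → Carrier) → ∑ (filterᵇ p xs) f ≈ ∑ xs (λ x → [ p x ]· (f x))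
    ∑-filter p [] f = refl
    ∑-filter p (x ∷ xs) f with p x
    ... | true = +-congˡ (∑-filter p xs f)
    ... | false = trans (∑-filter p xs f) (sym (+-identityˡ _))

  ∑-map : ∀ {a b} {A : Set a} {B : Set b} (g : B → A) (xs : List B) (f : A → Carrier) → ∑ (map g xs) f ≈ ∑ xs (λ x → f (g x))
  ∑-map g [] f = refl
  ∑-map g (x ∷ xs) f = +-congˡ (∑-map g xs f)

  ∑-concatMap : ∀ {a b} {A : Set a} {B : Set b} (g : B → List A) (xs : List B) (f : A → Carrier) →
    ∑ (concatMap g xs) f ≈ ∑ xs (λ x → ∑ (g x) f)
  ∑-concatMap g [] f = refl
  ∑-concatMap g (x ∷ xs) f = trans (∑-++ (g x) _ f) (+-congˡ (∑-concatMap g xs f))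

  ∑-swap : ∀ {a b} {A : Set a} {B : Set b} (xs : List A) (ys : List B) (f : A → B → Carrier) →
    ∑ xs (λ x → ∑ ys (f x)) ≈ ∑ ys (λ y → ∑ xs (λ x → f x y))
  ∑-swap [] ys f = sym (∑-0 ys (λ _ → refl))
  ∑-swap (x ∷ xs) ys f = trans (+-congˡ (∑-swap xs ys f)) (sym (∑-+ ys _ _))

  ∑< : ℕ → (ℕ → Carrier) → Carrier
  ∑< zero f = 0#
  ∑< (suc n) f = f 0 + ∑< n (λ i → f (suc i))

  ∑-applyUpTo : ∀ {a} {A : Set a} (g : ℕ → A) n (f : A → Carrier) → ∑ (applyUpTo g n) f ≈ ∑< n (λ i → f (g i))
  ∑-applyUpTo g zero f = refl
  ∑-applyUpTo g (suc n) f = +-congˡ (∑-applyUpTo (λ i → g (suc i)) n f)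

  ∑-upTo : ∀ n (f : ℕ → Carrier) → ∑ (upTo n) f ≈ ∑< n f
  ∑-upTo = ∑-applyUpTo id

  ∑<-cong : ∀ n {f g : ℕ → Carrier} → (∀ i → i ℕ.< n → f i ≈ g i) → ∑< n f ≈ ∑< n g
  ∑<-cong zero e = refl
  ∑<-cong (suc n) e = +-cong (e 0 (ℕ.s≤s ℕ.z≤n)) (∑<-cong n (λ i i<n → e (suc i) (ℕ.s≤s i<n)))

  ∑<-cong′ : ∀ n {f g : ℕ → Carrier} → (∀ i → f i ≈ g i) → ∑< n f ≈ ∑< n g
  ∑<-cong′ n e = ∑<-cong n (λ i _ → e i)

  ∑<-0 : ∀ n {f : ℕ → Carrier} → (∀ i → i ℕ.< n → f i ≈ 0#) → ∑< n f ≈ 0#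
  ∑<-0 zero e = refl
  ∑<-0 (suc n) e = trans (+-cong (e 0 (ℕ.s≤s ℕ.z≤n)) (∑<-0 n (λ i i<n → e (suc i) (ℕ.s≤s i<n)))) (+-identityˡ 0#)

  ∑<-+ : ∀ n (f g : ℕ → Carrier) → ∑< n (λ i → f i + g i) ≈ ∑< n f + ∑< n g
  ∑<-+ n f g = trans (sym (∑-upTo n _)) (trans (∑-+ (upTo n) f g) (+-cong (∑-upTo n f) (∑-upTo n g)))

  ∑<-*ˡ : ∀ n k (f : ℕ → Carrier) → ∑< n (λ i → k * f i) ≈ k * ∑< n f
  ∑<-*ˡ n k f = trans (sym (∑-upTo n _)) (trans (∑-*ˡ (upTo n) k f) (*-congˡ (∑-upTo n f)))

  ∑<-last : ∀ n (f : ℕ → Carrier) → ∑< (suc n) f ≈ ∑< n f + f n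
  ∑<-last zero f = +-comm _ _
  ∑<-last (suc n) f = trans (+-congˡ (∑<-last n (λ i → f (suc i)))) (sym (+-assoc _ _ _))

  ∑<-∑-swap : ∀ {a} {A : Set a} n (xs : List A) (f : ℕ → A → Carrier) →
    ∑< n (λ i → ∑ xs (f i)) ≈ ∑ xs (λ x → ∑< n (λ i → f i x))
  ∑<-∑-swap n xs f = trans (sym (∑-upTo n _)) (trans (∑-swap (upTo n) xs f) (∑-cong xs (λ x → ∑-upTo n (λ i → f i x))))

  []·-cong : ∀ b {x y} → x ≈ y → [ b ]· x ≈ [ b ]· y
  []·-cong true e = e
  []·-cong false e = refl

  []·-*ˡ : ∀ b k x → [ b ]· (k * x) ≈ k * [ b ]· x
  []·-*ˡ true k x = refl
  []·-*ˡ false k x = sym (zeroʳ k)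

  []·-∧ : ∀ b d x → [ b ∧ d ]· x ≈ [ b ]· ([ d ]· x)
  []·-∧ true d x = refl
  []·-∧ false d x = refl

  []·-∧-swap : ∀ b d x → [ b ∧ d ]· x ≈ [ d ]· ([ b ]· x)
  []·-∧-swap true d x = refl
  []·-∧-swap false true x = refl
  []·-∧-swap false false x = refl

  []·-0 : ∀ b → [ b ]· 0# ≈ 0#
  []·-0 true = refl
  []·-0 false = refl

  ×-zeroʳ : ∀ n → n × 0# ≈ 0#
  ×-zeroʳ zero = refl
  ×-zeroʳ (suc n) = trans (+-identityˡ _) (×-zeroʳ n)

  1^ : ∀ n → 1# ^ n ≈ 1#
  1^ zero = refl
  1^ (suc n) = trans (*-identityˡ _) (1^ n)

  inverse-^ : ∀ {d e} n → d * e ≈ 1# → d ^ n * e ^ n ≈ 1#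
  inverse-^ {d} {e} n de = trans (sym (^-distrib-* d e n)) (trans (^-congˡ n de) (1^ n))

-- Formal power series in one variable.

module PowerSeries {c ℓ : Level} (R : CommutativeRing c ℓ) where

  open import Data.Product.Base using (_,_)
  open RingKit R

  infixl 7 _⋆_

  -- The Cauchy product, by recursion on the degree that splits off the constant term of the left
  -- factor. The ring laws become inductions without reindexing; `⋆-∑<` recovers the usual sum.
  _⋆_ : (ℕ → Carrier) → (ℕ → Carrier) → ℕ → Carrier
  (f ⋆ g) zero = f 0 * g 0
  (f ⋆ g) (suc n) = f 0 * g (suc n) + ((λ i → f (suc i)) ⋆ g) n

  one : ℕ → Carrier
  one zero = 1#
  one (suc n) = 0#

  ⋆-cong : ∀ {f f′ g g′ : ℕ → Carrier} → (∀ i → f i ≈ f′ i) → (∀ i → g i ≈ g′ i) → ∀ n → (f ⋆ g) n ≈ (f′ ⋆ g′) n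
  ⋆-cong p q zero = *-cong (p 0) (q 0)
  ⋆-cong p q (suc n) = +-cong (*-cong (p 0) (q (suc n))) (⋆-cong (λ i → p (suc i)) q n)

  ⋆-zeroˡ : ∀ {f : ℕ → Carrier} g → (∀ i → f i ≈ 0#) → ∀ n → (f ⋆ g) n ≈ 0#
  ⋆-zeroˡ g z zero = trans (*-congʳ (z 0)) (zeroˡ _)
  ⋆-zeroˡ g z (suc n) = trans (+-cong (trans (*-congʳ (z 0)) (zeroˡ _)) (⋆-zeroˡ g (λ i → z (suc i)) n)) (+-identityˡ 0#)

  ⋆-distribʳ : ∀ f g h n → ((λ i → f i + g i) ⋆ h) n ≈ (f ⋆ h) n + (g ⋆ h) n
  ⋆-distribʳ f g h zero = distribʳ _ _ _
  ⋆-distribʳ f g h (suc n) = trans (+-congˡ (⋆-distribʳ (λ i → f (suc i)) (λ i → g (suc i)) h n))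
    (solve 5 (λ a b c p q → (a :+ b) :* c :+ (p :+ q) := (a :* c :+ p) :+ (b :* c :+ q)) refl _ _ _ _ _)

  ⋆-scaleˡ : ∀ k f g n → ((λ i → k * f i) ⋆ g) n ≈ k * (f ⋆ g) n
  ⋆-scaleˡ k f g zero = *-assoc _ _ _
  ⋆-scaleˡ k f g (suc n) = trans (+-congˡ (⋆-scaleˡ k (λ i → f (suc i)) g n))
    (solve 4 (λ k a b p → k :* a :* b :+ k :* p := k :* (a :* b :+ p)) refl _ _ _ _)

  -- The mirror image of the defining recursion, splitting off the constant term of the right
  -- factor; commutativity is the comparison of the two.
  ⋆-last : ∀ f g n → (f ⋆ g) (suc n) ≈ (f ⋆ (λ i → g (suc i))) n + f (suc n) * g 0
  ⋆-last f g zero = refl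
  ⋆-last f g (suc n) = trans (+-congˡ (⋆-last (λ i → f (suc i)) g n)) (sym (+-assoc _ _ _))

  ⋆-comm : ∀ f g n → (f ⋆ g) n ≈ (g ⋆ f) n
  ⋆-comm f g zero = *-comm _ _
  ⋆-comm f g (suc n) = begin
    f 0 * g (suc n) + ((λ i → f (suc i)) ⋆ g) n  ≈⟨ +-cong (*-comm _ _) (⋆-comm (λ i → f (suc i)) g n) ⟩
    g (suc n) * f 0 + (g ⋆ (λ i → f (suc i))) n  ≈⟨ +-comm _ _ ⟩
    (g ⋆ (λ i → f (suc i))) n + g (suc n) * f 0  ≈⟨ ⋆-last g f n ⟨
    (g ⋆ f) (suc n)                              ∎

  ⋆-assoc : ∀ f g h n → ((f ⋆ g) ⋆ h) n ≈ (f ⋆ (g ⋆ h)) n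
  ⋆-assoc f g h zero = *-assoc _ _ _
  ⋆-assoc f g h (suc n) = begin
    f 0 * g 0 * h (suc n) + ((λ i → f 0 * g (suc i) + (f′ ⋆ g) i) ⋆ h) n
      ≈⟨ +-congˡ (⋆-distribʳ (λ i → f 0 * g (suc i)) (f′ ⋆ g) h n) ⟩
    f 0 * g 0 * h (suc n) + (((λ i → f 0 * g (suc i)) ⋆ h) n + ((f′ ⋆ g) ⋆ h) n)
      ≈⟨ +-congˡ (+-cong (⋆-scaleˡ (f 0) (λ i → g (suc i)) h n) (⋆-assoc f′ g h n)) ⟩
    f 0 * g 0 * h (suc n) + (f 0 * ((λ i → g (suc i)) ⋆ h) n + (f′ ⋆ (g ⋆ h)) n)
      ≈⟨ solve 5 (λ a b c p q → a :* b :* c :+ (a :* p :+ q) := a :* (b :* c :+ p) :+ q) refl _ _ _ _ _ ⟩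
    f 0 * (g 0 * h (suc n) + ((λ i → g (suc i)) ⋆ h) n) + (f′ ⋆ (g ⋆ h)) n ∎
    where f′ : ℕ → Carrier
          f′ i = f (suc i)

  ⋆-identityˡ : ∀ f n → (one ⋆ f) n ≈ f n
  ⋆-identityˡ f zero = *-identityˡ _
  ⋆-identityˡ f (suc n) = trans (+-cong (*-identityˡ _) (⋆-zeroˡ f (λ _ → refl) n)) (+-identityʳ _)

  ⋆-∑< : ∀ f g n → (f ⋆ g) n ≈ ∑< (suc n) (λ i → f i * g (n ∸ i))
  ⋆-∑< f g zero = sym (+-identityʳ _)
  ⋆-∑< f g (suc n) = +-congˡ (⋆-∑< (λ i → f (suc i)) g n)

  powerSeries : CommutativeRing c ℓ
  powerSeries = record
    { Carrier = ℕ → Carrier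
    ; _≈_ = λ f g → ∀ n → f n ≈ g n
    ; _+_ = λ f g n → f n + g n
    ; _*_ = _⋆_
    ; -_ = λ f n → - f n
    ; 0# = λ _ → 0#
    ; 1# = one
    ; isCommutativeRing = record
      { isRing = record
        { +-isAbelianGroup = record
          { isGroup = record
            { isMonoid = record
              { isSemigroup = record
                { isMagma = record
                  { isEquivalence = record
                    { refl = λ _ → refl ; sym = λ p n → sym (p n) ; trans = λ p q n → trans (p n) (q n) }
                  ; ∙-cong = λ p q n → +-cong (p n) (q n) }
                ; assoc = λ f g h n → +-assoc _ _ _ }
              ; identity = (λ f n → +-identityˡ _) , (λ f n → +-identityʳ _) }
            ; inverse = (λ f n → -‿inverseˡ _) , (λ f n → -‿inverseʳ _)
            ; ⁻¹-cong = λ p n → -‿cong (p n) }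
          ; comm = λ f g n → +-comm _ _ }
        ; *-cong = ⋆-cong
        ; *-assoc = ⋆-assoc
        ; *-identity = ⋆-identityˡ , (λ f n → trans (⋆-comm f one n) (⋆-identityˡ f n))
        ; distrib = (λ f g h n → trans (⋆-comm f _ n) (trans (⋆-distribʳ g h f n) (+-cong (⋆-comm g f n) (⋆-comm h f n))))
                  , (λ f g h → ⋆-distribʳ g h f) }
      ; *-comm = ⋆-comm } }

  C : Carrier → ℕ → Carrier
  C a zero = a
  C a (suc n) = 0#

  X· : (ℕ → Carrier) → ℕ → Carrier
  X· f zero = 0#
  X· f (suc n) = f n

-- Permutations, signed letters and compatible labellings.

module WordLemmas where

  open import Data.Bool.Base using (T)
  open import Data.Bool.Properties using (not-injective)
  import Data.List.Properties as Listₚ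
  open import Data.Product.Base using (_×_; _,_; proj₁; proj₂; ∃₂)
  open import Data.Sum.Base using (inj₁; inj₂)
  open import Data.Empty using (⊥; ⊥-elim)
  open import Relation.Binary.Definitions using (tri<; tri≈; tri>)
  open import Defs using (distinct; notElem; indexOf; inverse)

  -- The increasing map that skips the value p: it makes room for a new letter p in a word.
  bump : ℕ → ℕ → ℕ
  bump zero i = suc i
  bump (suc p) zero = zero
  bump (suc p) (suc i) = suc (bump p i)

  insertAt : ∀ {a} {A : Set a} → ℕ → A → List A → List A
  insertAt zero x l = x ∷ l
  insertAt (suc p) x [] = x ∷ []
  insertAt (suc p) x (y ∷ l) = y ∷ insertAt p x l

  ≡ᵇ-refl : ∀ p → (p ≡ᵇ p) ≡ true
  ≡ᵇ-refl zero = ≡.refl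
  ≡ᵇ-refl (suc p) = ≡ᵇ-refl p

  bump-≡ᵇ : ∀ p i j → (bump p i ≡ᵇ bump p j) ≡ (i ≡ᵇ j)
  bump-≡ᵇ zero i j = ≡.refl
  bump-≡ᵇ (suc p) zero zero = ≡.refl
  bump-≡ᵇ (suc p) zero (suc j) = ≡.refl
  bump-≡ᵇ (suc p) (suc i) zero = ≡.refl
  bump-≡ᵇ (suc p) (suc i) (suc j) = bump-≡ᵇ p i j

  bump-<ᵇ : ∀ p i j → (bump p i <ᵇ bump p j) ≡ (i <ᵇ j)
  bump-<ᵇ zero i j = ≡.refl
  bump-<ᵇ (suc p) zero zero = ≡.refl
  bump-<ᵇ (suc p) zero (suc j) = ≡.refl
  bump-<ᵇ (suc p) (suc i) zero = ≡.refl
  bump-<ᵇ (suc p) (suc i) (suc j) = bump-<ᵇ p i j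

  bump-≢ : ∀ p i → (bump p i ≡ᵇ p) ≡ false
  bump-≢ zero i = ≡.refl
  bump-≢ (suc p) zero = ≡.refl
  bump-≢ (suc p) (suc i) = bump-≢ p i

  bump-≢′ : ∀ p i → (p ≡ᵇ bump p i) ≡ false
  bump-≢′ zero i = ≡.refl
  bump-≢′ (suc p) zero = ≡.refl
  bump-≢′ (suc p) (suc i) = bump-≢′ p i

  notElem-bump : ∀ p i w → notElem (bump p i) (map (bump p) w) ≡ notElem i w
  notElem-bump p i [] = ≡.refl
  notElem-bump p i (j ∷ w) rewrite bump-≡ᵇ p i j | notElem-bump p i w = ≡.refl

  notElem-bumped : ∀ p w → notElem p (map (bump p) w) ≡ true
  notElem-bumped p [] = ≡.refl
  notElem-bumped p (j ∷ w) rewrite bump-≢′ p j = notElem-bumped p w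

  distinct-bump : ∀ p w → distinct (map (bump p) w) ≡ distinct w
  distinct-bump p [] = ≡.refl
  distinct-bump p (i ∷ w) = cong₂ _∧_ (notElem-bump p i w) (distinct-bump p w)

  notElem-insertAt-0 : ∀ p i w → notElem (suc i) (insertAt p 0 (map suc w)) ≡ notElem i w
  notElem-insertAt-0 zero i w = notElem-bump 0 i w
  notElem-insertAt-0 (suc p) i [] = ≡.refl
  notElem-insertAt-0 (suc p) i (j ∷ w) rewrite notElem-insertAt-0 p i w = ≡.refl

  distinct-insertAt-0 : ∀ p w → distinct (insertAt p 0 (map suc w)) ≡ distinct w
  distinct-insertAt-0 zero w = cong₂ _∧_ (notElem-bumped 0 w) (distinct-bump 0 w)
  distinct-insertAt-0 (suc p) [] = ≡.refl
  distinct-insertAt-0 (suc p) (i ∷ w) = cong₂ _∧_ (notElem-insertAt-0 p i w) (distinct-insertAt-0 p w)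

  -- A permutation is given by its first letter and the standardized remainder, as in a Lehmer code.
  -- Taking off the first letter corresponds to taking the letter 0 out of the inverse.
  data Perm : ℕ → List ℕ → Set where
    [] : Perm 0 []
    _∷_ : ∀ {n p w} → p ℕ.≤ n → Perm n w → Perm (suc n) (p ∷ map (bump p) w)

  Perm-length : ∀ {n w} → Perm n w → length w ≡ n
  Perm-length [] = ≡.refl
  Perm-length (_∷_ {p = p} {w} _ π) = cong suc (≡.trans (Listₚ.length-map (bump p) w) (Perm-length π))

  Perm-distinct : ∀ {n w} → Perm n w → distinct w ≡ true
  Perm-distinct [] = ≡.refl
  Perm-distinct (_∷_ {p = p} {w} _ π) = cong₂ _∧_ (notElem-bumped p w) (≡.trans (distinct-bump p w) (Perm-distinct π))

  indexOf-bump : ∀ p j w → indexOf (bump p j) (map (bump p) w) ≡ indexOf j w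
  indexOf-bump p j [] = ≡.refl
  indexOf-bump p j (i ∷ w) rewrite bump-≡ᵇ p j i | indexOf-bump p j w = ≡.refl

  applyUpTo-insertAt : ∀ {a} {A : Set a} (F : ℕ → A) {p n} → p ℕ.≤ n →
    applyUpTo F (suc n) ≡ insertAt p (F p) (applyUpTo (λ j → F (bump p j)) n)
  applyUpTo-insertAt F z≤n = ≡.refl
  applyUpTo-insertAt F (s≤s p≤n) = cong (F 0 ∷_) (applyUpTo-insertAt (λ i → F (suc i)) p≤n)

  applyUpTo-cong : ∀ {a} {A : Set a} {F G : ℕ → A} n → (∀ i → F i ≡ G i) → applyUpTo F n ≡ applyUpTo G n
  applyUpTo-cong zero e = ≡.refl
  applyUpTo-cong (suc n) e = cong₂ _∷_ (e 0) (applyUpTo-cong n (λ i → e (suc i)))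

  -- The letter p stands in front, which puts the entry 0 at place p of the inverse; every other
  -- letter has moved one place to the right, which raises the old entries by one.
  inverse-∷ : ∀ {n p} w → p ℕ.≤ n → length w ≡ n → inverse (p ∷ map (bump p) w) ≡ insertAt p 0 (map suc (inverse w))
  inverse-∷ {n} {p} w p≤n ≡.refl = begin
    map F (upTo (length π))                                ≡⟨ cong (λ k → map F (upTo (suc k))) (Listₚ.length-map (bump p) w) ⟩
    map F (upTo (suc n))                                   ≡⟨ Listₚ.map-upTo F (suc n) ⟩
    applyUpTo F (suc n)                                    ≡⟨ applyUpTo-insertAt F p≤n ⟩
    insertAt p (F p) (applyUpTo (λ j → F (bump p j)) n)    ≡⟨ cong₂ (insertAt p) Fp (applyUpTo-cong n Fbump) ⟩
    insertAt p 0 (applyUpTo (λ j → suc (indexOf j w)) n)   ≡⟨ cong (insertAt p 0) (Listₚ.map-applyUpTo (λ j → indexOf j w) suc n) ⟨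
    insertAt p 0 (map suc (applyUpTo (λ j → indexOf j w) n)) ≡⟨ cong (λ l → insertAt p 0 (map suc l)) (Listₚ.map-upTo (λ j → indexOf j w) n) ⟨
    insertAt p 0 (map suc (inverse w))                     ∎
    where
    open ≡.≡-Reasoning
    π : List ℕ
    π = p ∷ map (bump p) w
    F : ℕ → ℕ
    F j = indexOf j π
    Fp : F p ≡ 0
    Fp rewrite ≡ᵇ-refl p = ≡.refl
    Fbump : ∀ j → F (bump p j) ≡ suc (indexOf j w)
    Fbump j rewrite bump-≢ p j | indexOf-bump p j w = ≡.refl

  inverse-length : ∀ w → length (inverse w) ≡ length w
  inverse-length w = ≡.trans (Listₚ.length-map _ (upTo (length w))) (Listₚ.length-upTo (length w))

  inverse-distinct : ∀ {n w} → Perm n w → distinct (inverse w) ≡ true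
  inverse-distinct [] = ≡.refl
  inverse-distinct (_∷_ {p = p} {w} p≤n π) =
    ≡.trans (cong distinct (inverse-∷ w p≤n (Perm-length π))) (≡.trans (distinct-insertAt-0 p (inverse w)) (inverse-distinct π))

  -- The letters 0, 1, 2, 3, … stand for -1 < 1 < -2 < 2 < …, so that odd letters are the positive ones.
  positive : ℕ → Bool
  positive zero = false
  positive (suc zero) = true
  positive (suc (suc n)) = positive n

  agree : ℕ → Bool → Bool
  agree d t = if positive d then t else not t

  -- The flag t says whether the labelled word ascends. As a relation on letters, `step true` is
  -- also the ascent relation for words in signed letters, where equal positive letters count as an
  -- ascent and equal negative ones as a descent. This double role lets the labels of π⁻¹ become the
  -- letters of a word.
  step : Bool → ℕ → ℕ → Bool
  step t d e = if agree d t then d ≤ᵇ e else d <ᵇ e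

  double : ℕ → ℕ
  double zero = 0
  double (suc j) = suc (suc (double j))

  compatible : ∀ {a} {A : Set a} → (A → A → Bool) → List ℕ → List A → Bool
  compatible r [] _ = true
  compatible r (d ∷ []) _ = true
  compatible r (d ∷ e ∷ v) [] = true
  compatible r (d ∷ e ∷ v) (x ∷ []) = true
  compatible r (d ∷ e ∷ v) (x ∷ y ∷ w) = step (r x y) d e ∧ compatible r (e ∷ v) (y ∷ w)

  -- Turns v into a function of positions, so that `map (at v) π` is v ∘ π. The value 0 past the end
  -- is not reached when π permutes the positions of v.
  at : List ℕ → ℕ → ℕ
  at [] _ = 0
  at (d ∷ v) zero = d
  at (d ∷ v) (suc k) = at v k

  at-insertAt : ∀ p d v → p ℕ.≤ length v → at (insertAt p d v) p ≡ d
  at-insertAt zero d v _ = ≡.refl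
  at-insertAt (suc p) d (e ∷ v) (s≤s h) = at-insertAt p d v h

  at-insertAt-bump : ∀ p d v k → p ℕ.≤ length v → at (insertAt p d v) (bump p k) ≡ at v k
  at-insertAt-bump zero d v k _ = ≡.refl
  at-insertAt-bump (suc p) d (e ∷ v) zero _ = ≡.refl
  at-insertAt-bump (suc p) d (e ∷ v) (suc k) (s≤s h) = at-insertAt-bump p d v k h

  pick-insertAt : ∀ p d v w → p ℕ.≤ length v → map (at (insertAt p d v)) (p ∷ map (bump p) w) ≡ d ∷ map (at v) w
  pick-insertAt p d v w h = cong₂ _∷_ (at-insertAt p d v h)
    (≡.trans (≡.sym (Listₚ.map-∘ w)) (Listₚ.map-cong (λ k → at-insertAt-bump p d v k h) w))

  insertAt-split : ∀ p (v : List ℕ) n → length v ≡ suc n → p ℕ.≤ n → ∃₂ λ (d : ℕ) (v′ : List ℕ) → v ≡ insertAt p d v′ × length v′ ≡ n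
  insertAt-split zero (d ∷ v) n eq _ = d , v , ≡.refl , ℕₚ.suc-injective eq
  insertAt-split (suc p) (d ∷ v) (suc n) eq (s≤s h) with insertAt-split p v n (ℕₚ.suc-injective eq) h
  ... | e , v′ , ≡.refl , eq′ = e , d ∷ v′ , ≡.refl , cong suc eq′

  true≢false : ∀ {b} → b ≡ true → b ≡ false → ⊥
  true≢false ≡.refl ()

  ∧-trueˡ : ∀ {a b} → (a ∧ b) ≡ true → a ≡ true
  ∧-trueˡ {true} _ = ≡.refl

  ∧-trueʳ : ∀ {a b} → (a ∧ b) ≡ true → b ≡ true
  ∧-trueʳ {true} p = p

  ≤ᵇ-true : ∀ {d e} → d ℕ.≤ e → (d ≤ᵇ e) ≡ true
  ≤ᵇ-true {d} {e} h = T⇒≡ (ℕₚ.≤⇒≤ᵇ h)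
    where
    T⇒≡ : ∀ {b} → T b → b ≡ true
    T⇒≡ {true} _ = ≡.refl

  ≤ᵇ-false : ∀ {d e} → d ℕ.< e → (e ≤ᵇ d) ≡ false
  ≤ᵇ-false {d} {e} h with e ≤ᵇ d in q
  ... | true = ⊥-elim (ℕₚ.<⇒≱ h (ℕₚ.≤ᵇ⇒≤ e d (≡.subst T (≡.sym q) _)))
  ... | false = ≡.refl

  <ᵇ-true : ∀ {d e} → d ℕ.< e → (d <ᵇ e) ≡ true
  <ᵇ-true = ≤ᵇ-true

  <ᵇ-false : ∀ {d e} → d ℕ.≤ e → (e <ᵇ d) ≡ false
  <ᵇ-false h = ≤ᵇ-false (s≤s h)

  step-< : ∀ t {d e} → d ℕ.< e → step t d e ≡ true
  step-< t {d} h with agree d t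
  ... | true = ≤ᵇ-true (ℕₚ.<⇒≤ h)
  ... | false = <ᵇ-true h

  step-> : ∀ t {d e} → e ℕ.< d → step t d e ≡ false
  step-> t {d} h with agree d t
  ... | true = ≤ᵇ-false h
  ... | false = <ᵇ-false (ℕₚ.<⇒≤ h)

  step-≤ : ∀ t d e → step t d e ≡ true → d ℕ.≤ e
  step-≤ t d e s with ℕₚ.<-cmp d e
  ... | tri< d<e _ _ = ℕₚ.<⇒≤ d<e
  ... | tri≈ _ d≡e _ = ℕₚ.≤-reflexive d≡e
  ... | tri> _ _ d>e = ⊥-elim (true≢false s (step-> t d>e))

  -- For different letters both sides compare sizes; for equal ones the sign decides, as a
  -- repetition is allowed at ascents precisely when it is forbidden at descents. Hence every letter
  -- lies on exactly one side of a given one.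
  step-compl : ∀ d e → step false d e ≡ not (step true e d)
  step-compl d e with ℕₚ.<-cmp d e
  ... | tri< d<e _ _ = ≡.trans (step-< false d<e) (≡.sym (cong not (step-> true d<e)))
  ... | tri> _ _ d>e = ≡.trans (step-> false d>e) (≡.sym (cong not (step-< true d>e)))
  ... | tri≈ _ ≡.refl _ with positive d
  ...   | true = ≡.trans (<ᵇ-false {d} ℕₚ.≤-refl) (≡.sym (cong not (≤ᵇ-true {d} ℕₚ.≤-refl)))
  ...   | false = ≡.trans (≤ᵇ-true {d} ℕₚ.≤-refl) (≡.sym (cong not (<ᵇ-false {d} ℕₚ.≤-refl)))

  step-false⇒ : ∀ d e → step false d e ≡ true → step true e d ≡ false
  step-false⇒ d e s with step true e d | step-compl d e
  ... | true | q = ⊥-elim (true≢false s q)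
  ... | false | _ = ≡.refl

  -- Equality throughout would allow the same letter to be repeated both at a descent and at an
  -- ascent.
  step-strict : ∀ d k e → step false d k ≡ true → step true k e ≡ true → d ℕ.< e
  step-strict d k e s s′ with ℕₚ.m≤n⇒m<n∨m≡n (ℕₚ.≤-trans (step-≤ false d k s) (step-≤ true k e s′))
  ... | inj₁ d<e = d<e
  ... | inj₂ ≡.refl = ⊥-elim (true≢false s′ (step-false⇒ d k s))

  step-false-mono : ∀ d e k → d ℕ.≤ e → step false e k ≡ true → step false d k ≡ true
  step-false-mono d e k d≤e s with ℕₚ.m≤n⇒m<n∨m≡n d≤e
  ... | inj₁ d<e = step-< false (ℕₚ.<-≤-trans d<e (step-≤ false e k s))
  ... | inj₂ ≡.refl = s

  step-true-mono : ∀ k d e → step true k d ≡ true → d ℕ.≤ e → step true k e ≡ true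
  step-true-mono k d e s d≤e with ℕₚ.m≤n⇒m<n∨m≡n d≤e
  ... | inj₁ d<e = step-< true (ℕₚ.≤-<-trans (step-≤ true k d s) d<e)
  ... | inj₂ ≡.refl = s

  compatible-suc : ∀ v w → compatible _<ᵇ_ v (map suc w) ≡ compatible _<ᵇ_ v w
  compatible-suc [] w = ≡.refl
  compatible-suc (d ∷ []) w = ≡.refl
  compatible-suc (d ∷ e ∷ v) [] = ≡.refl
  compatible-suc (d ∷ e ∷ v) (x ∷ []) = ≡.refl
  compatible-suc (d ∷ e ∷ v) (x ∷ y ∷ w) = cong (step (x <ᵇ y) d e ∧_) (compatible-suc (e ∷ v) (y ∷ w))

  -- The letter 0 lies below all letters of `map suc w`, so the step into it is a descent and the
  -- step out of it an ascent. By `step-strict` the labels on both sides of k then differ, and the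
  -- step that joins them after the deletion is allowed in either direction. The first component
  -- carries the bound by k back to the head d.
  compatible-delete : ∀ p k d v x w → length v ≡ length w →
    compatible _<ᵇ_ (d ∷ insertAt p k v) (suc x ∷ insertAt p 0 (map suc w)) ≡ true →
    step false d k ≡ true × compatible _<ᵇ_ (d ∷ v) (x ∷ w) ≡ true
  compatible-delete zero k d [] x [] eq h = ∧-trueˡ h , ≡.refl
  compatible-delete (suc p) k d [] x [] eq h = ∧-trueˡ h , ≡.refl
  compatible-delete zero k d (e ∷ v) x (y ∷ w) eq h = s , cong₂ _∧_ (step-< (x <ᵇ y) (step-strict d k e s s′)) c
    where
    s : step false d k ≡ true
    s = ∧-trueˡ h
    s′ : step true k e ≡ true
    s′ = ∧-trueˡ (∧-trueʳ {step false d k} h)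
    c : compatible _<ᵇ_ (e ∷ v) (y ∷ w) ≡ true
    c = ≡.trans (≡.sym (compatible-suc (e ∷ v) (y ∷ w))) (∧-trueʳ {step true k e} (∧-trueʳ {step false d k} h))
  compatible-delete (suc p) k d (e ∷ v) x (y ∷ w) eq h
    with compatible-delete p k e v y w (ℕₚ.suc-injective eq) (∧-trueʳ {step (x <ᵇ y) d e} h)
  ... | s , c = step-false-mono d e k (step-≤ _ d e (∧-trueˡ h)) s , cong₂ _∧_ (∧-trueˡ h) c

  compatible-delete′ : ∀ p k v w → length v ≡ length w →
    compatible _<ᵇ_ (insertAt p k v) (insertAt p 0 (map suc w)) ≡ true → compatible _<ᵇ_ v w ≡ true
  compatible-delete′ p k [] [] eq h = ≡.refl
  compatible-delete′ zero k (d ∷ v) (x ∷ w) eq h =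
    ≡.trans (≡.sym (compatible-suc (d ∷ v) (x ∷ w))) (∧-trueʳ {step true k d} h)
  compatible-delete′ (suc p) k (d ∷ v) (x ∷ w) eq h = proj₂ (compatible-delete p k d v x w (ℕₚ.suc-injective eq) h)

  compatible-≤ : ∀ k d v x w i → length v ≡ length w → i ℕ.≤ length v → step true k d ≡ true →
    compatible _<ᵇ_ (d ∷ v) (x ∷ w) ≡ true → step true k (at (d ∷ v) i) ≡ true
  compatible-≤ k d v x w zero eq h s c = s
  compatible-≤ k d (e ∷ v) x (y ∷ w) (suc i) eq (s≤s h) s c =
    compatible-≤ k e v y w i (ℕₚ.suc-injective eq) h (step-true-mono k d e s (step-≤ _ d e (∧-trueˡ c))) (∧-trueʳ {step (x <ᵇ y) d e} c)

  -- Labels increase along v, with a descent before the inserted 0 and an ascent after it, so the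
  -- labels before place p lie on one side of k and those after it on the other. Comparing labels by
  -- `step true` thus amounts to comparing positions; `bump p i` is the position of `at v i` after
  -- the insertion.
  compatible-order : ∀ p k v w i → length v ≡ length w → i ℕ.< length v →
    compatible _<ᵇ_ (insertAt p k v) (insertAt p 0 (map suc w)) ≡ true → step true k (at v i) ≡ (p <ᵇ bump p i)
  compatible-order zero k (d ∷ v) (x ∷ w) i eq (s≤s h) c =
    compatible-≤ k d v x w i (ℕₚ.suc-injective eq) h (∧-trueˡ c)
      (≡.trans (≡.sym (compatible-suc (d ∷ v) (x ∷ w))) (∧-trueʳ {step true k d} c))
  compatible-order (suc p) k (d ∷ v) (x ∷ w) zero eq h c =
    step-false⇒ d k (proj₁ (compatible-delete p k d v x w (ℕₚ.suc-injective eq) c))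
  compatible-order (suc p) k (d ∷ v) (x ∷ w) (suc i) eq (s≤s h) c =
    compatible-order p k v w i (ℕₚ.suc-injective eq) h (tail-compatible (insertAt p k v) (insertAt p 0 (map suc w)) c)
    where
    tail-compatible : ∀ v w → compatible _<ᵇ_ (d ∷ v) (suc x ∷ w) ≡ true → compatible _<ᵇ_ v w ≡ true
    tail-compatible [] w h = ≡.refl
    tail-compatible (e ∷ []) w h = ≡.refl
    tail-compatible (e ∷ f ∷ v) [] h = ≡.refl
    tail-compatible (e ∷ f ∷ v) (y ∷ w) h = ∧-trueʳ {step (suc x <ᵇ y) d e} h

  -- Only neighbours are compared, which is all that `layers` inspects, and the two words may use
  -- different alphabets.
  data SamePattern {a b} {A : Set a} {B : Set b} (r : A → A → Bool) (r′ : B → B → Bool) : List A → List B → Set (a ⊔ b) where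
    [] : SamePattern r r′ [] []
    [-] : ∀ {x x′} → SamePattern r r′ (x ∷ []) (x′ ∷ [])
    _∷_ : ∀ {x y w x′ y′ w′} → r x y ≡ r′ x′ y′ → SamePattern r r′ (y ∷ w) (y′ ∷ w′) →
          SamePattern r r′ (x ∷ y ∷ w) (x′ ∷ y′ ∷ w′)

  SamePattern-bump : ∀ {a} {A : Set a} {r : A → A → Bool} p {v w} →
    SamePattern r _<ᵇ_ v w → SamePattern r _<ᵇ_ v (map (bump p) w)
  SamePattern-bump p [] = []
  SamePattern-bump p [-] = [-]
  SamePattern-bump p (_∷_ {x′ = x′} {y′} e s) = ≡.trans e (≡.sym (bump-<ᵇ p x′ y′)) ∷ SamePattern-bump p s

  SamePattern-not : ∀ {a b} {A : Set a} {B : Set b} {r : A → A → Bool} {r′ : B → B → Bool} {v w} →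
    SamePattern r r′ v w → SamePattern (λ x y → not (r x y)) (λ x y → not (r′ x y)) v w
  SamePattern-not [] = []
  SamePattern-not [-] = [-]
  SamePattern-not (e ∷ s) = cong not e ∷ SamePattern-not s

  SamePattern-unnot : ∀ {a b} {A : Set a} {B : Set b} {r : A → A → Bool} {r′ : B → B → Bool} {v w} →
    SamePattern (λ x y → not (r x y)) (λ x y → not (r′ x y)) v w → SamePattern r r′ v w
  SamePattern-unnot [] = []
  SamePattern-unnot [-] = [-]
  SamePattern-unnot (e ∷ s) = not-injective e ∷ SamePattern-unnot s

  -- The values of π are positions in v, so a comparison of neighbours in v ∘ π is a comparison of
  -- two labels, which `compatible-order` reduces to their positions.
  compatible-pattern : ∀ {n π} → Perm n π → ∀ v → length v ≡ n →
    compatible _<ᵇ_ v (inverse π) ≡ true → SamePattern (step true) _<ᵇ_ (map (at v) π) π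
  compatible-pattern [] v eq c = []
  compatible-pattern (_∷_ {n} {p} {w} p≤n π) v eq c with insertAt-split p v n eq p≤n
  ... | k , v′ , ≡.refl , eq′ =
    ≡.subst (λ u → SamePattern (step true) _<ᵇ_ u (p ∷ map (bump p) w))
      (≡.sym (pick-insertAt p k v′ w (≡.subst (p ℕ.≤_) (≡.sym eq′) p≤n))) (extend π IH)
    where
    len : length v′ ≡ length (inverse w)
    len = ≡.trans eq′ (≡.sym (≡.trans (inverse-length w) (Perm-length π)))
    c′ : compatible _<ᵇ_ (insertAt p k v′) (insertAt p 0 (map suc (inverse w))) ≡ true
    c′ = ≡.trans (cong (compatible _<ᵇ_ (insertAt p k v′)) (≡.sym (inverse-∷ w p≤n (Perm-length π)))) c
    IH : SamePattern (step true) _<ᵇ_ (map (at v′) w) w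
    IH = compatible-pattern π v′ eq′ (compatible-delete′ p k v′ (inverse w) len c′)
    extend : ∀ {w} → Perm n w → SamePattern (step true) _<ᵇ_ (map (at v′) w) w →
      SamePattern (step true) _<ᵇ_ (k ∷ map (at v′) w) (p ∷ map (bump p) w)
    extend [] s = [-]
    -- Here i is the first letter of the remaining permutation, so the letter next to k is the label
    -- at position i.
    extend (_∷_ {p = i} i≤n _) s =
      compatible-order p k v′ (inverse w) i len (≡.subst (i ℕ.<_) (≡.sym eq′) (s≤s i≤n)) c′ ∷ SamePattern-bump p s

-- Convolution of functions on words, and weighted sums over words.

module WordSums {c ℓ : Level} (R : CommutativeRing c ℓ) where

  open import Data.Bool.Base using (T)
  open import Data.Unit.Base using (tt)
  open import Data.Empty using (⊥-elim)
  open import Defs using (words)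
  open RingKit R
  open PowerSeries R
  open WordLemmas

  ∑<-swap : ∀ m n (f : ℕ → ℕ → Carrier) → ∑< m (λ i → ∑< n (f i)) ≈ ∑< n (λ j → ∑< m (λ i → f i j))
  ∑<-swap zero n f = sym (∑<-0 n (λ _ _ → refl))
  ∑<-swap (suc m) n f = trans (+-congˡ (∑<-swap m n (λ i → f (suc i)))) (sym (∑<-+ n (f 0) _))

  []·-+ : ∀ b x y → [ b ]· (x + y) ≈ [ b ]· x + [ b ]· y
  []·-+ true x y = refl
  []·-+ false x y = sym (+-identityˡ 0#)

  []·-∑< : ∀ b n (f : ℕ → Carrier) → [ b ]· (∑< n f) ≈ ∑< n (λ i → [ b ]· (f i))
  []·-∑< true n f = refl
  []·-∑< false n f = sym (∑<-0 n (λ _ _ → refl))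

  if-cong : ∀ b {x x′ y y′ : Carrier} → x ≈ x′ → y ≈ y′ → (if b then x else y) ≈ (if b then x′ else y′)
  if-cong true p q = p
  if-cong false p q = q

  ⋆-∑ˡ : ∀ N (F : ℕ → ℕ → Carrier) g n → ((λ i → ∑< N (λ c → F c i)) ⋆ g) n ≈ ∑< N (λ c → (F c ⋆ g) n)
  ⋆-∑ˡ zero F g n = ⋆-zeroˡ g (λ _ → refl) n
  ⋆-∑ˡ (suc N) F g n = trans (⋆-distribʳ (F 0) _ g n) (+-congˡ (⋆-∑ˡ N (λ c → F (suc c)) g n))

  module _ {a} {A : Set a} where

    infixl 7 _⋈_

    -- The convolution dual to concatenation of words.
    _⋈_ : (List A → Carrier) → (List A → Carrier) → List A → Carrier
    (f ⋈ g) [] = f [] * g []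
    (f ⋈ g) (x ∷ w) = f [] * g (x ∷ w) + ((λ u → f (x ∷ u)) ⋈ g) w

    ⋈-zeroˡ : ∀ {f : List A → Carrier} g → (∀ w → f w ≈ 0#) → ∀ w → (f ⋈ g) w ≈ 0#
    ⋈-zeroˡ g z [] = trans (*-congʳ (z [])) (zeroˡ _)
    ⋈-zeroˡ g z (x ∷ w) = trans (+-cong (trans (*-congʳ (z [])) (zeroˡ _)) (⋈-zeroˡ g (λ u → z (x ∷ u)) w)) (+-identityˡ 0#)

    ⋈-scaleˡ : ∀ k f g w → ((λ u → k * f u) ⋈ g) w ≈ k * (f ⋈ g) w
    ⋈-scaleˡ k f g [] = *-assoc _ _ _
    ⋈-scaleˡ k f g (x ∷ w) = trans (+-congˡ (⋈-scaleˡ k (λ u → f (x ∷ u)) g w))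
      (solve 4 (λ k a b p → k :* a :* b :+ k :* p := k :* (a :* b :+ p)) refl _ _ _ _)

    isEmpty : List A → Carrier
    isEmpty [] = 1#
    isEmpty (_ ∷ _) = 0#

    -- For the ascent relation this is H(p), and for its negation E(p): the noncommutative analogues
    -- of the complete and the elementary symmetric series.
    chain : (A → A → Bool) → Carrier → List A → Carrier
    chain r p [] = 1#
    chain r p (x ∷ []) = p
    chain r p (x ∷ y ∷ w) = [ r x y ]· (p * chain r p (y ∷ w))

    -- A scan over the prefixes that are chains along r: behind each letter the prefix may stop, and
    -- it must stop if the next step is not along r. `chain-⋈` identifies the result with
    -- `chain r p ⋈ g`.
    grow : (A → A → Bool) → Carrier → (List A → Carrier) → List A → Carrier
    grow r p g [] = g []
    grow r p g (x ∷ []) = g (x ∷ []) + p * g []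
    grow r p g (x ∷ y ∷ w) = g (x ∷ y ∷ w) + p * (if r x y then grow r p g (y ∷ w) else g (y ∷ w))

    grow-cong : ∀ r p {g g′} → (∀ w → g w ≈ g′ w) → ∀ w → grow r p g w ≈ grow r p g′ w
    grow-cong r p e [] = e []
    grow-cong r p e (x ∷ []) = +-cong (e _) (*-congˡ (e []))
    grow-cong r p e (x ∷ y ∷ w) = +-cong (e _) (*-congˡ (if-cong (r x y) (grow-cong r p e (y ∷ w)) (e (y ∷ w))))

    chain-⋈ : ∀ r p g w → (chain r p ⋈ g) w ≈ grow r p g w
    chain-⋈ r p g [] = *-identityˡ _
    chain-⋈ r p g (x ∷ []) = +-congʳ (*-identityˡ _)
    chain-⋈ r p g (x ∷ y ∷ w) = +-cong (*-identityˡ _) (lem (chain-⋈ r p g (y ∷ w)))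
      where
      lem : (chain r p ⋈ g) (y ∷ w) ≈ grow r p g (y ∷ w) →
            p * g (y ∷ w) + ((λ u → chain r p (x ∷ y ∷ u)) ⋈ g) w ≈ p * (if r x y then grow r p g (y ∷ w) else g (y ∷ w))
      lem IH with r x y
      ... | true = begin
        p * g (y ∷ w) + ((λ u → p * chain r p (y ∷ u)) ⋈ g) w   ≈⟨ +-congˡ (⋈-scaleˡ p (λ u → chain r p (y ∷ u)) g w) ⟩
        p * g (y ∷ w) + p * ((λ u → chain r p (y ∷ u)) ⋈ g) w   ≈⟨ solve 3 (λ p a b → p :* a :+ p :* b := p :* (con (pos 1) :* a :+ b)) refl p _ _ ⟩
        p * (chain r p ⋈ g) (y ∷ w)                             ≈⟨ *-congˡ IH ⟩
        p * grow r p g (y ∷ w)                                  ∎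
      ... | false = trans (+-congˡ (⋈-zeroˡ g (λ _ → refl) w)) (+-identityʳ _)

    -- The noncommutative form of E(p) H(-p) = 1.
    grow-chain : ∀ (r : A → A → Bool) p w → grow (λ x y → not (r x y)) p (chain r (- p)) w ≈ isEmpty w
    grow-chain r p [] = refl
    grow-chain r p (x ∷ []) = solve 1 (λ p → (:- p) :+ p :* con (pos 1) := con (pos 0)) refl p
    grow-chain r p (x ∷ y ∷ w) with r x y | grow-chain r p (y ∷ w)
    ... | true | _ = solve 2 (λ p a → (:- p) :* a :+ p :* a := con (pos 0)) refl p _
    ... | false | IH = trans (+-identityˡ _) (trans (*-congˡ IH) (zeroʳ p))

    -- layers r q p i is the i-th convolution power of E(q) H(p): it counts, with weight q for a negative and p for
    -- a positive label, the weakly increasing labellings of a word by -1 < 1 < … < -i < i in which a positive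
    -- label is repeated only along r and a negative one only against r.
    layer : (A → A → Bool) → Carrier → Carrier → (List A → Carrier) → List A → Carrier
    layer r q p g = grow (λ x y → not (r x y)) q (grow r p g)

    layers : (A → A → Bool) → Carrier → Carrier → ℕ → List A → Carrier
    layers r q p zero = isEmpty
    layers r q p (suc i) = layer r q p (layers r q p i)

  module _ (wt : ℕ → Carrier) (N : ℕ) where

    wordSum : ℕ → (List ℕ → Carrier) → Carrier
    wordSum zero f = f []
    wordSum (suc n) f = ∑< N (λ d → wt d * wordSum n (λ w → f (d ∷ w)))

    wordSum-cong : ∀ n {f g} → (∀ w → f w ≈ g w) → wordSum n f ≈ wordSum n g
    wordSum-cong zero e = e []
    wordSum-cong (suc n) e = ∑<-cong′ N (λ d → *-congˡ (wordSum-cong n (λ w → e (d ∷ w))))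

    wordSum-+ : ∀ n f g → wordSum n (λ w → f w + g w) ≈ wordSum n f + wordSum n g
    wordSum-+ zero f g = refl
    wordSum-+ (suc n) f g = trans
      (∑<-cong′ N (λ d → trans (*-congˡ (wordSum-+ n (λ w → f (d ∷ w)) (λ w → g (d ∷ w)))) (distribˡ _ _ _)))
      (∑<-+ N (λ d → wt d * wordSum n (λ w → f (d ∷ w))) (λ d → wt d * wordSum n (λ w → g (d ∷ w))))

    wordSum-*ˡ : ∀ n k f → wordSum n (λ w → k * f w) ≈ k * wordSum n f
    wordSum-*ˡ zero k f = refl
    wordSum-*ˡ (suc n) k f = trans
      (∑<-cong′ N (λ d → trans (*-congˡ (wordSum-*ˡ n k (λ w → f (d ∷ w)))) (solve 3 (λ a b c → a :* (b :* c) := b :* (a :* c)) refl _ _ _)))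
      (∑<-*ˡ N k (λ d → wt d * wordSum n (λ w → f (d ∷ w))))

    wordSum-0 : ∀ n {f} → (∀ w → f w ≈ 0#) → wordSum n f ≈ 0#
    wordSum-0 zero e = e []
    wordSum-0 (suc n) e = ∑<-0 N (λ d _ → trans (*-congˡ (wordSum-0 n (λ w → e (d ∷ w)))) (zeroʳ _))

    wordSum-[] : ∀ n b f → wordSum n (λ w → [ b ]· (f w)) ≈ [ b ]· (wordSum n f)
    wordSum-[] n true f = refl
    wordSum-[] n false f = wordSum-0 n (λ _ → refl)

    -- Weights multiply under concatenation, so summing over all words turns the dual of
    -- concatenation into the Cauchy product.
    wordSum-⋈ : ∀ n f g → wordSum n (f ⋈ g) ≈ ((λ i → wordSum i f) ⋆ (λ i → wordSum i g)) n
    wordSum-⋈ zero f g = refl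
    wordSum-⋈ (suc n) f g = begin
      ∑< N (λ d → wt d * wordSum n (λ w → f [] * g (d ∷ w) + (f′ d ⋈ g) w))
        ≈⟨ ∑<-cong′ N (λ d → trans (*-congˡ (trans (wordSum-+ n (λ w → f [] * g (d ∷ w)) (f′ d ⋈ g))
             (+-cong (wordSum-*ˡ n (f []) (λ w → g (d ∷ w))) (wordSum-⋈ n (f′ d) g))))
             (solve 4 (λ a b c e → a :* (b :* c :+ e) := b :* (a :* c) :+ a :* e) refl _ _ _ _)) ⟩
      ∑< N (λ d → f [] * (wt d * wordSum n (λ w → g (d ∷ w))) + wt d * ((λ i → wordSum i (f′ d)) ⋆ G) n)
        ≈⟨ ∑<-+ N (λ d → f [] * (wt d * wordSum n (λ w → g (d ∷ w)))) (λ d → wt d * ((λ i → wordSum i (f′ d)) ⋆ G) n) ⟩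
      ∑< N (λ d → f [] * (wt d * wordSum n (λ w → g (d ∷ w)))) + ∑< N (λ d → wt d * ((λ i → wordSum i (f′ d)) ⋆ G) n)
        ≈⟨ +-cong (∑<-*ˡ N (f []) (λ d → wt d * wordSum n (λ w → g (d ∷ w))))
                  (trans (∑<-cong′ N (λ d → sym (⋆-scaleˡ (wt d) (λ i → wordSum i (f′ d)) G n)))
                         (sym (⋆-∑ˡ N (λ d i → wt d * wordSum i (f′ d)) G n))) ⟩
      f [] * G (suc n) + ((λ i → wordSum (suc i) f) ⋆ G) n ∎
      where
      f′ : ℕ → List ℕ → Carrier
      f′ d w = f (d ∷ w)
      G : ℕ → Carrier
      G i = wordSum i g

  ∑-words : ∀ N n f → ∑ (words N n) f ≈ wordSum (λ _ → 1#) N n f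
  ∑-words N zero f = +-identityʳ _
  ∑-words N (suc n) f = begin
    ∑ (words N (suc n)) f
      ≈⟨ ∑-concatMap (λ w → map (_∷ w) (upTo N)) (words N n) f ⟩
    ∑ (words N n) (λ w → ∑ (map (_∷ w) (upTo N)) f)
      ≈⟨ ∑-cong (words N n) (λ w → trans (∑-map (_∷ w) (upTo N) f) (∑-upTo N (λ d → f (d ∷ w)))) ⟩
    ∑ (words N n) (λ w → ∑< N (λ d → f (d ∷ w)))
      ≈⟨ ∑<-∑-swap N (words N n) (λ d w → f (d ∷ w)) ⟨
    ∑< N (λ d → ∑ (words N n) (λ w → f (d ∷ w)))
      ≈⟨ ∑<-cong′ N (λ d → trans (∑-words N n (λ w → f (d ∷ w))) (sym (*-identityˡ _))) ⟩
    ∑< N (λ d → 1# * wordSum (λ _ → 1#) N n (λ w → f (d ∷ w))) ∎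

  weight : Carrier → Carrier → ℕ → Carrier
  weight q p d = if positive d then p else q

  ≤ᵇ-split : ∀ N d (F : ℕ → Carrier) → d ℕ.< N → ∑< N (λ e → [ d ≤ᵇ e ]· (F e)) ≈ F d + ∑< N (λ e → [ d <ᵇ e ]· (F e))
  ≤ᵇ-split (suc N) zero F _ = +-congˡ (sym (+-identityˡ _))
  ≤ᵇ-split (suc N) (suc zero) F (ℕ.s≤s d<N) = trans (+-identityˡ _) (trans (≤ᵇ-split N zero (λ e → F (suc e)) d<N) (+-congˡ (sym (+-identityˡ _))))
  ≤ᵇ-split (suc N) (suc (suc d)) F (ℕ.s≤s d<N) = trans (+-identityˡ _) (trans (≤ᵇ-split N (suc d) (λ e → F (suc e)) d<N) (+-congˡ (sym (+-identityˡ _))))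

  module _ {a} {A : Set a} (r : A → A → Bool) (q p : Carrier) where

    rel : ℕ → A → A → Bool
    rel d x y = agree d (r x y)

    private
      wt : ℕ → Carrier
      wt = weight q p

    -- Labellings by d, d + 1, ..., d + m - 1: as labels increase, the places labelled d form a
    -- prefix, in which `rel d` governs the repetitions.
    growFrom : ℕ → ℕ → List A → Carrier
    growFrom d zero = isEmpty
    growFrom d (suc m) = grow (rel d) (wt d) (growFrom (suc d) m)

    growFrom-layers : ∀ j w → growFrom 0 (double j) w ≈ layers r q p j w
    growFrom-layers zero w = refl
    growFrom-layers (suc j) w = grow-cong _ q (grow-cong r p (λ u → trans (shift 0 (double j) u) (growFrom-layers j u))) w
      where
      -- Only the sign of a label matters, and signs have period two.
      shift : ∀ d m u → growFrom (suc (suc d)) m u ≈ growFrom d m u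
      shift d zero u = refl
      shift d (suc m) u = grow-cong (rel d) (wt d) (shift (suc d) m) u

    module _ (N : ℕ) where

      private
        M : ℕ → (List ℕ → Carrier) → Carrier
        M = wordSum wt N

      -- The weight of the leading label d itself is left out; `from` supplies it when it sums over
      -- the leading labels.
      first : ℕ → List A → Carrier
      first d [] = 0#
      first d (x ∷ w) = M (length w) (λ v → [ compatible r (d ∷ v) (x ∷ w) ]· 1#)

      from : ℕ → List A → Carrier
      from d [] = 1#
      from d (x ∷ w) = ∑< N (λ e → [ d ≤ᵇ e ]· (wt e * first e (x ∷ w)))

      first-step : ∀ d x y w → first d (x ∷ y ∷ w) ≈ (if rel d x y then from d (y ∷ w) else from (suc d) (y ∷ w))
      first-step d x y w = begin
        ∑< N (λ e → wt e * M (length w) (λ v → [ step (r x y) d e ∧ compatible r (e ∷ v) (y ∷ w) ]· 1#))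
          ≈⟨ ∑<-cong′ N (λ e → trans (*-congˡ (trans (wordSum-cong wt N (length w) (λ v → []·-∧ (step (r x y) d e) _ 1#))
               (wordSum-[] wt N (length w) (step (r x y) d e) (λ v → [ compatible r (e ∷ v) (y ∷ w) ]· 1#))))
               (sym ([]·-*ˡ (step (r x y) d e) (wt e) _))) ⟩
        ∑< N (λ e → [ step (r x y) d e ]· (wt e * first e (y ∷ w)))
          ≈⟨ lem (rel d x y) ⟩
        (if rel d x y then from d (y ∷ w) else from (suc d) (y ∷ w)) ∎
        where
        lem : ∀ b → ∑< N (λ e → [ if b then d ≤ᵇ e else d <ᵇ e ]· (wt e * first e (y ∷ w)))
            ≈ (if b then from d (y ∷ w) else from (suc d) (y ∷ w))
        lem true = refl
        lem false = refl

      -- Either all labels exceed d or the leading one is d. In the latter case the next label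
      -- starts again at d if the step permits a repetition, and at d + 1 otherwise.
      from-grow : ∀ d → d ℕ.< N → ∀ w → from d w ≈ grow (rel d) (wt d) (from (suc d)) w
      from-grow d d<N [] = refl
      from-grow d d<N (x ∷ []) = trans (≤ᵇ-split N d (λ e → wt e * first e (x ∷ [])) d<N) (+-comm _ _)
      from-grow d d<N (x ∷ y ∷ w) = trans (≤ᵇ-split N d (λ e → wt e * first e (x ∷ y ∷ w)) d<N)
        (trans (+-comm _ _) (+-congˡ (*-congˡ (trans (first-step d x y w) (if-cong (rel d x y) (from-grow d d<N (y ∷ w)) refl)))))

      from-growFrom : ∀ m d → m ℕ.+ d ≡ N → ∀ w → from d w ≈ growFrom d m w
      from-growFrom zero d eq [] = refl
      from-growFrom zero d ≡.refl (x ∷ w) = ∑<-0 N (λ e e<N → none e e<N)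
        where
        none : ∀ e → e ℕ.< N → [ N ≤ᵇ e ]· (wt e * first e (x ∷ w)) ≈ 0#
        none e e<N with N ≤ᵇ e in q
        ... | true = ⊥-elim (ℕₚ.<⇒≱ e<N (ℕₚ.≤ᵇ⇒≤ N e (≡.subst T (≡.sym q) tt)))
        ... | false = refl
      from-growFrom (suc m) d ≡.refl w = trans
        (from-grow d (ℕ.s≤s (ℕₚ.m≤n+m d m)) w)
        (grow-cong (rel d) (wt d) (from-growFrom m (suc d) (ℕₚ.+-suc m d)) w)

    -- The relation is kept general for the sake of two uses: the order of the letters of a
    -- permutation, and the constantly true relation on a one-letter alphabet.
    compatible-layers : ∀ j w →
      wordSum (weight q p) (double j) (length w) (λ v → [ compatible r v w ]· 1#) ≈ layers r q p j w
    compatible-layers j [] = trans (from-growFrom (double j) (double j) 0 (ℕₚ.+-identityʳ _) []) (growFrom-layers j [])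
    compatible-layers j (x ∷ w) = trans (from-growFrom (double j) (double j) 0 (ℕₚ.+-identityʳ _) (x ∷ w)) (growFrom-layers j (x ∷ w))

-- Sums over permutations and over their inverses.

module PermutationSums {c ℓ : Level} (R : CommutativeRing c ℓ) where

  open import Defs using (words; 𝔖; distinct; notElem; inverse)
  open RingKit R hiding (_×_)
  open WordSums R
  open WordLemmas

  permSum : ℕ → (List ℕ → Carrier) → Carrier
  permSum zero f = f []
  permSum (suc n) f = ∑< (suc n) (λ p → permSum n (λ w → f (p ∷ map (bump p) w)))

  permSum-cong : ∀ n {f g} → (∀ w → Perm n w → f w ≈ g w) → permSum n f ≈ permSum n g
  permSum-cong zero e = e [] []
  permSum-cong (suc n) e = ∑<-cong (suc n) (λ { p (s≤s p≤n) → permSum-cong n (λ w π → e _ (p≤n ∷ π)) })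

  ∑<-bump : ∀ {n p} (f : ℕ → Carrier) → p ℕ.≤ n → ∑< (suc n) (λ d → [ not (p ≡ᵇ d) ]· (f d)) ≈ ∑< n (λ d → f (bump p d))
  ∑<-bump f z≤n = +-identityˡ _
  ∑<-bump f (s≤s p≤n) = +-congˡ (∑<-bump (λ d → f (suc d)) p≤n)

  -- Lengths other than the size of the alphabet are needed: cutting off a first letter while the
  -- position of 0 is being tracked leaves an injective word that is no permutation.
  distinctSum : ℕ → ℕ → (List ℕ → Carrier) → Carrier
  distinctSum N m f = wordSum (λ _ → 1#) N m (λ w → [ distinct w ]· (f w))

  distinctSum-cong : ∀ N m {f g} → (∀ w → f w ≈ g w) → distinctSum N m f ≈ distinctSum N m g
  distinctSum-cong N m e = wordSum-cong _ N m (λ w → []·-cong (distinct w) (e w))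

  wordSum-avoid : ∀ {n p} m (f : List ℕ → Carrier) → p ℕ.≤ n →
    wordSum (λ _ → 1#) (suc n) m (λ w → [ notElem p w ]· (f w)) ≈ wordSum (λ _ → 1#) n m (λ w → f (map (bump p) w))
  wordSum-avoid zero f p≤n = refl
  wordSum-avoid {n} {p} (suc m) f p≤n = begin
    ∑< (suc n) (λ d → 1# * ws (suc n) (λ w → [ notElem p (d ∷ w) ]· (f (d ∷ w))))
      ≈⟨ ∑<-cong′ (suc n) (λ d → split (p ≡ᵇ d) d) ⟩
    ∑< (suc n) (λ d → [ not (p ≡ᵇ d) ]· (1# * ws (suc n) (λ w → [ notElem p w ]· (f (d ∷ w)))))
      ≈⟨ ∑<-bump (λ d → 1# * ws (suc n) (λ w → [ notElem p w ]· (f (d ∷ w)))) p≤n ⟩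
    ∑< n (λ d → 1# * ws (suc n) (λ w → [ notElem p w ]· (f (bump p d ∷ w))))
      ≈⟨ ∑<-cong′ n (λ d → *-congˡ (wordSum-avoid m (λ w → f (bump p d ∷ w)) p≤n)) ⟩
    ∑< n (λ d → 1# * ws n (λ w → f (bump p d ∷ map (bump p) w))) ∎
    where
    ws : ℕ → (List ℕ → Carrier) → Carrier
    ws N = wordSum (λ _ → 1#) N m
    split : ∀ b d → 1# * ws (suc n) (λ w → [ if b then false else notElem p w ]· (f (d ∷ w)))
                  ≈ [ not b ]· (1# * ws (suc n) (λ w → [ notElem p w ]· (f (d ∷ w))))
    split true d = trans (*-identityˡ _) (wordSum-0 _ (suc n) m (λ _ → refl))
    split false d = refl

  distinctSum-avoid : ∀ {n p} m (f : List ℕ → Carrier) → p ℕ.≤ n →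
    wordSum (λ _ → 1#) (suc n) m (λ w → [ distinct (p ∷ w) ]· (f w)) ≈ distinctSum n m (λ w → f (map (bump p) w))
  distinctSum-avoid {n} {p} m f p≤n = begin
    wordSum _ (suc n) m (λ w → [ notElem p w ∧ distinct w ]· (f w))
      ≈⟨ wordSum-cong _ (suc n) m (λ w → []·-∧ (notElem p w) (distinct w) (f w)) ⟩
    wordSum _ (suc n) m (λ w → [ notElem p w ]· ([ distinct w ]· (f w)))
      ≈⟨ wordSum-avoid m (λ w → [ distinct w ]· (f w)) p≤n ⟩
    wordSum _ n m (λ w → [ distinct (map (bump p) w) ]· (f (map (bump p) w)))
      ≈⟨ wordSum-cong _ n m (λ w → reflexive (cong (λ b → [ b ]· (f (map (bump p) w))) (distinct-bump p w))) ⟩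
    distinctSum n m (λ w → f (map (bump p) w)) ∎

  distinctSum-∷ : ∀ n m f → distinctSum (suc n) (suc m) f ≈ ∑< (suc n) (λ p → distinctSum n m (λ w → f (p ∷ map (bump p) w)))
  distinctSum-∷ n m f = ∑<-cong (suc n) (λ { p (s≤s p≤n) →
    trans (*-identityˡ _) (distinctSum-avoid m (λ w → f (p ∷ w)) p≤n) })

  distinctSum-permSum : ∀ n f → distinctSum n n f ≈ permSum n f
  distinctSum-permSum zero f = refl
  distinctSum-permSum (suc n) f = trans (distinctSum-∷ n n f)
    (∑<-cong′ (suc n) (λ p → distinctSum-permSum n (λ w → f (p ∷ map (bump p) w))))

  ∑-𝔖 : ∀ n f → ∑ (𝔖 n) f ≈ permSum n f
  ∑-𝔖 n f = trans (∑-filter distinct (words n n) f) (trans (∑-words n n _) (distinctSum-permSum n f))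

  -- The pigeonhole principle: each first letter that is cut off also removes a letter from the
  -- alphabet.
  distinctSum-long : ∀ n m f → n ℕ.< m → distinctSum n m f ≈ 0#
  distinctSum-long zero (suc m) f _ = refl
  distinctSum-long (suc n) (suc m) f (s≤s n<m) = trans (distinctSum-∷ n m f)
    (∑<-0 (suc n) (λ p _ → distinctSum-long n m (λ w → f (p ∷ map (bump p) w)) n<m))

  zeroAt : ℕ → ℕ → (List ℕ → Carrier) → Carrier
  zeroAt n zero f = 0#
  zeroAt n (suc m) f = ∑< (suc m) (λ p → distinctSum n m (λ w → f (insertAt p 0 (map suc w))))

  distinctSum-head : ∀ n m f → distinctSum n (suc m) f ≈ ∑< n (λ d → distinctSum n m (λ w → [ notElem d w ]· (f (d ∷ w))))
  distinctSum-head n m f = ∑<-cong′ n (λ d → trans (*-identityˡ _)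
    (wordSum-cong _ n m (λ w → []·-∧-swap (notElem d w) (distinct w) (f (d ∷ w)))))

  -- Injective words are sorted by whether and where 0 occurs. If the first letter is not 0, the
  -- induction runs over the remaining word, under the side condition that it avoids that letter.
  distinctSum-zeroAt : ∀ n m f → distinctSum (suc n) m f ≈ distinctSum n m (λ w → f (map suc w)) + zeroAt n m f
  distinctSum-zeroAt n zero f = sym (+-identityʳ _)
  distinctSum-zeroAt n (suc m) f = begin
    1# * wordSum (λ _ → 1#) (suc n) m (λ w → [ distinct (0 ∷ w) ]· (f (0 ∷ w)))
      + ∑< n (λ d → 1# * wordSum (λ _ → 1#) (suc n) m (λ w → [ distinct (suc d ∷ w) ]· (f (suc d ∷ w))))
      ≈⟨ +-cong (trans (*-identityˡ _) (distinctSum-avoid m (λ w → f (0 ∷ w)) z≤n))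
                (∑<-cong′ n (λ d → trans (*-identityˡ _) (tail d))) ⟩
    Z 0 + ∑< n (λ d → distinctSum n m (λ w → [ notElem d w ]· (f (suc d ∷ map suc w))) + rest m d)
      ≈⟨ +-congˡ (∑<-+ n (λ d → distinctSum n m (λ w → [ notElem d w ]· (f (suc d ∷ map suc w)))) (rest m)) ⟩
    Z 0 + (∑< n (λ d → distinctSum n m (λ w → [ notElem d w ]· (f (suc d ∷ map suc w)))) + ∑< n (rest m))
      ≈⟨ +-congˡ (+-cong (sym (distinctSum-head n m (λ w → f (map suc w)))) (rest-sum m)) ⟩
    Z 0 + (distinctSum n (suc m) (λ w → f (map suc w)) + ∑< m (λ p → distinctSum n m (λ w → f (insertAt (suc p) 0 (map suc w)))))
      ≈⟨ solve 3 (λ a b c → a :+ (b :+ c) := b :+ (a :+ c)) refl _ _ _ ⟩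
    distinctSum n (suc m) (λ w → f (map suc w)) + zeroAt n (suc m) f ∎
    where
    Z : ℕ → Carrier
    Z p = distinctSum n m (λ w → f (insertAt p 0 (map suc w)))
    rest : ℕ → ℕ → Carrier
    rest m d = zeroAt n m (λ w → [ notElem (suc d) w ]· (f (suc d ∷ w)))
    tail : ∀ d → wordSum (λ _ → 1#) (suc n) m (λ w → [ distinct (suc d ∷ w) ]· (f (suc d ∷ w)))
         ≈ distinctSum n m (λ w → [ notElem d w ]· (f (suc d ∷ map suc w))) + rest m d
    tail d = trans (wordSum-cong _ (suc n) m (λ w → []·-∧-swap (notElem (suc d) w) (distinct w) (f (suc d ∷ w))))
      (trans (distinctSum-zeroAt n m (λ w → [ notElem (suc d) w ]· (f (suc d ∷ w))))
        (+-congʳ (distinctSum-cong n m (λ w → reflexive (cong (λ b → [ b ]· (f (suc d ∷ map suc w))) (notElem-bump 0 d w))))))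
    rest-sum : ∀ m → ∑< n (rest m) ≈ ∑< m (λ p → distinctSum n m (λ w → f (insertAt (suc p) 0 (map suc w))))
    rest-sum zero = ∑<-0 n (λ _ _ → refl)
    rest-sum (suc m) = trans (∑<-swap n (suc m) (λ d p → distinctSum n m (λ w → [ notElem (suc d) (insertAt p 0 (map suc w)) ]· (f (suc d ∷ insertAt p 0 (map suc w)))))) (∑<-cong′ (suc m) (λ p →
      trans (∑<-cong′ n (λ d → distinctSum-cong n m (λ w →
               reflexive (cong (λ b → [ b ]· (f (suc d ∷ insertAt p 0 (map suc w)))) (notElem-insertAt-0 p d w)))))
            (sym (distinctSum-head n m (λ w → f (insertAt (suc p) 0 (map suc w)))))))

  permSum-zeroAt : ∀ n f → permSum (suc n) f ≈ ∑< (suc n) (λ p → permSum n (λ w → f (insertAt p 0 (map suc w))))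
  permSum-zeroAt n f = begin
    permSum (suc n) f                 ≈⟨ distinctSum-permSum (suc n) f ⟨
    distinctSum (suc n) (suc n) f     ≈⟨ distinctSum-zeroAt n (suc n) f ⟩
    distinctSum n (suc n) (λ w → f (map suc w)) + zeroAt n (suc n) f
      ≈⟨ +-cong (distinctSum-long n (suc n) (λ w → f (map suc w)) ℕₚ.≤-refl)
                (∑<-cong′ (suc n) (λ p → distinctSum-permSum n (λ w → f (insertAt p 0 (map suc w))))) ⟩
    0# + ∑< (suc n) (λ p → permSum n (λ w → f (insertAt p 0 (map suc w)))) ≈⟨ +-identityˡ _ ⟩
    ∑< (suc n) (λ p → permSum n (λ w → f (insertAt p 0 (map suc w)))) ∎

  -- By `inverse-∷`, inversion exchanges the decomposition by the first letter, which defines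
  -- `permSum`, with the decomposition by the position of 0.
  permSum-inverse : ∀ n f → permSum n (λ w → f (inverse w)) ≈ permSum n f
  permSum-inverse zero f = refl
  permSum-inverse (suc n) f = begin
    ∑< (suc n) (λ p → permSum n (λ w → f (inverse (p ∷ map (bump p) w))))
      ≈⟨ ∑<-cong (suc n) (λ { p (s≤s p≤n) → permSum-cong n (λ w π → reflexive (cong f (inverse-∷ w p≤n (Perm-length π)))) }) ⟩
    ∑< (suc n) (λ p → permSum n (λ w → f (insertAt p 0 (map suc (inverse w)))))
      ≈⟨ ∑<-cong′ (suc n) (λ p → permSum-inverse n (λ w → f (insertAt p 0 (map suc w)))) ⟩
    ∑< (suc n) (λ p → permSum n (λ w → f (insertAt p 0 (map suc w))))
      ≈⟨ permSum-zeroAt n f ⟨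
    permSum (suc n) f ∎

-- Standardization of words in signed letters.

module Standardization {c ℓ : Level} (R : CommutativeRing c ℓ) where

  open import Defs using (inverse)
  open RingKit R
  open WordLemmas
  open WordSums R
  open PermutationSums R

  grow-pattern : ∀ {a b} {A : Set a} {B : Set b} (r : A → A → Bool) (r′ : B → B → Bool) p {g g′} →
    (∀ {v w} → SamePattern r r′ v w → g v ≈ g′ w) → ∀ {v w} → SamePattern r r′ v w → grow r p g v ≈ grow r′ p g′ w
  grow-pattern r r′ p e [] = e []
  grow-pattern r r′ p e [-] = +-cong (e [-]) (*-congˡ (e []))
  grow-pattern r r′ p e (_∷_ {x} {y} {w} {x′} {y′} {w′} q s) rewrite ≡.sym q =
    +-cong (e (q ∷ s)) (*-congˡ (if-cong (r x y) (grow-pattern r r′ p e s) (e s)))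

  layers-pattern : ∀ {a b} {A : Set a} {B : Set b} (r : A → A → Bool) (r′ : B → B → Bool) q p i →
    ∀ {v w} → SamePattern r r′ v w → layers r q p i v ≈ layers r′ q p i w
  layers-pattern r r′ q p zero [] = refl
  layers-pattern r r′ q p zero [-] = refl
  layers-pattern r r′ q p zero (_ ∷ _) = refl
  layers-pattern r r′ q p (suc i) s = grow-pattern (λ x y → not (r x y)) (λ x y → not (r′ x y)) q
    (λ s′ → grow-pattern r r′ p (layers-pattern r r′ q p i) (SamePattern-unnot s′)) (SamePattern-not s)

  -- Exactly one place behind d accepts the label k. The new letter 0 needs a descent before it and
  -- an ascent after it, and by `step-compl` k lies on exactly one side of each label of the
  -- increasing sequence v.
  compatible-insert : ∀ k d v x w g → length v ≡ length w →
    ∑< (suc (length v)) (λ p → [ compatible _<ᵇ_ (d ∷ insertAt p k v) (suc x ∷ insertAt p 0 (map suc w)) ]· g)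
      ≈ [ step false d k ∧ compatible _<ᵇ_ (d ∷ v) (x ∷ w) ]· g
  compatible-insert k d [] x [] g eq = +-identityʳ _
  compatible-insert k d (e ∷ v) x (y ∷ w) g eq = begin
    [ step false d k ∧ (step true k e ∧ compatible _<ᵇ_ (e ∷ v) (map suc (y ∷ w))) ]· g
      + ∑< (suc (length v)) (λ p → [ t ∧ compatible _<ᵇ_ (e ∷ insertAt p k v) (suc y ∷ insertAt p 0 (map suc w)) ]· g)
      ≈⟨ +-cong (reflexive (cong (λ b → [ step false d k ∧ (step true k e ∧ b) ]· g) (compatible-suc (e ∷ v) (y ∷ w))))
          (trans (trans (∑<-cong′ (suc (length v)) (λ p → []·-∧ t (C′ p) g)) (sym ([]·-∑< t (suc (length v)) (λ p → [ C′ p ]· g))))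
                 ([]·-cong t (compatible-insert k e v y w g (ℕₚ.suc-injective eq)))) ⟩
    [ step false d k ∧ (step true k e ∧ C) ]· g + [ t ]· ([ step false e k ∧ C ]· g)
      ≡⟨ cong (λ b → [ step false d k ∧ (step true k e ∧ C) ]· g + [ t ]· ([ b ∧ C ]· g)) (step-compl e k) ⟩
    [ step false d k ∧ (step true k e ∧ C) ]· g + [ t ]· ([ not (step true k e) ∧ C ]· g)
      ≈⟨ combine (step false d k) (step true k e) t C
           (λ s s′ → step-< (x <ᵇ y) (step-strict d k e s s′))
           (λ s t′ → step-false-mono d e k (step-≤ (x <ᵇ y) d e t′) (≡.trans (step-compl e k) (cong not s))) ⟩
    [ step false d k ∧ (t ∧ C) ]· g ∎
    where
    t C : Bool
    t = step (x <ᵇ y) d e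
    C = compatible _<ᵇ_ (e ∷ v) (y ∷ w)
    C′ : ℕ → Bool
    C′ p = compatible _<ᵇ_ (e ∷ insertAt p k v) (suc y ∷ insertAt p 0 (map suc w))
    -- The flags a, s and t mean that k may follow d, e may follow k, and e may follow d. The first
    -- summand puts k between d and e, the second one behind e.
    combine : ∀ a s t c → (a ≡ true → s ≡ true → t ≡ true) → (s ≡ false → t ≡ true → a ≡ true) →
      [ a ∧ (s ∧ c) ]· g + [ t ]· ([ not s ∧ c ]· g) ≈ [ a ∧ (t ∧ c) ]· g
    combine true true t c h₁ h₂ rewrite h₁ ≡.refl ≡.refl = +-identityʳ _
    combine true false true c h₁ h₂ = +-identityˡ _
    combine true false false c h₁ h₂ = +-identityˡ _
    combine false true true c h₁ h₂ = +-identityˡ _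
    combine false true false c h₁ h₂ = +-identityˡ _
    combine false false true c h₁ h₂ with h₂ ≡.refl ≡.refl
    ... | ()
    combine false false false c h₁ h₂ = +-identityˡ _

  -- The place in front of the whole word takes up the labels k that cannot follow its head, so that
  -- the place exists, and is unique, for every k.
  compatible-insert′ : ∀ k v w g → length v ≡ length w →
    ∑< (suc (length v)) (λ p → [ compatible _<ᵇ_ (insertAt p k v) (insertAt p 0 (map suc w)) ]· g)
      ≈ [ compatible _<ᵇ_ v w ]· g
  compatible-insert′ k [] [] g eq = +-identityʳ _
  compatible-insert′ k (d ∷ v) (x ∷ w) g eq = begin
    [ step true k d ∧ compatible _<ᵇ_ (d ∷ v) (map suc (x ∷ w)) ]· g
      + ∑< (suc (length v)) (λ p → [ compatible _<ᵇ_ (d ∷ insertAt p k v) (suc x ∷ insertAt p 0 (map suc w)) ]· g)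
      ≈⟨ +-cong (reflexive (cong (λ b → [ step true k d ∧ b ]· g) (compatible-suc (d ∷ v) (x ∷ w))))
                (compatible-insert k d v x w g (ℕₚ.suc-injective eq)) ⟩
    [ step true k d ∧ C ]· g + [ step false d k ∧ C ]· g
      ≡⟨ cong (λ b → [ step true k d ∧ C ]· g + [ b ∧ C ]· g) (step-compl d k) ⟩
    [ step true k d ∧ C ]· g + [ not (step true k d) ∧ C ]· g
      ≈⟨ combine (step true k d) ⟩
    [ C ]· g ∎
    where
    C : Bool
    C = compatible _<ᵇ_ (d ∷ v) (x ∷ w)
    combine : ∀ s → [ s ∧ C ]· g + [ not s ∧ C ]· g ≈ [ C ]· g
    combine true = +-identityʳ _
    combine false = +-identityˡ _

  module _ (wt : ℕ → Carrier) (N : ℕ) where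

    private
      M : ℕ → (List ℕ → Carrier) → Carrier
      M = wordSum wt N

    wordSum-congₗ : ∀ n {f g} → (∀ w → length w ≡ n → f w ≈ g w) → M n f ≈ M n g
    wordSum-congₗ zero e = e [] ≡.refl
    wordSum-congₗ (suc n) e = ∑<-cong′ N (λ d → *-congˡ (wordSum-congₗ n (λ w eq → e (d ∷ w) (cong suc eq))))

    wordSum-∑< : ∀ n m (F : ℕ → List ℕ → Carrier) → M n (λ w → ∑< m (λ i → F i w)) ≈ ∑< m (λ i → M n (F i))
    wordSum-∑< n zero F = wordSum-0 wt N n (λ _ → refl)
    wordSum-∑< n (suc m) F = trans (wordSum-+ wt N n (F 0) (λ w → ∑< m (λ i → F (suc i) w)))
      (+-congˡ (wordSum-∑< n m (λ i → F (suc i))))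

    wordSum-insertAt : ∀ n p F → p ℕ.≤ n → M (suc n) F ≈ ∑< N (λ k → wt k * M n (λ v → F (insertAt p k v)))
    wordSum-insertAt n zero F _ = refl
    wordSum-insertAt (suc n) (suc p) F (s≤s p≤n) = begin
      ∑< N (λ d → wt d * M (suc n) (λ v → F (d ∷ v)))
        ≈⟨ ∑<-cong′ N (λ d → trans (*-congˡ (wordSum-insertAt n p (λ v → F (d ∷ v)) p≤n)) (sym (∑<-*ˡ N (wt d) _))) ⟩
      ∑< N (λ d → ∑< N (λ k → wt d * (wt k * M n (λ v → F (d ∷ insertAt p k v)))))
        ≈⟨ ∑<-swap N N (λ d k → wt d * (wt k * M n (λ v → F (d ∷ insertAt p k v)))) ⟩
      ∑< N (λ k → ∑< N (λ d → wt d * (wt k * M n (λ v → F (d ∷ insertAt p k v)))))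
        ≈⟨ ∑<-cong′ N (λ k → trans (∑<-cong′ N (λ d → solve 3 (λ a b c → a :* (b :* c) := b :* (a :* c)) refl _ _ _))
                                    (∑<-*ˡ N (wt k) (λ d → wt d * M n (λ v → F (d ∷ insertAt p k v))))) ⟩
      ∑< N (λ k → wt k * M (suc n) (λ v → F (insertAt (suc p) k v))) ∎

    permSum-* : ∀ n k f → permSum n (λ w → k * f w) ≈ k * permSum n f
    permSum-* zero k f = refl
    permSum-* (suc n) k f = trans (∑<-cong′ (suc n) (λ p → permSum-* n k (λ w → f (p ∷ map (bump p) w))))
      (∑<-*ˡ (suc n) k (λ p → permSum n (λ w → f (p ∷ map (bump p) w))))

    permSum-∑< : ∀ n m (F : ℕ → List ℕ → Carrier) → permSum n (λ w → ∑< m (λ i → F i w)) ≈ ∑< m (λ i → permSum n (F i))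
    permSum-∑< zero m F = refl
    permSum-∑< (suc n) m F = trans (∑<-cong′ (suc n) (λ p → permSum-∑< n m (λ i w → F i (p ∷ map (bump p) w))))
      (∑<-swap (suc n) m (λ p i → permSum n (λ w → F i (p ∷ map (bump p) w))))

    -- Every word is v ∘ π for exactly one permutation π and one word v compatible with π⁻¹; the induction
    -- removes the first letter of the word.
    standardization : ∀ n (f : List ℕ → Carrier) →
      permSum n (λ π → M n (λ v → [ compatible _<ᵇ_ v (inverse π) ]· (f (map (at v) π)))) ≈ M n f
    standardization zero f = refl
    standardization (suc n) f = begin
      ∑< (suc n) (λ p → permSum n (λ w → M (suc n) (λ v →
          [ compatible _<ᵇ_ v (inverse (p ∷ map (bump p) w)) ]· (f (map (at v) (p ∷ map (bump p) w))))))
        ≈⟨ ∑<-cong (suc n) (λ { p (s≤s p≤n) → permSum-cong n (λ w π → peel p w p≤n π) }) ⟩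
      ∑< (suc n) (λ p → permSum n (λ w → ∑< N (λ k → wt k * M n (λ v → term p w k v))))
        ≈⟨ permSum-∑< n (suc n) (λ p w → ∑< N (λ k → wt k * M n (λ v → term p w k v))) ⟨
      permSum n (λ w → ∑< (suc n) (λ p → ∑< N (λ k → wt k * M n (λ v → term p w k v))))
        ≈⟨ permSum-cong n (λ w π → trans (∑<-swap (suc n) N (λ p k → wt k * M n (λ v → term p w k v)))
             (∑<-cong′ N (λ k → trans (∑<-*ˡ (suc n) (wt k) (λ p → M n (λ v → term p w k v))) (*-congˡ (insert w k π))))) ⟩
      permSum n (λ w → ∑< N (λ k → wt k * M n (λ v → [ compatible _<ᵇ_ v (inverse w) ]· (f (k ∷ map (at v) w)))))
        ≈⟨ permSum-∑< n N (λ k w → wt k * M n (λ v → [ compatible _<ᵇ_ v (inverse w) ]· (f (k ∷ map (at v) w)))) ⟩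
      ∑< N (λ k → permSum n (λ w → wt k * M n (λ v → [ compatible _<ᵇ_ v (inverse w) ]· (f (k ∷ map (at v) w)))))
        ≈⟨ ∑<-cong′ N (λ k → trans (permSum-* n (wt k) (λ w → M n (λ v → [ compatible _<ᵇ_ v (inverse w) ]· (f (k ∷ map (at v) w)))))
                                    (*-congˡ (standardization n (λ b → f (k ∷ b))))) ⟩
      ∑< N (λ k → wt k * M n (λ b → f (k ∷ b))) ∎
      where
      term : ℕ → List ℕ → ℕ → List ℕ → Carrier
      term p w k v = [ compatible _<ᵇ_ (insertAt p k v) (insertAt p 0 (map suc (inverse w))) ]· (f (k ∷ map (at v) w))
      peel : ∀ p w → p ℕ.≤ n → Perm n w →
        M (suc n) (λ v → [ compatible _<ᵇ_ v (inverse (p ∷ map (bump p) w)) ]· (f (map (at v) (p ∷ map (bump p) w))))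
          ≈ ∑< N (λ k → wt k * M n (λ v → term p w k v))
      peel p w p≤n π = trans
        (wordSum-insertAt n p (λ v → [ compatible _<ᵇ_ v (inverse (p ∷ map (bump p) w)) ]· (f (map (at v) (p ∷ map (bump p) w)))) p≤n)
        (∑<-cong′ N (λ k → *-congˡ (wordSum-congₗ n (λ v eq → reflexive (cong₂ (λ u x → [ compatible _<ᵇ_ (insertAt p k v) u ]· (f x))
          (inverse-∷ w p≤n (Perm-length π)) (pick-insertAt p k v w (≡.subst (p ℕ.≤_) (≡.sym eq) p≤n)))))))
      insert : ∀ w k → Perm n w → ∑< (suc n) (λ p → M n (λ v → term p w k v))
        ≈ M n (λ v → [ compatible _<ᵇ_ v (inverse w) ]· (f (k ∷ map (at v) w)))
      insert w k π = trans (sym (wordSum-∑< n (suc n) (λ p v → term p w k v)))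
        (wordSum-congₗ n (λ { v ≡.refl → compatible-insert′ k v (inverse w) (f (k ∷ map (at v) w))
          (≡.trans (≡.sym (Perm-length π)) (≡.sym (inverse-length w))) }))

  permSum-layers : ∀ y i q p j n →
    permSum n (λ π → layers _<ᵇ_ y 1# i π * layers _<ᵇ_ q p j (inverse π))
      ≈ wordSum (weight q p) (double j) n (layers (step true) y 1# i)
  permSum-layers y i q p j n = trans (permSum-cong n lem) (standardization (weight q p) (double j) n F′)
    where
    F F′ : List ℕ → Carrier
    F = layers _<ᵇ_ y 1# i
    F′ = layers (step true) y 1# i
    M : ℕ → (List ℕ → Carrier) → Carrier
    M = wordSum (weight q p) (double j)
    same : ∀ {π} → Perm n π → ∀ v → length v ≡ n →
      F π * [ compatible _<ᵇ_ v (inverse π) ]· 1# ≈ [ compatible _<ᵇ_ v (inverse π) ]· (F′ (map (at v) π))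
    same {π} P v eq with compatible _<ᵇ_ v (inverse π) in c
    ... | true = trans (*-identityʳ _) (sym (layers-pattern (step true) _<ᵇ_ y 1# i (compatible-pattern P v eq c)))
    ... | false = zeroʳ _
    lem : ∀ π → Perm n π → F π * layers _<ᵇ_ q p j (inverse π)
      ≈ M n (λ v → [ compatible _<ᵇ_ v (inverse π) ]· (F′ (map (at v) π)))
    lem π P = begin
      F π * layers _<ᵇ_ q p j (inverse π)
        ≈⟨ *-congˡ (compatible-layers _<ᵇ_ q p j (inverse π)) ⟨
      F π * M (length (inverse π)) (λ v → [ compatible _<ᵇ_ v (inverse π) ]· 1#)
        ≡⟨ cong (λ m → F π * M m (λ v → [ compatible _<ᵇ_ v (inverse π) ]· 1#)) (≡.trans (inverse-length π) (Perm-length P)) ⟩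
      F π * M n (λ v → [ compatible _<ᵇ_ v (inverse π) ]· 1#)
        ≈⟨ wordSum-*ˡ _ _ n (F π) _ ⟨
      M n (λ v → F π * [ compatible _<ᵇ_ v (inverse π) ]· 1#)
        ≈⟨ wordSum-congₗ _ _ n (same P) ⟩
      M n (λ v → [ compatible _<ᵇ_ v (inverse π) ]· (F′ (map (at v) π))) ∎

  permSum-layers₁ : ∀ q p j n → permSum n (λ π → layers _<ᵇ_ q p j (inverse π)) ≈ wordSum (weight q p) (double j) n (λ _ → 1#)
  permSum-layers₁ q p j n = trans (permSum-cong n lem) (standardization (weight q p) (double j) n (λ _ → 1#))
    where
    lem : ∀ π → Perm n π → layers _<ᵇ_ q p j (inverse π) ≈ wordSum (weight q p) (double j) n (λ v → [ compatible _<ᵇ_ v (inverse π) ]· 1#)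
    lem π P = trans (sym (compatible-layers _<ᵇ_ q p j (inverse π)))
      (reflexive (cong (λ m → wordSum (weight q p) (double j) m (λ v → [ compatible _<ᵇ_ v (inverse π) ]· 1#)) (≡.trans (inverse-length π) (Perm-length P))))

  wordSum-1 : ∀ wt N n → wordSum wt N n (λ _ → 1#) ≈ ∑< N wt ^ n
  wordSum-1 wt N zero = refl
  wordSum-1 wt N (suc n) = trans (∑<-cong′ N (λ d → trans (*-congˡ (wordSum-1 wt N n)) (*-comm _ _)))
    (trans (∑<-*ˡ N (∑< N wt ^ n) wt) (*-comm _ _))

  -- With weight 0 on the negative letters only i letters remain, and all words of length n in them
  -- together weigh the n-th power of i. The inverse is introduced to reach the form of
  -- `permSum-layers₁`.
  permSum-power : ∀ i n → permSum n (layers _<ᵇ_ 0# 1# i) ≈ (i × 1#) ^ n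
  permSum-power i n = begin
    permSum n (layers _<ᵇ_ 0# 1# i)                          ≈⟨ permSum-inverse n (layers _<ᵇ_ 0# 1# i) ⟨
    permSum n (λ π → layers _<ᵇ_ 0# 1# i (inverse π))        ≈⟨ permSum-layers₁ 0# 1# i n ⟩
    wordSum (weight 0# 1#) (double i) n (λ _ → 1#)           ≈⟨ wordSum-1 (weight 0# 1#) (double i) n ⟩
    ∑< (double i) (weight 0# 1#) ^ n                         ≈⟨ ^-congˡ n (letters i) ⟩
    (i × 1#) ^ n                                             ∎
    where
    letters : ∀ i → ∑< (double i) (weight 0# 1#) ≈ i × 1#
    letters zero = refl
    letters (suc i) = trans (+-identityˡ _) (+-congˡ (letters i))

-- Generating functions of increasing and decreasing words.

module WordSeries {c ℓ : Level} (R : CommutativeRing c ℓ) where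

  open import Data.List.Base using (replicate)
  import Data.List.Properties as Listₚ
  open import Data.Unit.Base using (⊤; tt)
  open RingKit R hiding (_×_)
  open PowerSeries R
  open WordLemmas
  open WordSums R
  open Standardization R using (wordSum-congₗ)

  module P = RingKit powerSeries

  -- The series 1/(1 - pX); `lin q` is 1 + qX.
  geo : Carrier → ℕ → Carrier
  geo p n = p ^ n

  lin : Carrier → ℕ → Carrier
  lin q zero = 1#
  lin q (suc zero) = q
  lin q (suc (suc n)) = 0#

  lin-⋆ : ∀ q f n → (lin q ⋆ f) (suc n) ≈ f (suc n) + q * f n
  lin-⋆ q f zero = +-congʳ (*-identityˡ _)
  lin-⋆ q f (suc n) = +-cong (*-identityˡ _) (trans (+-congˡ (⋆-zeroˡ f (λ _ → refl) n)) (+-identityʳ _))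

  lin-geo : ∀ q p → p + q ≈ 0# → (lin q ⋆ geo p) P.≈ one
  lin-geo q p e zero = *-identityˡ _
  lin-geo q p e (suc n) = trans (lin-⋆ q (geo p) n) (trans (sym (distribʳ _ _ _)) (trans (*-congʳ e) (zeroˡ _)))

  ⋈-replicate : ∀ (f g : List ⊤ → Carrier) n →
    (f ⋈ g) (replicate n tt) ≈ ((λ i → f (replicate i tt)) ⋆ (λ i → g (replicate i tt))) n
  ⋈-replicate f g zero = refl
  ⋈-replicate f g (suc n) = +-congˡ (⋈-replicate (λ w → f (tt ∷ w)) g n)

  chain-true : ∀ p n → chain (λ _ _ → true) p (replicate n tt) ≈ geo p n
  chain-true p zero = refl
  chain-true p (suc zero) = sym (*-identityʳ p)
  chain-true p (suc (suc n)) = *-congˡ (chain-true p (suc n))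

  chain-false : ∀ q n → chain (λ _ _ → false) q (replicate n tt) ≈ lin q n
  chain-false q zero = refl
  chain-false q (suc zero) = refl
  chain-false q (suc (suc n)) = refl

  -- When every step counts as an ascent, positive labels repeat freely and negative ones never, so
  -- that each layer contributes (1 + qX)/(1 - pX).
  layers-true : ∀ q p j n → layers (λ _ _ → true) q p j (replicate n tt) ≈ ((lin q ⋆ geo p) P.^ j) n
  layers-true q p zero zero = refl
  layers-true q p zero (suc n) = refl
  layers-true q p (suc j) n = begin
    grow (λ _ _ → false) q (grow (λ _ _ → true) p L) (replicate n tt)
      ≈⟨ chain-⋈ (λ _ _ → false) q (grow (λ _ _ → true) p L) (replicate n tt) ⟨
    (chain (λ _ _ → false) q ⋈ grow (λ _ _ → true) p L) (replicate n tt)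
      ≈⟨ ⋈-replicate (chain (λ _ _ → false) q) (grow (λ _ _ → true) p L) n ⟩
    ((λ i → chain (λ _ _ → false) q (replicate i tt)) ⋆ (λ i → grow (λ _ _ → true) p L (replicate i tt))) n
      ≈⟨ ⋆-cong (chain-false q) inner n ⟩
    (lin q ⋆ (geo p ⋆ ((lin q ⋆ geo p) P.^ j))) n
      ≈⟨ ⋆-assoc (lin q) (geo p) ((lin q ⋆ geo p) P.^ j) n ⟨
    ((lin q ⋆ geo p) P.^ suc j) n ∎
    where
    L : List ⊤ → Carrier
    L = layers (λ _ _ → true) q p j
    inner : ∀ i → grow (λ _ _ → true) p L (replicate i tt) ≈ (geo p ⋆ ((lin q ⋆ geo p) P.^ j)) i
    inner i = trans (sym (chain-⋈ (λ _ _ → true) p L (replicate i tt)))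
      (trans (⋈-replicate (chain (λ _ _ → true) p) L i) (⋆-cong (chain-true p) (layers-true q p j) i))

  chain-compatible : ∀ v (w : List ⊤) → length v ≡ length w → chain (step true) 1# v ≈ [ compatible (λ _ _ → true) v w ]· 1#
  chain-compatible [] [] eq = refl
  chain-compatible (d ∷ []) (x ∷ []) eq = refl
  chain-compatible (d ∷ e ∷ v) (x ∷ y ∷ w) eq = trans
    ([]·-cong (step true d e) (trans (*-identityˡ _) (chain-compatible (e ∷ v) (y ∷ w) (ℕₚ.suc-injective eq))))
    (sym ([]·-∧ (step true d e) _ 1#))

  -- The roles of label and letter are exchanged here: an increasing word in signed letters is a
  -- labelling of a word all of whose steps are ascents, to which `compatible-layers` applies.
  wordSum-chain : ∀ q p j n → wordSum (weight q p) (double j) n (chain (step true) 1#) ≈ ((lin q ⋆ geo p) P.^ j) n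
  wordSum-chain q p j n = begin
    M n (chain (step true) 1#)
      ≈⟨ wordSum-congₗ _ _ n (λ v eq → chain-compatible v (replicate n tt) (≡.trans eq (≡.sym (Listₚ.length-replicate n)))) ⟩
    M n (λ v → [ compatible (λ _ _ → true) v (replicate n tt) ]· 1#)
      ≡⟨ cong (λ m → M m (λ v → [ compatible (λ _ _ → true) v (replicate n tt) ]· 1#)) (≡.sym (Listₚ.length-replicate n {x = tt})) ⟩
    M (length (replicate n tt)) (λ v → [ compatible (λ _ _ → true) v (replicate n tt) ]· 1#)
      ≈⟨ compatible-layers (λ _ _ → true) q p j (replicate n tt) ⟩
    layers (λ _ _ → true) q p j (replicate n tt)
      ≈⟨ layers-true q p j n ⟩
    ((lin q ⋆ geo p) P.^ j) n ∎
    where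
    M : ℕ → (List ℕ → Carrier) → Carrier
    M = wordSum (weight q p) (double j)

  chain-scale : ∀ (r : ℕ → ℕ → Bool) u w → chain r u w ≈ u ^ length w * chain r 1# w
  chain-scale r u [] = sym (*-identityˡ 1#)
  chain-scale r u (x ∷ []) = solve 1 (λ u → u := (u :* con (pos 1)) :* con (pos 1)) refl u
  chain-scale r u (x ∷ y ∷ w) = trans ([]·-cong (r x y) (trans (*-congˡ (chain-scale r u (y ∷ w)))
    (solve 3 (λ u a b → u :* (a :* b) := (u :* a) :* (con (pos 1) :* b)) refl u _ _)))
    ([]·-*ˡ (r x y) _ _)

  wordSum-scale : ∀ u q p N n f →
    wordSum (weight q p) N n (λ w → u ^ length w * f w) ≈ wordSum (weight (u * q) (u * p)) N n f
  wordSum-scale u q p N zero f = *-identityˡ _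
  wordSum-scale u q p N (suc n) f = ∑<-cong′ N (λ d → begin
    weight q p d * wordSum (weight q p) N n (λ w → u * u ^ length w * f (d ∷ w))
      ≈⟨ *-congˡ (trans (wordSum-cong _ N n (λ w → *-assoc u _ _)) (wordSum-*ˡ _ N n u (λ w → u ^ length w * f (d ∷ w)))) ⟩
    weight q p d * (u * wordSum (weight q p) N n (λ w → u ^ length w * f (d ∷ w)))
      ≈⟨ *-congˡ (*-congˡ (wordSum-scale u q p N n (λ w → f (d ∷ w)))) ⟩
    weight q p d * (u * wordSum (weight (u * q) (u * p)) N n (λ w → f (d ∷ w)))
      ≈⟨ solve 3 (λ a b c → a :* (b :* c) := (b :* a) :* c) refl _ _ _ ⟩
    u * weight q p d * wordSum (weight (u * q) (u * p)) N n (λ w → f (d ∷ w))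
      ≈⟨ *-congʳ (lem (positive d)) ⟩
    weight (u * q) (u * p) d * wordSum (weight (u * q) (u * p)) N n (λ w → f (d ∷ w)) ∎)
    where
    lem : ∀ b → u * (if b then p else q) ≈ (if b then u * p else u * q)
    lem true = refl
    lem false = refl

  wordSum-isEmpty : ∀ wt N n → wordSum wt N n isEmpty ≈ one n
  wordSum-isEmpty wt N zero = refl
  wordSum-isEmpty wt N (suc n) = ∑<-0 N (λ d _ → trans (*-congˡ (wordSum-0 wt N n (λ _ → refl))) (zeroʳ _))

  geo-cong : ∀ {p p′} → p ≈ p′ → geo p P.≈ geo p′
  geo-cong e n = ^-congˡ n e

  lin-cong : ∀ {q q′} → q ≈ q′ → lin q P.≈ lin q′
  lin-cong e zero = refl
  lin-cong e (suc zero) = e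
  lin-cong e (suc (suc n)) = refl

  module _ (y z : Carrier) (j : ℕ) where

    private
      M : (List ℕ → Carrier) → ℕ → Carrier
      M f n = wordSum (weight z 1#) (double j) n f
      E H H₋ A A₋ B : ℕ → Carrier
      E = M (chain (λ d e → not (step true d e)) y)
      H = M (chain (step true) 1#)
      H₋ = M (chain (step true) (- y))
      -- `A` and `B` are the halves (1 + yX)/(1 - yzX) and (1 + zX)/(1 - X) of F. The inverse `A₋`
      -- of `A` is `B` with -yX in place of X, which is why it arises from increasing words at
      -- weight -y.
      A = lin y ⋆ geo (y * z)
      A₋ = lin (- (y * z)) ⋆ geo (- y)
      B = lin z ⋆ geo 1#

      H₋≈ : H₋ P.≈ A₋ P.^ j
      H₋≈ n = begin
        M (chain (step true) (- y)) n                                            ≈⟨ wordSum-cong _ _ n (chain-scale (step true) (- y)) ⟩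
        M (λ w → (- y) ^ length w * chain (step true) 1# w) n                    ≈⟨ wordSum-scale (- y) z 1# (double j) n (chain (step true) 1#) ⟩
        wordSum (weight (- y * z) (- y * 1#)) (double j) n (chain (step true) 1#) ≈⟨ wordSum-chain (- y * z) (- y * 1#) j n ⟩
        ((lin (- y * z) ⋆ geo (- y * 1#)) P.^ j) n
          ≈⟨ P.^-congˡ j (P.*-cong (lin-cong (sym (-‿distribˡ-* y z))) (geo-cong (*-identityʳ (- y)))) n ⟩
        (A₋ P.^ j) n ∎

      E⋆H₋ : (E ⋆ H₋) P.≈ one
      E⋆H₋ n = begin
        (E ⋆ H₋) n ≈⟨ wordSum-⋈ _ _ n (chain (λ d e → not (step true d e)) y) (chain (step true) (- y)) ⟨
        M (chain (λ d e → not (step true d e)) y ⋈ chain (step true) (- y)) n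
          ≈⟨ wordSum-cong _ _ n (λ w → trans (chain-⋈ (λ d e → not (step true d e)) y (chain (step true) (- y)) w) (grow-chain (step true) y w)) ⟩
        M isEmpty n ≈⟨ wordSum-isEmpty _ _ n ⟩
        one n ∎

      A⋆A₋ : (A₋ ⋆ A) P.≈ one
      A⋆A₋ = P.trans (P.solve 4 (λ a b c d → (c P.:* d) P.:* (a P.:* b) P.:= (a P.:* d) P.:* (c P.:* b)) P.refl (lin y) (geo (y * z)) (lin (- (y * z))) (geo (- y)))
        (P.trans (P.*-cong (lin-geo y (- y) (-‿inverseˡ y)) (lin-geo (- (y * z)) (y * z) (-‿inverseʳ _))) (P.*-identityˡ one))

      -- Both sides are inverse to `H₋`, the left one by `grow-chain`.
      E≈ : E P.≈ A P.^ j
      E≈ = P.begin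
        E                              P.≈⟨ P.*-identityʳ E ⟨
        E ⋆ one                        P.≈⟨ P.*-congˡ (P.trans (P.^-congˡ j A⋆A₋) (P.1^ j)) ⟨
        E ⋆ ((A₋ ⋆ A) P.^ j)           P.≈⟨ P.*-congˡ (P.^-distrib-* A₋ A j) ⟩
        E ⋆ ((A₋ P.^ j) ⋆ (A P.^ j))   P.≈⟨ P.*-congˡ (P.*-congʳ H₋≈) ⟨
        E ⋆ (H₋ ⋆ (A P.^ j))           P.≈⟨ P.*-assoc E H₋ (A P.^ j) ⟨
        (E ⋆ H₋) ⋆ (A P.^ j)           P.≈⟨ P.*-congʳ E⋆H₋ ⟩
        one ⋆ (A P.^ j)                P.≈⟨ P.*-identityˡ (A P.^ j) ⟩
        A P.^ j                        P.∎

      M-layers : ∀ i → M (layers (step true) y 1# i) P.≈ (E ⋆ H) P.^ i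
      M-layers zero n = wordSum-isEmpty _ _ n
      M-layers (suc i) n = begin
        M (grow r̄ y (grow r 1# L)) n                          ≈⟨ wordSum-cong _ _ n (λ w → chain-⋈ r̄ y (grow r 1# L) w) ⟨
        M (chain r̄ y ⋈ grow r 1# L) n                         ≈⟨ wordSum-⋈ _ _ n (chain r̄ y) (grow r 1# L) ⟩
        (E ⋆ M (grow r 1# L)) n                               ≈⟨ ⋆-cong (λ _ → refl) inner n ⟩
        (E ⋆ (H ⋆ ((E ⋆ H) P.^ i))) n                         ≈⟨ ⋆-assoc E H ((E ⋆ H) P.^ i) n ⟨
        ((E ⋆ H) P.^ suc i) n                                 ∎
        where
        r r̄ : ℕ → ℕ → Bool
        r = step true
        r̄ d e = not (step true d e)
        L : List ℕ → Carrier
        L = layers r y 1# i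
        inner : M (grow r 1# L) P.≈ H ⋆ ((E ⋆ H) P.^ i)
        inner m = trans (sym (wordSum-cong _ _ m (λ w → chain-⋈ r 1# L w)))
          (trans (wordSum-⋈ _ _ m (chain r 1#) L) (⋆-cong {f = H} (λ _ → refl) (M-layers i) m))

    wordSum-layers : ∀ i n → wordSum (weight z 1#) (double j) n (layers (step true) y 1# i)
      ≈ (((lin y ⋆ geo (y * z)) ⋆ (lin z ⋆ geo 1#)) P.^ (i ℕ.* j)) n
    wordSum-layers i = P.begin
      M (layers (step true) y 1# i)    P.≈⟨ M-layers i ⟩
      (E ⋆ H) P.^ i                    P.≈⟨ P.^-congˡ i (P.*-cong E≈ (wordSum-chain z 1# j)) ⟩
      ((A P.^ j) ⋆ (B P.^ j)) P.^ i    P.≈⟨ P.^-congˡ i (P.^-distrib-* A B j) ⟨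
      ((A ⋆ B) P.^ j) P.^ i            P.≈⟨ P.^-assocʳ (A ⋆ B) j i ⟩
      (A ⋆ B) P.^ (j ℕ.* i)            P.≡⟨ cong ((A ⋆ B) P.^_) (ℕₚ.*-comm j i) ⟩
      (A ⋆ B) P.^ (i ℕ.* j)            P.∎

  lin-geo-arrange : ∀ y z → ((lin y ⋆ lin z) ⋆ geo (y * z)) ⋆ geo 1# P.≈ (lin y ⋆ geo (y * z)) ⋆ (lin z ⋆ geo 1#)
  lin-geo-arrange y z = P.solve 4 (λ a b c d → ((a P.:* b) P.:* c) P.:* d P.:= (a P.:* c) P.:* (b P.:* d)) P.refl (lin y) (lin z) (geo (y * z)) (geo 1#)

  geo-unique : ∀ c f → (lin (- c) ⋆ f) P.≈ one → f P.≈ geo c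
  geo-unique c f e = P.begin
    f                             P.≈⟨ P.*-identityˡ f ⟨
    one ⋆ f                       P.≈⟨ P.*-congʳ (lin-geo (- c) c (-‿inverseʳ c)) ⟨
    (lin (- c) ⋆ geo c) ⋆ f       P.≈⟨ P.solve 3 (λ a b f → (a P.:* b) P.:* f P.:= (a P.:* f) P.:* b) P.refl (lin (- c)) (geo c) f ⟩
    (lin (- c) ⋆ f) ⋆ geo c       P.≈⟨ P.*-congʳ e ⟩
    one ⋆ geo c                   P.≈⟨ P.*-identityˡ (geo c) ⟩
    geo c                         P.∎

  one+pX : ∀ p n → one n + p * X· one n ≈ lin p n
  one+pX p zero = trans (+-congˡ (zeroʳ p)) (+-identityʳ 1#)
  one+pX p (suc zero) = trans (+-identityˡ _) (*-identityʳ p)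
  one+pX p (suc (suc n)) = trans (+-identityˡ _) (zeroʳ p)

-- The labelling series of one word, in terms of its peaks and descents.

module Transfer {c ℓ : Level} (R : CommutativeRing c ℓ) where

  open import Data.List.Relation.Unary.Linked using (Linked; []; [-]; _∷_)
  open import Data.Product.Base using (_×_; _,_; proj₁)
  open import Data.Empty using (⊥-elim)
  open import Relation.Binary.Definitions using (tri<; tri≈; tri>)
  open import Defs using (pk; des; distinct; notElem; b2n)
  open RingKit R hiding (_×_)
  open PowerSeries R using (C; X·)
  open WordLemmas
  open WordSums R

  module _ {a} {A : Set a} (r : A → A → Bool) (y s : Carrier) where

    mutual
      -- The numerators, over powers of 1 - s, of the series `Υ` and `Θ` below: a scan with two
      -- states, where `totalA` takes over after an ascent. A peak collects 1 + y on entering that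
      -- state and s * (1 + y) on leaving it.
      total : List A → Carrier
      total [] = 1#
      total (x ∷ []) = 1# + y
      total (x ∷ x′ ∷ w) = if r x x′ then (1# + y) * totalA (x′ ∷ w) else (y + s) * total (x′ ∷ w)

      totalA : List A → Carrier
      totalA [] = 1#
      totalA (x ∷ []) = 1# + y * s
      totalA (x ∷ x′ ∷ w) = if r x x′ then (1# + y * s) * totalA (x′ ∷ w) else s * (1# + y) * total (x′ ∷ w)

    -- `L` stands for the passage from fᵢ to Σ fᵢ sⁱ and is known only by these laws, so that the
    -- same argument serves for s, for t and for the case y = 0. The factor m is carried along
    -- because `L` is not assumed to be linear over all ring elements.
    module _ (L : (ℕ → Carrier) → Carrier)
             (L-cong : ∀ {f g} → (∀ i → f i ≈ g i) → L f ≈ L g)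
             (L-+ : ∀ f g → L (λ i → f i + g i) ≈ L f + L g)
             (L-y : ∀ f → L (λ i → y * f i) ≈ y * L f)
             (L-X : ∀ f → L (X· f) ≈ s * L f)
             (m : Carrier) (L-C : L (C m) ≈ m) where

      private
        α : ℕ → List A → Carrier
        α = layers r y 1#
        Ψ Θ Υ : List A → Carrier
        Ψ w = L (λ i → α i w * m)
        Θ w = L (λ i → grow r 1# (α i) w * m)
        Υ w = L (λ i → α (suc i) w * m)

        -- Without layers only the empty word has a labelling, so for a nonempty word the sum starts
        -- at i = 1.
        Ψ-∷ : ∀ x w → Ψ (x ∷ w) ≈ s * Υ (x ∷ w)
        Ψ-∷ x w = trans (L-cong split) (L-X _)
          where
          split : ∀ i → α i (x ∷ w) * m ≈ X· (λ i → α (suc i) (x ∷ w) * m) i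
          split zero = zeroˡ m
          split (suc i) = refl

        Ψ-[] : Ψ [] ≈ m + s * Ψ []
        Ψ-[] = trans (L-cong split) (trans (L-+ (C m) (X· (λ i → α (suc i) [] * m))) (+-cong L-C (L-X _)))
          where
          split : ∀ i → α i [] * m ≈ C m i + X· (λ i → α (suc i) [] * m) i
          split zero = trans (*-identityˡ m) (sym (+-identityʳ m))
          split (suc i) = sym (+-identityˡ _)

        L-sum : ∀ (g h : ℕ → Carrier) → L (λ i → (g i + y * h i) * m) ≈ L (λ i → g i * m) + y * L (λ i → h i * m)
        L-sum g h = trans (L-cong (λ i → solve 4 (λ g y h m → (g :+ y :* h) :* m := g :* m :+ y :* (h :* m)) refl (g i) y (h i) m))
          (trans (L-+ (λ i → g i * m) (λ i → y * (h i * m))) (+-congˡ (L-y (λ i → h i * m))))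

        L-sum₁ : ∀ (g h : ℕ → Carrier) → L (λ i → (g i + 1# * h i) * m) ≈ L (λ i → g i * m) + L (λ i → h i * m)
        L-sum₁ g h = trans (L-cong (λ i → solve 3 (λ g h m → (g :+ con (pos 1) :* h) :* m := g :* m :+ h :* m) refl (g i) (h i) m))
          (L-+ (λ i → g i * m) (λ i → h i * m))

        -- Eliminating one unknown leaves the factor 1 - s. At an ascent both unknowns depend on the
        -- tail only through Θ₀, at a descent only through Υ₀; therefore the solution is a product
        -- over the steps of the word.
        module Step {Υ₁ Θ₁ : Carrier} where
          ascΥ : ∀ {Θ₀} → Υ₁ ≈ Θ₁ + y * Θ₀ → Θ₁ ≈ s * Υ₁ + Θ₀ → (1# - s) * Υ₁ ≈ (1# + y) * Θ₀
          ascΥ {Θ₀} e₁ e₂ = begin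
            (1# - s) * Υ₁                        ≈⟨ solve 2 (λ s u → (con (pos 1) :- s) :* u := u :- s :* u) refl s Υ₁ ⟩
            Υ₁ - s * Υ₁                          ≈⟨ +-congʳ (trans e₁ (+-congʳ e₂)) ⟩
            ((s * Υ₁ + Θ₀) + y * Θ₀) - s * Υ₁    ≈⟨ solve 4 (λ s u y t → ((s :* u :+ t) :+ y :* t) :- s :* u := (con (pos 1) :+ y) :* t) refl s Υ₁ y Θ₀ ⟩
            (1# + y) * Θ₀                        ∎
          ascΘ : ∀ {Θ₀} → Υ₁ ≈ Θ₁ + y * Θ₀ → Θ₁ ≈ s * Υ₁ + Θ₀ → (1# - s) * Θ₁ ≈ (1# + y * s) * Θ₀
          ascΘ {Θ₀} e₁ e₂ = begin
            (1# - s) * Θ₁                                ≈⟨ *-congˡ e₂ ⟩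
            (1# - s) * (s * Υ₁ + Θ₀)                     ≈⟨ solve 3 (λ s u t → (con (pos 1) :- s) :* (s :* u :+ t) := s :* ((con (pos 1) :- s) :* u) :+ (con (pos 1) :- s) :* t) refl s Υ₁ Θ₀ ⟩
            s * ((1# - s) * Υ₁) + (1# - s) * Θ₀          ≈⟨ +-congʳ (*-congˡ (ascΥ e₁ e₂)) ⟩
            s * ((1# + y) * Θ₀) + (1# - s) * Θ₀          ≈⟨ solve 3 (λ s y t → s :* ((con (pos 1) :+ y) :* t) :+ (con (pos 1) :- s) :* t := (con (pos 1) :+ y :* s) :* t) refl s y Θ₀ ⟩
            (1# + y * s) * Θ₀                            ∎
          descΥ : ∀ {Υ₀} → Υ₁ ≈ Θ₁ + y * Υ₀ → Θ₁ ≈ s * Υ₁ + s * Υ₀ → (1# - s) * Υ₁ ≈ (y + s) * Υ₀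
          descΥ {Υ₀} e₁ e₂ = begin
            (1# - s) * Υ₁                             ≈⟨ solve 2 (λ s u → (con (pos 1) :- s) :* u := u :- s :* u) refl s Υ₁ ⟩
            Υ₁ - s * Υ₁                               ≈⟨ +-congʳ (trans e₁ (+-congʳ e₂)) ⟩
            ((s * Υ₁ + s * Υ₀) + y * Υ₀) - s * Υ₁     ≈⟨ solve 4 (λ s u y t → ((s :* u :+ s :* t) :+ y :* t) :- s :* u := (y :+ s) :* t) refl s Υ₁ y Υ₀ ⟩
            (y + s) * Υ₀                              ∎
          descΘ : ∀ {Υ₀} → Υ₁ ≈ Θ₁ + y * Υ₀ → Θ₁ ≈ s * Υ₁ + s * Υ₀ → (1# - s) * Θ₁ ≈ s * (1# + y) * Υ₀
          descΘ {Υ₀} e₁ e₂ = begin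
            (1# - s) * Θ₁                                ≈⟨ *-congˡ e₂ ⟩
            (1# - s) * (s * Υ₁ + s * Υ₀)                 ≈⟨ solve 3 (λ s u t → (con (pos 1) :- s) :* (s :* u :+ s :* t) := s :* ((con (pos 1) :- s) :* u) :+ (con (pos 1) :- s) :* (s :* t)) refl s Υ₁ Υ₀ ⟩
            s * ((1# - s) * Υ₁) + (1# - s) * (s * Υ₀)    ≈⟨ +-congʳ (*-congˡ (descΥ e₁ e₂)) ⟩
            s * ((y + s) * Υ₀) + (1# - s) * (s * Υ₀)     ≈⟨ solve 3 (λ s y t → s :* ((y :+ s) :* t) :+ (con (pos 1) :- s) :* (s :* t) := s :* (con (pos 1) :+ y) :* t) refl s y Υ₀ ⟩
            s * (1# + y) * Υ₀                            ∎

        lift : ∀ n {a k b t} → (1# - s) * a ≈ k * b → (1# - s) ^ n * b ≈ t * m → (1# - s) ^ suc n * a ≈ k * t * m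
        lift n {a} {k} {b} {t} e₁ e₂ = begin
          (1# - s) * (1# - s) ^ n * a      ≈⟨ solve 3 (λ d e a → d :* e :* a := e :* (d :* a)) refl _ _ _ ⟩
          (1# - s) ^ n * ((1# - s) * a)    ≈⟨ *-congˡ e₁ ⟩
          (1# - s) ^ n * (k * b)           ≈⟨ solve 3 (λ d e a → d :* (e :* a) := e :* (d :* a)) refl _ _ _ ⟩
          k * ((1# - s) ^ n * b)           ≈⟨ *-congˡ e₂ ⟩
          k * (t * m)                      ≈⟨ *-assoc k t m ⟨
          k * t * m                        ∎

        base : (1# - s) ^ 1 * Ψ [] ≈ 1# * m
        base = begin
          (1# - s) ^ 1 * Ψ []    ≈⟨ solve 2 (λ s u → ((con (pos 1) :- s) :* con (pos 1)) :* u := u :- s :* u) refl s (Ψ []) ⟩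
          Ψ [] - s * Ψ []        ≈⟨ +-congʳ Ψ-[] ⟩
          (m + s * Ψ []) - s * Ψ [] ≈⟨ solve 2 (λ m u → (m :+ u) :- u := con (pos 1) :* m) refl m _ ⟩
          1# * m                 ∎

        L-if : ∀ b (f g : ℕ → Carrier) → L (λ i → (if b then f i else g i) * m) ≈ (if b then L (λ i → f i * m) else L (λ i → g i * m))
        L-if true f g = refl
        L-if false f g = refl

        step-total : ∀ b n {Υ₁ Θ₁ Υ₀ Θ₀ t tA} → Υ₁ ≈ Θ₁ + y * (if not b then Υ₀ else Θ₀) → Θ₁ ≈ s * Υ₁ + (if b then Θ₀ else s * Υ₀) →
          (1# - s) ^ n * Υ₀ ≈ t * m × (1# - s) ^ n * Θ₀ ≈ tA * m →
          (1# - s) ^ suc n * Υ₁ ≈ (if b then (1# + y) * tA else (y + s) * t) * m ×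
          (1# - s) ^ suc n * Θ₁ ≈ (if b then (1# + y * s) * tA else s * (1# + y) * t) * m
        step-total true n e₁ e₂ (_ , ihΘ) = lift n (Step.ascΥ e₁ e₂) ihΘ , lift n (Step.ascΘ e₁ e₂) ihΘ
        step-total false n e₁ e₂ (ihΥ , _) = lift n (Step.descΥ e₁ e₂) ihΥ , lift n (Step.descΘ e₁ e₂) ihΥ

        Υ-Θ-total : ∀ x w → (1# - s) ^ suc (suc (length w)) * Υ (x ∷ w) ≈ total (x ∷ w) * m
                          × (1# - s) ^ suc (suc (length w)) * Θ (x ∷ w) ≈ totalA (x ∷ w) * m
        -- Behind a single letter the series `Ψ []` takes the place of Θ₀, so the last letter is
        -- treated like an ascent.
        Υ-Θ-total x [] =
          trans (lift 1 (Step.ascΥ e₁ e₂) base) (*-congʳ (*-identityʳ _)) , trans (lift 1 (Step.ascΘ e₁ e₂) base) (*-congʳ (*-identityʳ _))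
          where
          e₁ : Υ (x ∷ []) ≈ Θ (x ∷ []) + y * Ψ []
          e₁ = L-sum (λ i → grow r 1# (α i) (x ∷ [])) (λ i → α i [])
          e₂ : Θ (x ∷ []) ≈ s * Υ (x ∷ []) + Ψ []
          e₂ = trans (L-sum₁ (λ i → α i (x ∷ [])) (λ i → α i [])) (+-congʳ (Ψ-∷ x []))
        Υ-Θ-total x (x′ ∷ w) = step-total (r x x′) (suc (suc (length w))) e₁ e₂ (Υ-Θ-total x′ w)
          where
          e₁ : Υ (x ∷ x′ ∷ w) ≈ Θ (x ∷ x′ ∷ w) + y * (if not (r x x′) then Υ (x′ ∷ w) else Θ (x′ ∷ w))
          e₁ = trans (L-sum (λ i → grow r 1# (α i) (x ∷ x′ ∷ w))
                            (λ i → if not (r x x′) then α (suc i) (x′ ∷ w) else grow r 1# (α i) (x′ ∷ w)))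
            (+-congˡ (*-congˡ (L-if (not (r x x′)) (λ i → α (suc i) (x′ ∷ w)) (λ i → grow r 1# (α i) (x′ ∷ w)))))
          e₂ : Θ (x ∷ x′ ∷ w) ≈ s * Υ (x ∷ x′ ∷ w) + (if r x x′ then Θ (x′ ∷ w) else s * Υ (x′ ∷ w))
          e₂ = trans (L-sum₁ (λ i → α i (x ∷ x′ ∷ w)) (λ i → if r x x′ then grow r 1# (α i) (x′ ∷ w) else α i (x′ ∷ w)))
            (+-cong (Ψ-∷ x (x′ ∷ w)) (trans (L-if (r x x′) (λ i → grow r 1# (α i) (x′ ∷ w)) (λ i → α i (x′ ∷ w)))
                                             (if-cong (r x x′) refl (Ψ-∷ x′ w))))

      layers-[] : (1# - s) ^ 1 * L (λ i → layers r y 1# i [] * m) ≈ m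
      layers-[] = trans base (*-identityˡ m)

      layers-total : ∀ x w → (1# - s) ^ suc (suc (length w)) * L (λ i → layers r y 1# i (x ∷ w) * m) ≈ s * total (x ∷ w) * m
      layers-total x w = begin
        (1# - s) ^ suc (suc (length w)) * Ψ (x ∷ w)        ≈⟨ *-congˡ (Ψ-∷ x w) ⟩
        (1# - s) ^ suc (suc (length w)) * (s * Υ (x ∷ w))  ≈⟨ solve 3 (λ d e a → d :* (e :* a) := e :* (d :* a)) refl _ _ _ ⟩
        s * ((1# - s) ^ suc (suc (length w)) * Υ (x ∷ w))  ≈⟨ *-congˡ (proj₁ (Υ-Θ-total x w)) ⟩
        s * (total (x ∷ w) * m)                            ≈⟨ *-assoc s _ m ⟨
        s * total (x ∷ w) * m                              ∎

  Opposite : ℕ → ℕ → Set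
  Opposite a b = (b <ᵇ a) ≡ not (a <ᵇ b)

  ≢⇒Opposite : ∀ a b → (a ≡ᵇ b) ≡ false → Opposite a b
  ≢⇒Opposite a b h with ℕₚ.<-cmp a b
  ... | tri< a<b _ _ rewrite <ᵇ-true a<b = <ᵇ-false (ℕₚ.<⇒≤ a<b)
  ... | tri> _ _ a>b rewrite <ᵇ-true a>b = ≡.sym (cong not (<ᵇ-false (ℕₚ.<⇒≤ a>b)))
  ... | tri≈ _ ≡.refl _ = ⊥-elim (true≢false (≡ᵇ-refl a) h)

  distinct⇒Linked : ∀ w → distinct w ≡ true → Linked Opposite w
  distinct⇒Linked [] d = []
  distinct⇒Linked (a ∷ []) d = [-]
  distinct⇒Linked (a ∷ b ∷ w) d = ≢⇒Opposite a b (lem (∧-trueˡ d)) ∷ distinct⇒Linked (b ∷ w) (∧-trueʳ {notElem a (b ∷ w)} d)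
    where
    lem : ∀ {x c} → (if x then false else c) ≡ true → x ≡ false
    lem {false} _ = ≡.refl

  -- Peaks of a word that is thought of as preceded by a smaller letter.
  pkA : List ℕ → ℕ
  pkA [] = 0
  pkA (a ∷ []) = 0
  pkA (a ∷ b ∷ w) = if a <ᵇ b then pkA (b ∷ w) else suc (pk (b ∷ w))

  -- `pk` tests a descent directly and `pkA` as the failure of an ascent; the two tests agree for
  -- distinct neighbours.
  pk-step : ∀ a b w → Linked Opposite (a ∷ b ∷ w) → pk (a ∷ b ∷ w) ≡ (if a <ᵇ b then pkA (b ∷ w) else pk (b ∷ w))
  pk-step a b [] l with a <ᵇ b
  ... | true = ≡.refl
  ... | false = ≡.refl
  pk-step a b (e ∷ w) (_ ∷ (o ∷ l)) = lem (a <ᵇ b) (b <ᵇ e) (e <ᵇ b) o (pk-step b e w (o ∷ l))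
    where
    lem : ∀ x z z′ → z′ ≡ not z → ∀ {p q r} → p ≡ (if z then q else r) →
      b2n (x ∧ z′) ℕ.+ p ≡ (if x then (if z then q else suc r) else p)
    lem false z z′ _ e = ≡.refl
    lem true true _ ≡.refl e = e
    lem true false _ ≡.refl e = cong suc e

  -- Descents preceded by a descent, for a word thought of as preceded by a larger (dd) or smaller (ddA) letter.
  mutual
    dd : List ℕ → ℕ
    dd [] = 0
    dd (a ∷ []) = 0
    dd (a ∷ b ∷ w) = if a <ᵇ b then ddA (b ∷ w) else suc (dd (b ∷ w))

    ddA : List ℕ → ℕ
    ddA [] = 0
    ddA (a ∷ []) = 0
    ddA (a ∷ b ∷ w) = if a <ᵇ b then ddA (b ∷ w) else dd (b ∷ w)

  mutual
    -- A descent that follows an ascent starts at a peak. All others are counted by `dd`, an initial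
    -- one thanks to the imagined larger letter in front.
    des-dd : ∀ a w → Linked Opposite (a ∷ w) → des (a ∷ w) ≡ dd (a ∷ w) ℕ.+ pk (a ∷ w)
    des-dd a [] l = ≡.refl
    des-dd a (b ∷ w) (o ∷ l) = lem (a <ᵇ b) (b <ᵇ a) o (pk-step a b w (o ∷ l)) (des-dd b w l) (des-ddA b w l)
      where
      v : List ℕ
      v = b ∷ w
      lem : ∀ x x′ → x′ ≡ not x → ∀ {p} → p ≡ (if x then pkA v else pk v) → des v ≡ dd v ℕ.+ pk v → des v ≡ ddA v ℕ.+ pkA v →
        b2n x′ ℕ.+ des v ≡ (if x then ddA v else suc (dd v)) ℕ.+ p
      lem true _ ≡.refl ≡.refl _ e = e
      lem false _ ≡.refl ≡.refl e _ = cong suc e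

    des-ddA : ∀ a w → Linked Opposite (a ∷ w) → des (a ∷ w) ≡ ddA (a ∷ w) ℕ.+ pkA (a ∷ w)
    des-ddA a [] l = ≡.refl
    des-ddA a (b ∷ w) (o ∷ l) = lem (a <ᵇ b) (b <ᵇ a) o (des-dd b w l) (des-ddA b w l)
      where
      v : List ℕ
      v = b ∷ w
      lem : ∀ x x′ → x′ ≡ not x → des v ≡ dd v ℕ.+ pk v → des v ≡ ddA v ℕ.+ pkA v →
        b2n x′ ℕ.+ des v ≡ (if x then ddA v else dd v) ℕ.+ (if x then pkA v else suc (pk v))
      lem true _ ≡.refl _ e = e
      lem false _ ≡.refl e _ = ≡.trans (cong suc e) (≡.sym (ℕₚ.+-suc (dd v) (pk v)))

  -- Each peak is the start of a descent of its own.
  pk≤des : ∀ w → pk w ℕ.≤ des w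
  pk≤des [] = ℕ.z≤n
  pk≤des (a ∷ w) = ℕₚ.≤-trans (tail a w) (des-tail a w)
    where
    des-tail : ∀ a w → des w ℕ.≤ des (a ∷ w)
    des-tail a [] = ℕ.z≤n
    des-tail a (b ∷ w) = ℕₚ.m≤n+m (des (b ∷ w)) (b2n (b <ᵇ a))
    ∧-b2n : ∀ x y → b2n (x ∧ y) ℕ.≤ b2n y
    ∧-b2n true y = ℕₚ.≤-refl
    ∧-b2n false y = ℕ.z≤n
    tail : ∀ a w → pk (a ∷ w) ℕ.≤ des w
    tail a [] = ℕ.z≤n
    tail a (b ∷ []) = ℕ.z≤n
    tail a (b ∷ e ∷ w) = ℕₚ.+-mono-≤ (∧-b2n (a <ᵇ b) (e <ᵇ b)) (tail b (e ∷ w))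

  module _ (s : Carrier) where

    mutual
      total-0 : ∀ a w → Linked Opposite (a ∷ w) → total _<ᵇ_ 0# s (a ∷ w) ≈ s ^ des (a ∷ w)
      total-0 a [] l = +-identityʳ 1#
      total-0 a (b ∷ w) (o ∷ l) = lem (a <ᵇ b) (b <ᵇ a) o (total-0 b w l) (totalA-0 b w l)
        where
        lem : ∀ x x′ → x′ ≡ not x → ∀ {t tA n} → t ≈ s ^ n → tA ≈ s ^ n →
          (if x then (1# + 0#) * tA else (0# + s) * t) ≈ s ^ (b2n x′ ℕ.+ n)
        lem true _ ≡.refl e eA = trans (*-cong (+-identityʳ 1#) eA) (*-identityˡ _)
        lem false _ ≡.refl e eA = *-cong (+-identityˡ s) e

      totalA-0 : ∀ a w → Linked Opposite (a ∷ w) → totalA _<ᵇ_ 0# s (a ∷ w) ≈ s ^ des (a ∷ w)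
      totalA-0 a [] l = trans (+-congˡ (zeroˡ s)) (+-identityʳ 1#)
      totalA-0 a (b ∷ w) (o ∷ l) = lem (a <ᵇ b) (b <ᵇ a) o (total-0 b w l) (totalA-0 b w l)
        where
        lem : ∀ x x′ → x′ ≡ not x → ∀ {t tA n} → t ≈ s ^ n → tA ≈ s ^ n →
          (if x then (1# + 0# * s) * tA else s * (1# + 0#) * t) ≈ s ^ (b2n x′ ℕ.+ n)
        lem true _ ≡.refl e eA = trans (*-cong (trans (+-congˡ (zeroˡ s)) (+-identityʳ 1#)) eA) (*-identityˡ _)
        lem false _ ≡.refl e eA = *-cong (trans (*-congˡ (+-identityʳ 1#)) (*-identityʳ s)) e

  module _ (y s : Carrier) where

    private
      m k d u : Carrier
      m = 1# + y
      k = 1# + y * s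
      d = y + s
      u = m * m * s
      t tA : List ℕ → Carrier
      t = total _<ᵇ_ y s
      tA = totalA _<ᵇ_ y s

    mutual
      -- The exponent n - 1 - pk - des of `k` is cleared to the other side, which keeps truncated
      -- subtraction out of the induction. A peak accounts for `u`, a descent that is not at a peak
      -- for `d`.
      total-closed : ∀ a w → Linked Opposite (a ∷ w) →
        t (a ∷ w) * (k ^ pk (a ∷ w) * (k ^ des (a ∷ w) * k)) ≈ m * (u ^ pk (a ∷ w) * d ^ dd (a ∷ w) * k ^ suc (length w))
      total-closed a [] l = solve 2 (λ m k → m :* (con (pos 1) :* (con (pos 1) :* k)) := m :* (con (pos 1) :* con (pos 1) :* (k :* con (pos 1)))) refl m k
      total-closed a (b ∷ w) (o ∷ l) = lem (a <ᵇ b) (b <ᵇ a) o (pk-step a b w (o ∷ l)) (total-closed b w l) (totalA-closed b w l)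
        where
        v : List ℕ
        v = b ∷ w
        lem : ∀ x x′ → x′ ≡ not x → ∀ {p} → p ≡ (if x then pkA v else pk v) →
          t v * (k ^ pk v * (k ^ des v * k)) ≈ m * (u ^ pk v * d ^ dd v * k ^ length v) →
          tA v * (k ^ pkA v * k ^ des v) ≈ u ^ pkA v * d ^ ddA v * k ^ length v →
          (if x then m * tA v else d * t v) * (k ^ p * (k ^ (b2n x′ ℕ.+ des v) * k))
            ≈ m * (u ^ p * d ^ (if x then ddA v else suc (dd v)) * k ^ suc (length v))
        lem true _ ≡.refl ≡.refl ih ihA =
          trans (solve 5 (λ m k v kp kd → m :* v :* (kp :* (kd :* k)) := (m :* k) :* (v :* (kp :* kd))) refl _ _ _ _ _)
            (trans (*-congˡ ihA) (solve 5 (λ m k up dd kn → (m :* k) :* (up :* dd :* kn) := m :* (up :* dd :* (k :* kn))) refl _ _ _ _ _))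
        lem false _ ≡.refl ≡.refl ih ihA =
          trans (solve 5 (λ d k v kp kd → d :* v :* (kp :* (k :* kd :* k)) := (d :* k) :* (v :* (kp :* (kd :* k)))) refl _ _ _ _ _)
            (trans (*-congˡ ih) (solve 6 (λ d m k up dd kn → (d :* k) :* (m :* (up :* dd :* kn)) := m :* (up :* (d :* dd) :* (k :* kn))) refl _ _ _ _ _ _))

      totalA-closed : ∀ a w → Linked Opposite (a ∷ w) →
        tA (a ∷ w) * (k ^ pkA (a ∷ w) * k ^ des (a ∷ w)) ≈ u ^ pkA (a ∷ w) * d ^ ddA (a ∷ w) * k ^ suc (length w)
      totalA-closed a [] l = solve 1 (λ k → k :* (con (pos 1) :* con (pos 1)) := con (pos 1) :* con (pos 1) :* (k :* con (pos 1))) refl k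
      totalA-closed a (b ∷ w) (o ∷ l) = lem (a <ᵇ b) (b <ᵇ a) o (total-closed b w l) (totalA-closed b w l)
        where
        v : List ℕ
        v = b ∷ w
        lem : ∀ x x′ → x′ ≡ not x →
          t v * (k ^ pk v * (k ^ des v * k)) ≈ m * (u ^ pk v * d ^ dd v * k ^ length v) →
          tA v * (k ^ pkA v * k ^ des v) ≈ u ^ pkA v * d ^ ddA v * k ^ length v →
          (if x then k * tA v else s * m * t v) * (k ^ (if x then pkA v else suc (pk v)) * k ^ (b2n x′ ℕ.+ des v))
            ≈ u ^ (if x then pkA v else suc (pk v)) * d ^ (if x then ddA v else dd v) * k ^ suc (length v)
        lem true _ ≡.refl ih ihA = trans (*-assoc k _ _)
          (trans (*-congˡ ihA) (solve 4 (λ k up dd kn → k :* (up :* dd :* kn) := up :* dd :* (k :* kn)) refl _ _ _ _))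
        lem false _ ≡.refl ih ihA =
          trans (solve 6 (λ s m k v kp kd → s :* m :* v :* (k :* kp :* (k :* kd)) := (s :* m :* k) :* (v :* (kp :* (kd :* k)))) refl _ _ _ _ _ _)
            (trans (*-congˡ ih) (solve 6 (λ s m k up dd kn → (s :* m :* k) :* (m :* (up :* dd :* kn)) := (m :* m :* s :* up) :* dd :* (k :* kn)) refl _ _ _ _ _ _))

    -- The part of a monomial of Pₙ in y and s after the substitution of the theorem; j stands for 1/(1 + ys).
    monomial : Carrier → ℕ → ℕ → Carrier
    monomial j p e = u ^ suc p * d ^ (e ∸ p) * (j ^ suc p * j ^ suc e)

    module _ (j : Carrier) (jk : k * j ≈ 1#) where

      private
        jk^ : ∀ n → k ^ n * j ^ n ≈ 1#
        jk^ n = inverse-^ n jk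

      -- Numerator and denominator of a substituted monomial. As `d` has no inverse, its power p + 1
      -- below is matched against the power e + 1 above, leaving e ∸ p; only `k` is inverted, by j.
      monomial-fraction : ∀ {p e} → p ℕ.≤ e → u ^ suc p * d ^ suc e ≈ monomial j p e * ((d * k) ^ suc p * k ^ suc e)
      monomial-fraction {p} {e} p≤e = sym (begin
        U * d ^ (e ∸ p) * (j ^ suc p * j ^ suc e) * ((d * k) ^ suc p * k ^ suc e)
          ≈⟨ *-congˡ (*-congʳ (^-distrib-* d k (suc p))) ⟩
        U * d ^ (e ∸ p) * (j ^ suc p * j ^ suc e) * (d ^ suc p * k ^ suc p * k ^ suc e)
          ≈⟨ solve 7 (λ U D J J′ D′ K K′ → U :* D :* (J :* J′) :* (D′ :* K :* K′) := (U :* (D :* D′)) :* ((K :* J) :* (K′ :* J′))) refl _ _ _ _ _ _ _ ⟩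
        (U * (d ^ (e ∸ p) * d ^ suc p)) * ((k ^ suc p * j ^ suc p) * (k ^ suc e * j ^ suc e))
          ≈⟨ *-cong (*-congˡ (sym (^-homo-* d (e ∸ p) (suc p)))) (trans (*-cong (jk^ (suc p)) (jk^ (suc e))) (*-identityˡ 1#)) ⟩
        (U * d ^ (e ∸ p ℕ.+ suc p)) * 1#
          ≈⟨ *-identityʳ _ ⟩
        U * d ^ (e ∸ p ℕ.+ suc p)
          ≡⟨ cong (λ n → U * d ^ n) (≡.trans (ℕₚ.+-suc (e ∸ p) p) (cong suc (ℕₚ.m∸n+n≡m p≤e))) ⟩
        U * d ^ suc e ∎)
        where
        U : Carrier
        U = u ^ suc p

      monomial-total : ∀ a w → Linked Opposite (a ∷ w) →
        k ^ suc (suc (length w)) * monomial j (pk (a ∷ w)) (des (a ∷ w)) ≈ m * (s * t (a ∷ w))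
      monomial-total a w l = begin
        k * K * (u * U * d ^ (des v ∸ pk v) * (j * j ^ pk v * (j * j ^ des v)))
          ≡⟨ cong (λ n → k * K * (u * U * d ^ n * (j * j ^ pk v * (j * j ^ des v)))) dd≡ ⟩
        k * K * (m * m * s * U * D * (j * j ^ pk v * (j * j ^ des v)))
          ≈⟨ solve 9 (λ k K m s U D j J J′ → k :* K :* (m :* m :* s :* U :* D :* (j :* J :* (j :* J′))) := (m :* s) :* (m :* (U :* D :* K)) :* (k :* j :* (j :* (J :* J′)))) refl k K m s U D j _ _ ⟩
        (m * s) * (m * (U * D * K)) * (k * j * (j * (j ^ pk v * j ^ des v)))
          ≈⟨ *-congʳ (*-congˡ (total-closed a w l)) ⟨
        (m * s) * (t v * (k ^ pk v * (k ^ des v * k))) * (k * j * (j * (j ^ pk v * j ^ des v)))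
          ≈⟨ solve 9 (λ m s t k j P E J J′ → (m :* s) :* (t :* (P :* (E :* k))) :* (k :* j :* (j :* (J :* J′))) := (m :* (s :* t)) :* ((k :* j) :* (k :* j) :* ((P :* J) :* (E :* J′)))) refl m s (t v) k j _ _ _ _ ⟩
        (m * (s * t v)) * ((k * j) * (k * j) * ((k ^ pk v * j ^ pk v) * (k ^ des v * j ^ des v)))
          ≈⟨ *-congˡ (*-cong (*-cong jk jk) (*-cong (jk^ (pk v)) (jk^ (des v)))) ⟩
        (m * (s * t v)) * (1# * 1# * (1# * 1#))
          ≈⟨ solve 1 (λ x → x :* (con (pos 1) :* con (pos 1) :* (con (pos 1) :* con (pos 1))) := x) refl _ ⟩
        m * (s * t v) ∎
        where
        v : List ℕ
        v = a ∷ w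
        K U D : Carrier
        K = k ^ suc (length w)
        U = u ^ pk v
        D = d ^ dd v
        dd≡ : des v ∸ pk v ≡ dd v
        dd≡ = ≡.trans (cong (_∸ pk v) (des-dd a w l)) (ℕₚ.m+n∸n≡m (dd v) (pk v))

-- Removing a part from a partition, and its effect on z_λ.

module PartitionLemmas where

  open import Data.Nat.Base as ℕ using (_+_; _*_; _≤_; _<_; _!)
  open import Data.Nat.Properties
  open import Data.Nat.ListAction using (sum; product)
  open import Data.List.Properties using (map-applyUpTo)
  open import Data.List.Relation.Unary.All using (All; []; _∷_)
  open import Data.Empty using (⊥-elim)
  open import Relation.Binary.PropositionalEquality
  open import Defs using (count; zλ)

  mem : ℕ → List ℕ → Bool
  mem k [] = false
  mem k (a ∷ p) = if k ≡ᵇ a then true else mem k p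

  remove : ℕ → List ℕ → List ℕ
  remove k [] = []
  remove k (a ∷ p) = if k ≡ᵇ a then p else a ∷ remove k p

  ≡ᵇ-true : ∀ m n → (m ≡ᵇ n) ≡ true → m ≡ n
  ≡ᵇ-true zero zero _ = refl
  ≡ᵇ-true (suc m) (suc n) h = cong suc (≡ᵇ-true m n h)

  ≡ᵇ-false : ∀ {m n} → m ≢ n → (m ≡ᵇ n) ≡ false
  ≡ᵇ-false {m} {n} m≢n with m ≡ᵇ n in q
  ... | true = ⊥-elim (m≢n (≡ᵇ-true m n q))
  ... | false = refl

  count-∷ : ∀ i a p → count i (a ∷ p) ≡ (if i ≡ᵇ a then suc (count i p) else count i p)
  count-∷ i a p with i ≡ᵇ a
  ... | true = refl
  ... | false = refl

  count-∉ : ∀ k p → mem k p ≡ false → count k p ≡ 0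
  count-∉ k [] h = refl
  count-∉ k (a ∷ p) h with k ≡ᵇ a
  count-∉ k (a ∷ p) () | true
  count-∉ k (a ∷ p) h | false = count-∉ k p h

  count-remove : ∀ k p → mem k p ≡ true → count k p ≡ suc (count k (remove k p))
  count-remove k (a ∷ p) h with k ≡ᵇ a in q
  ... | true = refl
  ... | false rewrite q = count-remove k p h

  count-remove-≢ : ∀ i k p → (i ≡ᵇ k) ≡ false → count i p ≡ count i (remove k p)
  count-remove-≢ i k [] h = refl
  count-remove-≢ i k (a ∷ p) h with k ≡ᵇ a in q
  ... | true = trans (count-∷ i a p) (cong (λ b → if b then suc (count i p) else count i p) (subst (λ x → (i ≡ᵇ x) ≡ false) (≡ᵇ-true k a q) h))
  ... | false = trans (count-∷ i a p) (trans (cong (λ n → if i ≡ᵇ a then suc n else n) (count-remove-≢ i k p h)) (sym (count-∷ i a (remove k p))))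

  product-remove : ∀ k p → mem k p ≡ true → product p ≡ k * product (remove k p)
  product-remove k (a ∷ p) h with k ≡ᵇ a in q
  ... | true = cong (_* product p) (sym (≡ᵇ-true k a q))
  ... | false = begin
    a * product p                     ≡⟨ cong (a *_) (product-remove k p h) ⟩
    a * (k * product (remove k p))    ≡⟨ *-assoc a k _ ⟨
    a * k * product (remove k p)      ≡⟨ cong (_* product (remove k p)) (*-comm a k) ⟩
    k * a * product (remove k p)      ≡⟨ *-assoc k a _ ⟩
    k * (a * product (remove k p))    ∎
    where open ≡-Reasoning

  sum-remove : ∀ k p → mem k p ≡ true → sum p ≡ k + sum (remove k p)
  sum-remove k (a ∷ p) h with k ≡ᵇ a in q
  ... | true = cong (_+ sum p) (sym (≡ᵇ-true k a q))
  ... | false = begin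
    a + sum p                     ≡⟨ cong (a +_) (sum-remove k p h) ⟩
    a + (k + sum (remove k p))    ≡⟨ +-assoc a k _ ⟨
    a + k + sum (remove k p)      ≡⟨ cong (_+ sum (remove k p)) (+-comm a k) ⟩
    k + a + sum (remove k p)      ≡⟨ +-assoc k a _ ⟩
    k + (a + sum (remove k p))    ∎
    where open ≡-Reasoning

  remove-positive : ∀ k {p} → All (1 ≤_) p → All (1 ≤_) (remove k p)
  remove-positive k [] = []
  remove-positive k (_∷_ {a} h hs) with k ≡ᵇ a
  ... | true = hs
  ... | false = h ∷ remove-positive k hs

  count-large : ∀ i p → sum p < i → count i p ≡ 0
  count-large i [] h = refl
  count-large i (a ∷ p) h = trans (count-∷ i a p)
    (trans (cong (λ b → if b then suc (count i p) else count i p) (≡ᵇ-false {i} {a} (λ i≡a → <⇒≱ h (≤-trans (≤-reflexive i≡a) (m≤m+n a (sum p))))))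
      (count-large i p (≤-<-trans (m≤n+m (sum p) a) h)))

  -- The factorials of `zλ`, built up at the last factor so that a longer range only appends
  -- factors.
  multiplicities : ℕ → List ℕ → ℕ
  multiplicities zero p = 1
  multiplicities (suc N) p = multiplicities N p * (count (suc N) p) !

  product-applyUpTo-last : ∀ (f : ℕ → ℕ) N → product (applyUpTo f (suc N)) ≡ product (applyUpTo f N) * f N
  product-applyUpTo-last f zero = *-comm (f 0) 1
  product-applyUpTo-last f (suc N) = trans (cong (f 0 *_) (product-applyUpTo-last (λ i → f (suc i)) N)) (sym (*-assoc (f 0) _ _))

  multiplicities-product : ∀ N p → product (map (λ i → (count i p) !) (applyUpTo suc N)) ≡ multiplicities N p
  multiplicities-product zero p = refl
  multiplicities-product (suc N) p = trans (cong product (map-applyUpTo suc (λ i → (count i p) !) (suc N)))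
    (trans (product-applyUpTo-last (λ i → (count (suc i) p) !) N)
      (cong (_* (count (suc N) p) !) (trans (cong product (sym (map-applyUpTo suc (λ i → (count i p) !) N))) (multiplicities-product N p))))

  multiplicities-≥ : ∀ d p → multiplicities (d + sum p) p ≡ multiplicities (sum p) p
  multiplicities-≥ zero p = refl
  multiplicities-≥ (suc d) p = trans (cong (λ c → multiplicities (d + sum p) p * c !) (count-large (suc (d + sum p)) p (s≤s (m≤n+m (sum p) d))))
    (trans (*-identityʳ _) (multiplicities-≥ d p))

  multiplicities-remove-< : ∀ N k p → N < k → multiplicities N p ≡ multiplicities N (remove k p)
  multiplicities-remove-< zero k p h = refl
  multiplicities-remove-< (suc N) k p h = cong₂ _*_ (multiplicities-remove-< N k p (<-trans (n<1+n N) h))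
    (cong _! (count-remove-≢ (suc N) k p (≡ᵇ-false (<⇒≢ h))))

  -- Only the factor of the removed part changes, from (c + 1)! to c!; d counts the factors of the
  -- range beyond it.
  multiplicities-remove : ∀ d k p → mem (suc k) p ≡ true →
    multiplicities (d + suc k) p ≡ count (suc k) p * multiplicities (d + suc k) (remove (suc k) p)
  multiplicities-remove zero k p h = begin
    multiplicities k p * (count (suc k) p) !                       ≡⟨ cong₂ (λ a b → a * b !) (multiplicities-remove-< k (suc k) p ≤-refl) (count-remove (suc k) p h) ⟩
    multiplicities k p′ * (suc c * c !)                            ≡⟨ *-assoc (multiplicities k p′) (suc c) (c !) ⟨
    multiplicities k p′ * suc c * c !                              ≡⟨ cong (_* c !) (*-comm (multiplicities k p′) (suc c)) ⟩
    suc c * multiplicities k p′ * c !                              ≡⟨ *-assoc (suc c) (multiplicities k p′) (c !) ⟩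
    suc c * (multiplicities k p′ * c !)                            ≡⟨ cong (_* (multiplicities k p′ * c !)) (count-remove (suc k) p h) ⟨
    count (suc k) p * (multiplicities k p′ * c !)                  ∎
    where
    open ≡-Reasoning
    p′ : List ℕ
    p′ = remove (suc k) p
    c : ℕ
    c = count (suc k) p′
  multiplicities-remove (suc d) k p h = trans
    (cong₂ (λ a b → a * b !) (multiplicities-remove d k p h)
      (count-remove-≢ (suc (d + suc k)) (suc k) p (≡ᵇ-false (λ e → <⇒≢ (s≤s (m≤n+m (suc k) d)) (sym e)))))
    (*-assoc (count (suc k) p) _ _)

  -- The range of the factorials in `zλ` is the sum of the parts and so shrinks as well. The factors
  -- that drop out are 0!, since no part of the remainder exceeds its sum.
  zλ-remove : ∀ k p → mem (suc k) p ≡ true → zλ p ≡ suc k * count (suc k) p * zλ (remove (suc k) p)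
  zλ-remove k p h = begin
    product p * product (map (λ i → (count i p) !) (applyUpTo suc (sum p)))
      ≡⟨ cong₂ _*_ (product-remove (suc k) p h) (multiplicities-product (sum p) p) ⟩
    suc k * product p′ * multiplicities (sum p) p
      ≡⟨ cong (suc k * product p′ *_) mults ⟩
    suc k * product p′ * (count (suc k) p * multiplicities (sum p′) p′)
      ≡⟨ swap (suc k) (product p′) (count (suc k) p) (multiplicities (sum p′) p′) ⟩
    suc k * count (suc k) p * (product p′ * multiplicities (sum p′) p′)
      ≡⟨ cong (λ m → suc k * count (suc k) p * (product p′ * m)) (multiplicities-product (sum p′) p′) ⟨
    suc k * count (suc k) p * zλ p′ ∎
    where
    open ≡-Reasoning
    p′ : List ℕ
    p′ = remove (suc k) p
    mults : multiplicities (sum p) p ≡ count (suc k) p * multiplicities (sum p′) p′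
    mults = begin
      multiplicities (sum p) p ≡⟨ cong (λ N → multiplicities N p) (trans (sum-remove (suc k) p h) (+-comm (suc k) (sum p′))) ⟩
      multiplicities (sum p′ + suc k) p ≡⟨ multiplicities-remove (sum p′) k p h ⟩
      count (suc k) p * multiplicities (sum p′ + suc k) p′ ≡⟨ cong (λ N → count (suc k) p * multiplicities N p′) (+-comm (sum p′) (suc k)) ⟩
      count (suc k) p * multiplicities (suc k + sum p′) p′ ≡⟨ cong (count (suc k) p *_) (multiplicities-≥ (suc k) p′) ⟩
      count (suc k) p * multiplicities (sum p′) p′ ∎
    swap : ∀ a b c d → a * b * (c * d) ≡ a * c * (b * d)
    swap a b c d = begin
      a * b * (c * d)   ≡⟨ *-assoc a b (c * d) ⟩
      a * (b * (c * d)) ≡⟨ cong (a *_) (*-assoc b c d) ⟨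
      a * (b * c * d)   ≡⟨ cong (λ x → a * (x * d)) (*-comm b c) ⟩
      a * (c * b * d)   ≡⟨ cong (a *_) (*-assoc c b d) ⟩
      a * (c * (b * d)) ≡⟨ *-assoc a c (b * d) ⟨
      a * c * (b * d)   ∎

  zλ-nonZero : ∀ {p} → All (1 ≤_) p → NonZero (zλ p)
  zλ-nonZero {p} hs = m*n≢0 (product p) _ {{prod hs}} {{subst NonZero (sym (multiplicities-product (sum p) p)) (mult (sum p))}}
    where
    prod : ∀ {p} → All (1 ≤_) p → NonZero (product p)
    prod [] = _
    prod {a ∷ p} (h ∷ hs) = m*n≢0 a (product p) {{ℕ.>-nonZero h}} {{prod hs}}
    mult : ∀ N → NonZero (multiplicities N p)
    mult zero = _
    mult (suc N) = m*n≢0 (multiplicities N p) ((count (suc N) p) !) {{mult N}} {{ count (suc N) p !≢0 }}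

-- Sums over partitions and the recurrence they satisfy.

module PartitionSums {c ℓ : Level} (R : CommutativeRing c ℓ) where

  open import Data.Bool.Base using (T)
  open import Data.Nat.ListAction using (sum)
  open import Data.List.Relation.Unary.All using (All; []; _∷_)
  open import Data.Unit.Base using (tt)
  open import Defs using (parts; count; zλ)
  open RingKit R
  open PowerSeries R
  open WordLemmas using (≤ᵇ-true; ≤ᵇ-false; ≡ᵇ-refl)
  open WordSums R using ([]·-+)
  open PartitionLemmas

  -- The first argument is fuel, as in parts.
  partSum : ℕ → ℕ → ℕ → (List ℕ → Carrier) → Carrier
  partSum _ zero m g = g []
  partSum zero (suc n) m g = 0#
  partSum (suc f) (suc n) zero g = 0#
  partSum (suc f) (suc n) (suc m) g = partSum (suc f) (suc n) m g + [ m ≤ᵇ n ]· (partSum f (n ∸ m) (suc m) (λ p → g (suc m ∷ p)))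

  ∑<-⊓ : ∀ m n (F : ℕ → Carrier) → ∑< (m ⊓ n) F ≈ ∑< m (λ i → [ i <ᵇ n ]· (F i))
  ∑<-⊓ zero n F = refl
  ∑<-⊓ (suc m) zero F = sym (∑<-0 (suc m) (λ _ _ → refl))
  ∑<-⊓ (suc m) (suc n) F = +-congˡ (∑<-⊓ m n (λ i → F (suc i)))

  partSum-∑< : ∀ f n m g → partSum (suc f) (suc n) m g ≈ ∑< m (λ i → [ i ≤ᵇ n ]· (partSum f (n ∸ i) (suc i) (λ p → g (suc i ∷ p))))
  partSum-∑< f n zero g = refl
  partSum-∑< f n (suc m) g = trans (+-congʳ (partSum-∑< f n m g)) (sym (∑<-last m _))

  <ᵇ-suc : ∀ i n → (i <ᵇ suc n) ≡ (i ≤ᵇ n)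
  <ᵇ-suc zero n = ≡.refl
  <ᵇ-suc (suc i) n = ≡.refl

  ∑-parts : ∀ f n m g → ∑ (parts f n m) g ≈ partSum f n m g
  ∑-parts zero zero m g = +-identityʳ _
  ∑-parts (suc f) zero m g = +-identityʳ _
  ∑-parts zero (suc n) m g = refl
  ∑-parts (suc f) (suc n) m g = begin
    ∑ (concatMap (λ k → map (k ∷_) (parts f (suc n ∸ k) k)) (applyUpTo suc (m ⊓ suc n))) g
      ≈⟨ ∑-concatMap (λ k → map (k ∷_) (parts f (suc n ∸ k) k)) (applyUpTo suc (m ⊓ suc n)) g ⟩
    ∑ (applyUpTo suc (m ⊓ suc n)) (λ k → ∑ (map (k ∷_) (parts f (suc n ∸ k) k)) g)
      ≈⟨ ∑-applyUpTo suc (m ⊓ suc n) (λ k → ∑ (map (k ∷_) (parts f (suc n ∸ k) k)) g) ⟩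
    ∑< (m ⊓ suc n) (λ i → ∑ (map (suc i ∷_) (parts f (n ∸ i) (suc i))) g)
      ≈⟨ ∑<-cong′ (m ⊓ suc n) (λ i → trans (∑-map (suc i ∷_) (parts f (n ∸ i) (suc i)) g) (∑-parts f (n ∸ i) (suc i) (λ p → g (suc i ∷ p)))) ⟩
    ∑< (m ⊓ suc n) (λ i → partSum f (n ∸ i) (suc i) (λ p → g (suc i ∷ p)))
      ≈⟨ ∑<-⊓ m (suc n) (λ i → partSum f (n ∸ i) (suc i) (λ p → g (suc i ∷ p))) ⟩
    ∑< m (λ i → [ i <ᵇ suc n ]· (partSum f (n ∸ i) (suc i) (λ p → g (suc i ∷ p))))
      ≈⟨ ∑<-cong′ m (λ i → reflexive (cong (λ b → [ b ]· (partSum f (n ∸ i) (suc i) (λ p → g (suc i ∷ p)))) (<ᵇ-suc i n))) ⟩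
    ∑< m (λ i → [ i ≤ᵇ n ]· (partSum f (n ∸ i) (suc i) (λ p → g (suc i ∷ p))))
      ≈⟨ partSum-∑< f n m g ⟨
    partSum (suc f) (suc n) m g ∎

  partSum-fuel : ∀ f f′ n m g → n ℕ.≤ f → n ℕ.≤ f′ → partSum f n m g ≈ partSum f′ n m g
  partSum-fuel f f′ zero m g _ _ = refl
  partSum-fuel (suc f) (suc f′) (suc n) zero g _ _ = refl
  partSum-fuel (suc f) (suc f′) (suc n) (suc m) g (s≤s h) (s≤s h′) = +-cong
    (partSum-fuel (suc f) (suc f′) (suc n) m g (s≤s h) (s≤s h′))
    ([]·-cong (m ≤ᵇ n) (partSum-fuel f f′ (n ∸ m) (suc m) _ (ℕₚ.≤-trans (ℕₚ.m∸n≤m n m) h) (ℕₚ.≤-trans (ℕₚ.m∸n≤m n m) h′)))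

  Σλ : ℕ → ℕ → (List ℕ → Carrier) → Carrier
  Σλ n m g = partSum n n m g

  ≤ᵇ-suc : ∀ m n → (suc m ≤ᵇ suc n) ≡ (m ≤ᵇ n)
  ≤ᵇ-suc = <ᵇ-suc

  Σλ-suc : ∀ n m g → Σλ n (suc m) g ≈ Σλ n m g + [ suc m ≤ᵇ n ]· (Σλ (n ∸ suc m) (suc m) (λ p → g (suc m ∷ p)))
  Σλ-suc zero m g = sym (+-identityʳ _)
  Σλ-suc (suc n) m g = +-congˡ (trans
    ([]·-cong (m ≤ᵇ n) (partSum-fuel n (n ∸ m) (n ∸ m) (suc m) _ (ℕₚ.m∸n≤m n m) ℕₚ.≤-refl))
    (reflexive (cong (λ b → [ b ]· (Σλ (n ∸ m) (suc m) (λ p → g (suc m ∷ p)))) (≡.sym (≤ᵇ-suc m n)))))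

  T-≤ : ∀ m n → (m ≤ᵇ n) ≡ true → m ℕ.≤ n
  T-≤ m n h = ℕₚ.≤ᵇ⇒≤ m n (≡.subst T (≡.sym h) tt)

  []·-cong′ : ∀ b {x y} → (b ≡ true → x ≈ y) → [ b ]· x ≈ [ b ]· y
  []·-cong′ true e = e ≡.refl
  []·-cong′ false e = refl

  partSum-cong : ∀ f n m {g g′} → (∀ p → sum p ≡ n → All (1 ℕ.≤_) p → g p ≈ g′ p) → partSum f n m g ≈ partSum f n m g′
  partSum-cong f zero m e = e [] ≡.refl []
  partSum-cong zero (suc n) m e = refl
  partSum-cong (suc f) (suc n) zero e = refl
  partSum-cong (suc f) (suc n) (suc m) e = +-cong (partSum-cong (suc f) (suc n) m e)
    ([]·-cong′ (m ≤ᵇ n) (λ m≤n → partSum-cong f (n ∸ m) (suc m)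
      (λ p eq hs → e (suc m ∷ p) (≡.trans (cong (suc m ℕ.+_) eq) (cong suc (ℕₚ.m+[n∸m]≡n (T-≤ m n m≤n)))) (s≤s z≤n ∷ hs))))

  partSum-0 : ∀ f n m {g} → (∀ p → g p ≈ 0#) → partSum f n m g ≈ 0#
  partSum-0 f zero m e = e []
  partSum-0 zero (suc n) m e = refl
  partSum-0 (suc f) (suc n) zero e = refl
  partSum-0 (suc f) (suc n) (suc m) e = trans (+-cong (partSum-0 (suc f) (suc n) m e)
    (trans ([]·-cong (m ≤ᵇ n) (partSum-0 f (n ∸ m) (suc m) (λ p → e (suc m ∷ p)))) ([]·-0 (m ≤ᵇ n)))) (+-identityˡ 0#)

  partSum-+ : ∀ f n m g h → partSum f n m (λ p → g p + h p) ≈ partSum f n m g + partSum f n m h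
  partSum-+ f zero m g h = refl
  partSum-+ zero (suc n) m g h = sym (+-identityˡ 0#)
  partSum-+ (suc f) (suc n) zero g h = sym (+-identityˡ 0#)
  partSum-+ (suc f) (suc n) (suc m) g h = trans
    (+-cong (partSum-+ (suc f) (suc n) m g h)
      (trans ([]·-cong (m ≤ᵇ n) (partSum-+ f (n ∸ m) (suc m) _ _)) ([]·-+ (m ≤ᵇ n) _ _)))
    (solve 4 (λ p q r s → (p :+ q) :+ (r :+ s) := (p :+ r) :+ (q :+ s)) refl _ _ _ _)

  partSum-*ˡ : ∀ f n m k g → partSum f n m (λ p → k * g p) ≈ k * partSum f n m g
  partSum-*ˡ f zero m k g = refl
  partSum-*ˡ zero (suc n) m k g = sym (zeroʳ k)
  partSum-*ˡ (suc f) (suc n) zero k g = sym (zeroʳ k)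
  partSum-*ˡ (suc f) (suc n) (suc m) k g = trans
    (+-cong (partSum-*ˡ (suc f) (suc n) m k g)
      (trans ([]·-cong (m ≤ᵇ n) (partSum-*ˡ f (n ∸ m) (suc m) k _)) ([]·-*ˡ (m ≤ᵇ n) k _)))
    (sym (distribˡ k _ _))

  partSum-× : ∀ f n m k g → partSum f n m (λ p → k × g p) ≈ k × partSum f n m g
  partSum-× f n m zero g = partSum-0 f n m (λ _ → refl)
  partSum-× f n m (suc k) g = trans (partSum-+ f n m g (λ p → k × g p)) (+-congˡ (partSum-× f n m k g))

  partSum-∑<-swap : ∀ f n m N (F : ℕ → List ℕ → Carrier) → partSum f n m (λ p → ∑< N (λ i → F i p)) ≈ ∑< N (λ i → partSum f n m (F i))
  partSum-∑<-swap f n m zero F = partSum-0 f n m (λ _ → refl)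
  partSum-∑<-swap f n m (suc N) F = trans (partSum-+ f n m (F 0) _) (+-congˡ (partSum-∑<-swap f n m N (λ i → F (suc i))))

  Σλ-large : ∀ n d g → Σλ n (d ℕ.+ n) g ≈ Σλ n n g
  Σλ-large n zero g = refl
  Σλ-large n (suc d) g = trans (Σλ-suc n (d ℕ.+ n) g) (trans (+-cong (Σλ-large n d g)
    (reflexive (cong (λ b → [ b ]· (Σλ (n ∸ suc (d ℕ.+ n)) (suc (d ℕ.+ n)) (λ p → g (suc (d ℕ.+ n) ∷ p)))) (≤ᵇ-false (s≤s (ℕₚ.m≤n+m n d))))))
    (+-identityʳ _))

  partSum-absent : ∀ f n m k (g : List ℕ → Carrier) → m ℕ.< k → partSum f n m (λ p → [ mem k p ]· (g p)) ≈ 0#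
  partSum-absent f zero m k g h = refl
  partSum-absent zero (suc n) m k g h = refl
  partSum-absent (suc f) (suc n) zero k g h = refl
  partSum-absent (suc f) (suc n) (suc m) k g h = trans (+-cong (partSum-absent (suc f) (suc n) m k g (ℕₚ.<-trans (ℕₚ.n<1+n m) h))
    (trans ([]·-cong (m ≤ᵇ n) (trans (partSum-cong f (n ∸ m) (suc m) (λ p _ _ → reflexive (cong (λ b → [ if b then true else mem k p ]· (g (suc m ∷ p)))
      (≡ᵇ-false {k} {suc m} (λ e → ℕₚ.<⇒≢ h (≡.sym e)))))) (partSum-absent f (n ∸ m) (suc m) k (λ p → g (suc m ∷ p)) h))) ([]·-0 (m ≤ᵇ n))))
    (+-identityˡ 0#)

  ∸-∸-comm : ∀ n a b → n ∸ a ∸ b ≡ n ∸ b ∸ a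
  ∸-∸-comm n a b = ≡.trans (ℕₚ.∸-+-assoc n a b) (≡.trans (cong (n ∸_) (ℕₚ.+-comm a b)) (≡.sym (ℕₚ.∸-+-assoc n b a)))

  ≤ᵇ-∸ : ∀ n a b → ((a ≤ᵇ n) ∧ (b ≤ᵇ n ∸ a)) ≡ (a ℕ.+ b ≤ᵇ n)
  ≤ᵇ-∸ n zero b = ≡.refl
  ≤ᵇ-∸ zero (suc a) b = ≡.refl
  ≤ᵇ-∸ (suc n) (suc a) b = ≡.trans (cong (_∧ (b ≤ᵇ n ∸ a)) (≤ᵇ-suc a n)) (≡.trans (≤ᵇ-∸ n a b) (≡.sym (≤ᵇ-suc (a ℕ.+ b) n)))

  -- Removing one copy of a part is a bijection from the partitions containing it onto all
  -- partitions of the smaller number. The induction splits off a largest part on both sides until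
  -- the bound reaches the removed part; N bounds n to make it terminate.
  Σλ-remove : ∀ N n d k g → n ℕ.≤ N →
    Σλ n (d ℕ.+ suc k) (λ p → [ mem (suc k) p ]· (g (remove (suc k) p))) ≈ [ suc k ≤ᵇ n ]· (Σλ (n ∸ suc k) (d ℕ.+ suc k) g)
  Σλ-remove N n zero k g n≤N = begin
    Σλ n (suc k) G ≈⟨ Σλ-suc n k G ⟩
    Σλ n k G + [ suc k ≤ᵇ n ]· (Σλ (n ∸ suc k) (suc k) (λ p → G (suc k ∷ p)))
      ≈⟨ +-cong (partSum-absent n n k (suc k) (λ p → g (remove (suc k) p)) ℕₚ.≤-refl)
                ([]·-cong (suc k ≤ᵇ n) (partSum-cong (n ∸ suc k) (n ∸ suc k) (suc k) (λ p _ _ → reflexive (head p)))) ⟩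
    0# + [ suc k ≤ᵇ n ]· (Σλ (n ∸ suc k) (suc k) g) ≈⟨ +-identityˡ _ ⟩
    [ suc k ≤ᵇ n ]· (Σλ (n ∸ suc k) (suc k) g) ∎
    where
    G : List ℕ → Carrier
    G p = [ mem (suc k) p ]· (g (remove (suc k) p))
    head : ∀ p → G (suc k ∷ p) ≡ g p
    head p rewrite ≡ᵇ-refl k = ≡.refl
  Σλ-remove zero zero (suc d) k g z≤n = refl
  Σλ-remove (suc N) zero (suc d) k g z≤n = refl
  Σλ-remove (suc N) n@(suc _) (suc d) k g n≤N = begin
    Σλ n (suc m) G ≈⟨ Σλ-suc n m G ⟩
    Σλ n m G + [ suc m ≤ᵇ n ]· (Σλ (n ∸ suc m) (suc m) (λ p → G (suc m ∷ p)))
      ≈⟨ +-cong (Σλ-remove (suc N) n d k g n≤N)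
           ([]·-cong (suc m ≤ᵇ n) (trans (partSum-cong (n ∸ suc m) (n ∸ suc m) (suc m) (λ p _ _ → reflexive (tail p)))
             (Σλ-remove N (n ∸ suc m) (suc d) k (λ p → g (suc m ∷ p)) smaller))) ⟩
    [ suc k ≤ᵇ n ]· (Σλ (n ∸ suc k) m g) + [ suc m ≤ᵇ n ]· ([ suc k ≤ᵇ n ∸ suc m ]· (Σλ (n ∸ suc m ∸ suc k) (suc m) (λ p → g (suc m ∷ p))))
      ≈⟨ +-congˡ (trans (sym ([]·-∧ (suc m ≤ᵇ n) (suc k ≤ᵇ n ∸ suc m) _))
           (trans (reflexive (cong₂ (λ b j → [ b ]· (Σλ j (suc m) (λ p → g (suc m ∷ p)))) flags (∸-∸-comm n (suc m) (suc k))))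
             ([]·-∧ (suc k ≤ᵇ n) (suc m ≤ᵇ n ∸ suc k) _))) ⟩
    [ suc k ≤ᵇ n ]· (Σλ (n ∸ suc k) m g) + [ suc k ≤ᵇ n ]· ([ suc m ≤ᵇ n ∸ suc k ]· (Σλ (n ∸ suc k ∸ suc m) (suc m) (λ p → g (suc m ∷ p))))
      ≈⟨ []·-+ (suc k ≤ᵇ n) _ _ ⟨
    [ suc k ≤ᵇ n ]· (Σλ (n ∸ suc k) m g + [ suc m ≤ᵇ n ∸ suc k ]· (Σλ (n ∸ suc k ∸ suc m) (suc m) (λ p → g (suc m ∷ p))))
      ≈⟨ []·-cong (suc k ≤ᵇ n) (Σλ-suc (n ∸ suc k) m g) ⟨
    [ suc k ≤ᵇ n ]· (Σλ (n ∸ suc k) (suc m) g) ∎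
    where
    m : ℕ
    m = d ℕ.+ suc k
    G : List ℕ → Carrier
    G p = [ mem (suc k) p ]· (g (remove (suc k) p))
    tail : ∀ p → G (suc m ∷ p) ≡ [ mem (suc k) p ]· (g (suc m ∷ remove (suc k) p))
    tail p rewrite ≡ᵇ-false {suc k} {suc m} (ℕₚ.<⇒≢ (s≤s (ℕₚ.m≤n+m (suc k) d))) = ≡.refl
    smaller : n ∸ suc m ℕ.≤ N
    smaller = ℕₚ.≤-trans (ℕₚ.∸-monoʳ-≤ n (s≤s (z≤n {m}))) (ℕ.s≤s⁻¹ n≤N)
    flags : ((suc m ≤ᵇ n) ∧ (suc k ≤ᵇ n ∸ suc m)) ≡ ((suc k ≤ᵇ n) ∧ (suc m ≤ᵇ n ∸ suc k))
    flags = ≡.trans (≤ᵇ-∸ n (suc m) (suc k)) (≡.trans (cong (_≤ᵇ n) (ℕₚ.+-comm (suc m) (suc k))) (≡.sym (≤ᵇ-∸ n (suc k) (suc m))))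

  ∑<-single : ∀ N a (F : ℕ → Carrier) → a ℕ.< N → ∑< N (λ i → [ i ≡ᵇ a ]· (F i)) ≈ F a
  ∑<-single (suc N) zero F h = trans (+-congˡ (∑<-0 N (λ _ _ → refl))) (+-identityʳ _)
  ∑<-single (suc N) (suc a) F (s≤s h) = trans (+-identityˡ _) (∑<-single N a (λ i → F (suc i)) h)

  sum-count : ∀ N p x → sum p ℕ.≤ N → All (1 ℕ.≤_) p → sum p × x ≈ ∑< N (λ i → (suc i ℕ.* count (suc i) p) × x)
  sum-count N [] x _ _ = sym (∑<-0 N (λ i _ → reflexive (cong (_× x) (ℕₚ.*-zeroʳ (suc i)))))
  sum-count N (suc a ∷ p) x h (_ ∷ hs) = begin
    (suc a ℕ.+ sum p) × x                                  ≈⟨ ×-homo-+ x (suc a) (sum p) ⟩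
    suc a × x + sum p × x
      ≈⟨ +-cong (sym (∑<-single N a (λ i → suc i × x) (ℕₚ.≤-trans (ℕₚ.m≤m+n (suc a) (sum p)) h)))
                (sum-count N p x (ℕₚ.≤-trans (ℕₚ.m≤n+m (sum p) (suc a)) h) hs) ⟩
    ∑< N (λ i → [ i ≡ᵇ a ]· (suc i × x)) + ∑< N (λ i → (suc i ℕ.* count (suc i) p) × x)
      ≈⟨ ∑<-+ N (λ i → [ i ≡ᵇ a ]· (suc i × x)) (λ i → (suc i ℕ.* count (suc i) p) × x) ⟨
    ∑< N (λ i → [ i ≡ᵇ a ]· (suc i × x) + (suc i ℕ.* count (suc i) p) × x)
      ≈⟨ ∑<-cong′ N (λ i → trans (add (i ≡ᵇ a) i) (reflexive (cong (λ n → (suc i ℕ.* n) × x) (≡.sym (count-∷ (suc i) (suc a) p))))) ⟩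
    ∑< N (λ i → (suc i ℕ.* count (suc i) (suc a ∷ p)) × x) ∎
    where
    add : ∀ b i → [ b ]· (suc i × x) + (suc i ℕ.* count (suc i) p) × x ≈ (suc i ℕ.* (if b then suc (count (suc i) p) else count (suc i) p)) × x
    add true i = trans (sym (×-homo-+ x (suc i) _)) (reflexive (cong (_× x) (≡.sym (ℕₚ.*-suc (suc i) (count (suc i) p)))))
    add false i = +-identityˡ _

  qProduct : (ℕ → Carrier) → List ℕ → Carrier
  qProduct q [] = 1#
  qProduct q (k ∷ p) = q k * qProduct q p

  qProduct-remove : ∀ q k p → mem k p ≡ true → qProduct q p ≈ q k * qProduct q (remove k p)
  qProduct-remove q k (a ∷ p) h with k ≡ᵇ a in e
  ... | true = *-congʳ (reflexive (cong q (≡.sym (≡ᵇ-true k a e))))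
  ... | false = trans (*-congˡ (qProduct-remove q k p h)) (solve 3 (λ a b c → a :* (b :* c) := b :* (a :* c)) refl _ _ _)

  qProduct-scale : ∀ q m p → qProduct (λ k → m × q k) p ≈ (m × 1#) ^ length p * qProduct q p
  qProduct-scale q m [] = sym (*-identityˡ 1#)
  qProduct-scale q m (k ∷ p) = trans (*-cong (trans (×-congʳ m (sym (*-identityˡ (q k)))) (sym (×-assoc-* m 1# (q k)))) (qProduct-scale q m p))
    (solve 4 (λ a b c d → a :* b :* (c :* d) := a :* c :* (b :* d)) refl _ _ _ _)

  module _ (torsionFree : ∀ n {x y} → .{{NonZero n}} → n × x ≈ n × y → x ≈ y) where

    module _ (q : ℕ → Carrier) (w : List ℕ → Carrier) (w-z : ∀ {p} → All (1 ℕ.≤_) p → zλ p × w p ≈ qProduct q p) where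

      w-remove : ∀ k p → All (1 ℕ.≤_) p → (suc k ℕ.* count (suc k) p) × w p ≈ [ mem (suc k) p ]· (q (suc k) * w (remove (suc k) p))
      w-remove k p hs with mem (suc k) p in e
      ... | false = reflexive (cong (_× w p) (≡.trans (cong (suc k ℕ.*_) (count-∉ (suc k) p e)) (ℕₚ.*-zeroʳ (suc k))))
      -- Both sides are multiplied by z of the remainder: `zλ-remove` then completes the left one to
      -- `zλ p × w p`.
      ... | true = torsionFree (zλ p′) {{zλ-nonZero (remove-positive (suc k) hs)}} (begin
        zλ p′ × ((suc k ℕ.* count (suc k) p) × w p)   ≈⟨ ×-assocˡ (w p) (zλ p′) _ ⟩
        (zλ p′ ℕ.* (suc k ℕ.* count (suc k) p)) × w p ≡⟨ cong (_× w p) (≡.trans (ℕₚ.*-comm (zλ p′) _) (≡.sym (zλ-remove k p e))) ⟩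
        zλ p × w p                                    ≈⟨ w-z hs ⟩
        qProduct q p                                  ≈⟨ qProduct-remove q (suc k) p e ⟩
        q (suc k) * qProduct q p′                     ≈⟨ *-congˡ (w-z (remove-positive (suc k) hs)) ⟨
        q (suc k) * (zλ p′ × w p′)                    ≈⟨ ×-comm-* (zλ p′) (q (suc k)) (w p′) ⟩
        zλ p′ × (q (suc k) * w p′)                    ∎)
        where
        p′ : List ℕ
        p′ = remove (suc k) p

      -- Newton's identity between the power sums q and the complete symmetric functions. It arises
      -- by writing n as the sum over k of k times the multiplicity of k in each partition.
      partition-recurrence : ∀ n → n × Σλ n n w ≈ ∑< n (λ k → q (suc k) * Σλ (n ∸ suc k) (n ∸ suc k) w)
      partition-recurrence n = begin
        n × Σλ n n w                                    ≈⟨ partSum-× n n n n w ⟨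
        Σλ n n (λ p → n × w p)                          ≈⟨ partSum-cong n n n (λ p eq hs → trans (reflexive (cong (_× w p) (≡.sym eq))) (trans (sum-count n p (w p) (ℕₚ.≤-reflexive eq) hs) (∑<-cong′ n (λ k → w-remove k p hs)))) ⟩
        Σλ n n (λ p → ∑< n (λ k → [ mem (suc k) p ]· (q (suc k) * w (remove (suc k) p))))
          ≈⟨ partSum-∑<-swap n n n n (λ k p → [ mem (suc k) p ]· (q (suc k) * w (remove (suc k) p))) ⟩
        ∑< n (λ k → Σλ n n (λ p → [ mem (suc k) p ]· (q (suc k) * w (remove (suc k) p))))
          ≈⟨ ∑<-cong n term ⟩
        ∑< n (λ k → q (suc k) * Σλ (n ∸ suc k) (n ∸ suc k) w) ∎
        where
        term : ∀ k → k ℕ.< n → Σλ n n (λ p → [ mem (suc k) p ]· (q (suc k) * w (remove (suc k) p))) ≈ q (suc k) * Σλ (n ∸ suc k) (n ∸ suc k) w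
        term k k<n = begin
          Σλ n n (λ p → [ mem (suc k) p ]· (q (suc k) * w (remove (suc k) p)))
            ≈⟨ partSum-cong n n n (λ p _ _ → []·-*ˡ (mem (suc k) p) (q (suc k)) _) ⟩
          Σλ n n (λ p → q (suc k) * [ mem (suc k) p ]· (w (remove (suc k) p)))
            ≈⟨ partSum-*ˡ n n n (q (suc k)) _ ⟩
          q (suc k) * Σλ n n (λ p → [ mem (suc k) p ]· (w (remove (suc k) p)))
            ≡⟨ cong (λ m → q (suc k) * Σλ n m (λ p → [ mem (suc k) p ]· (w (remove (suc k) p)))) (ℕₚ.m∸n+n≡m k<n) ⟨
          q (suc k) * Σλ n (n ∸ suc k ℕ.+ suc k) (λ p → [ mem (suc k) p ]· (w (remove (suc k) p)))
            ≈⟨ *-congˡ (Σλ-remove n n (n ∸ suc k) k w ℕₚ.≤-refl) ⟩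
          q (suc k) * [ suc k ≤ᵇ n ]· (Σλ (n ∸ suc k) (n ∸ suc k ℕ.+ suc k) w)
            ≡⟨ cong₂ (λ b m → q (suc k) * [ b ]· (Σλ (n ∸ suc k) m w)) (≤ᵇ-true k<n) (ℕₚ.+-comm (n ∸ suc k) (suc k)) ⟩
          q (suc k) * Σλ (n ∸ suc k) (suc k ℕ.+ (n ∸ suc k)) w
            ≈⟨ *-congˡ (Σλ-large (n ∸ suc k) (suc k) w) ⟩
          q (suc k) * Σλ (n ∸ suc k) (n ∸ suc k) w ∎

-- Logarithmic derivatives and the expansion of powers of F over partitions.

module LogarithmicDerivative {c ℓ : Level} (R : CommutativeRing c ℓ) where

  open import Data.List.Relation.Unary.All using (All)
  open import Defs using (zλ)
  open RingKit R
  open PowerSeries R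
  open WordSeries R
  open PartitionSums R

  -- The derivation x d/dx.
  D : (ℕ → Carrier) → ℕ → Carrier
  D f n = n × f n

  D-⋆ : ∀ f g n → D (f ⋆ g) n ≈ (D f ⋆ g) n + (f ⋆ D g) n
  D-⋆ f g zero = sym (trans (+-cong (zeroˡ _) (zeroʳ _)) (+-identityˡ 0#))
  D-⋆ f g (suc n) = begin
    suc n × (f 0 * g (suc n) + (f′ ⋆ g) n)
      ≈⟨ ×-distrib-+ _ _ (suc n) ⟩
    suc n × (f 0 * g (suc n)) + ((f′ ⋆ g) n + D (f′ ⋆ g) n)
      ≈⟨ +-cong (sym (×-comm-* (suc n) (f 0) (g (suc n)))) (+-congˡ (D-⋆ f′ g n)) ⟩
    f 0 * D g (suc n) + ((f′ ⋆ g) n + ((D f′ ⋆ g) n + (f′ ⋆ D g) n))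
      ≈⟨ solve 5 (λ a b c d g → a :+ (b :+ (c :+ d)) := (con (pos 0) :* g :+ (b :+ c)) :+ (a :+ d)) refl _ _ _ _ (g (suc n)) ⟩
    (0# * g (suc n) + ((f′ ⋆ g) n + (D f′ ⋆ g) n)) + (f 0 * D g (suc n) + (f′ ⋆ D g) n)
      ≈⟨ +-congʳ (+-congˡ (⋆-distribʳ f′ (D f′) g n)) ⟨
    (D f ⋆ g) (suc n) + (f ⋆ D g) (suc n) ∎
    where
    f′ : ℕ → Carrier
    f′ i = f (suc i)

  LogDerivative : (ℕ → Carrier) → (ℕ → Carrier) → Set ℓ
  LogDerivative l f = D f P.≈ l ⋆ f

  LogD-⋆ : ∀ {l f l′ f′} → LogDerivative l f → LogDerivative l′ f′ → LogDerivative (l P.+ l′) (f ⋆ f′)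
  LogD-⋆ {l} {f} {l′} {f′} e e′ = P.trans (D-⋆ f f′) (P.trans (P.+-cong (P.*-congʳ e) (P.*-congˡ {f} e′))
    (P.solve 4 (λ l f l′ f′ → (l P.:* f) P.:* f′ P.:+ f P.:* (l′ P.:* f′) P.:= (l P.:+ l′) P.:* (f P.:* f′)) P.refl l f l′ f′))

  LogD-^ : ∀ {l f} m → LogDerivative l f → LogDerivative (m P.× l) (f P.^ m)
  LogD-^ zero e zero = sym (zeroˡ _)
  LogD-^ zero e (suc n) = trans (×-zeroʳ (suc n)) (sym (P.zeroˡ one (suc n)))
  LogD-^ {l} {f} (suc m) e = LogD-⋆ {l} {f} e (LogD-^ m e)

  -- The series pX/(1 - pX) and qX/(1 + qX).
  logGeo logLin : Carrier → ℕ → Carrier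
  logGeo p zero = 0#
  logGeo p (suc n) = p ^ suc n
  logLin q zero = 0#
  logLin q (suc n) = - (- q) ^ suc n

  LogD-geo : ∀ p → LogDerivative (logGeo p) (geo p)
  LogD-geo p n = trans (lem n) (⋆-comm (geo p) (logGeo p) n)
    where
    lem : ∀ n → n × p ^ n ≈ (geo p ⋆ logGeo p) n
    lem zero = sym (zeroʳ _)
    lem (suc n) = begin
      p ^ suc n + n × (p * p ^ n)                             ≈⟨ +-cong (sym (*-identityˡ _)) (sym (×-comm-* n p (p ^ n))) ⟩
      1# * logGeo p (suc n) + p * (n × p ^ n)                 ≈⟨ +-congˡ (*-congˡ (lem n)) ⟩
      1# * logGeo p (suc n) + p * (geo p ⋆ logGeo p) n        ≈⟨ +-congˡ (⋆-scaleˡ p (geo p) (logGeo p) n) ⟨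
      (geo p ⋆ logGeo p) (suc n)                              ∎

  LogD-lin : ∀ q → LogDerivative (logLin q) (lin q)
  LogD-lin q n = trans (lem n) (⋆-comm (lin q) (logLin q) n)
    where
    lem : ∀ n → D (lin q) n ≈ (lin q ⋆ logLin q) n
    lem zero = sym (zeroʳ _)
    lem (suc zero) = solve 1 (λ q → q :+ con (pos 0) := con (pos 1) :* (:- ((:- q) :* con (pos 1))) :+ q :* con (pos 0)) refl q
    lem (suc (suc n)) = trans (×-zeroʳ (suc (suc n))) (sym (trans (lin-⋆ q (logLin q) (suc n))
      (solve 2 (λ q a → :- ((:- q) :* a) :+ q :* (:- a) := con (pos 0)) refl q ((- q) ^ suc n))))

  ⋆-cong≤ : ∀ {f f′} g n → (∀ i → i ℕ.≤ n → f i ≈ f′ i) → (f ⋆ g) n ≈ (f′ ⋆ g) n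
  ⋆-cong≤ g zero e = *-congʳ (e 0 z≤n)
  ⋆-cong≤ g (suc n) e = +-cong (*-congʳ (e 0 z≤n)) (⋆-cong≤ g n (λ i h → e (suc i) (s≤s h)))

  module _ (torsionFree : ∀ n {x y} → .{{NonZero n}} → n × x ≈ n × y → x ≈ y) where

    -- As l has no constant term, the n-th coefficient of `D f` involves only earlier coefficients
    -- of f, and the factor n can be cancelled.
    LogD-unique : ∀ {l f g} → l 0 ≈ 0# → LogDerivative l f → LogDerivative l g → f 0 ≈ g 0 → ∀ n → f n ≈ g n
    LogD-unique {l} {f} {g} l0 ef eg e0 n = below n n ℕₚ.≤-refl
      where
      below : ∀ N n → n ℕ.≤ N → f n ≈ g n
      below N zero _ = e0
      below (suc N) (suc n) (s≤s h) = torsionFree (suc n) (begin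
        suc n × f (suc n)                                      ≈⟨ ef (suc n) ⟩
        l 0 * f (suc n) + (l′ ⋆ f) n                           ≈⟨ +-cong (trans (*-congʳ l0) (zeroˡ _)) (⋆-comm l′ f n) ⟩
        0# + (f ⋆ l′) n                                        ≈⟨ +-congˡ (⋆-cong≤ l′ n (λ i i≤n → below N i (ℕₚ.≤-trans i≤n h))) ⟩
        0# + (g ⋆ l′) n                                        ≈⟨ +-cong (trans (*-congʳ l0) (zeroˡ _)) (⋆-comm l′ g n) ⟨
        l 0 * g (suc n) + (l′ ⋆ g) n                           ≈⟨ eg (suc n) ⟨
        suc n × g (suc n)                                      ∎)
        where
        l′ : ℕ → Carrier
        l′ i = l (suc i)

    power-partitions : ∀ y z m (w : List ℕ → Carrier) →
      (∀ {p} → All (1 ℕ.≤_) p → zλ p × w p ≈ qProduct (λ k → m × ((1# - (- y) ^ k) * (1# - (- z) ^ k))) p) →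
      ∀ n → (((lin y ⋆ geo (y * z)) ⋆ (lin z ⋆ geo 1#)) P.^ m) n ≈ Σλ n n w
    power-partitions y z m w w-z = LogD-unique {q} q0 F-log c-log e0
      where
      q : ℕ → Carrier
      q k = m × ((1# - (- y) ^ k) * (1# - (- z) ^ k))
      q0 : q 0 ≈ 0#
      q0 = trans (×-congʳ m (solve 0 ((con (pos 1) :- con (pos 1)) :* (con (pos 1) :- con (pos 1)) := con (pos 0)) refl)) (×-zeroʳ m)
      F : ℕ → Carrier
      F = (lin y ⋆ geo (y * z)) ⋆ (lin z ⋆ geo 1#)
      l : ℕ → Carrier
      l = (logLin y P.+ logGeo (y * z)) P.+ (logLin z P.+ logGeo 1#)
      l≈ : ∀ k → l k ≈ (1# - (- y) ^ k) * (1# - (- z) ^ k)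
      l≈ zero = solve 0 ((con (pos 0) :+ con (pos 0)) :+ (con (pos 0) :+ con (pos 0)) := (con (pos 1) :- con (pos 1)) :* (con (pos 1) :- con (pos 1))) refl
      l≈ (suc n) = begin
        -- The four factors of F contribute -Y, YZ, -Z and 1, which is (1 - Y)(1 - Z) multiplied
        -- out.
        (- Y + (y * z) ^ k) + (- Z + 1# ^ k)
          ≈⟨ +-cong (+-congˡ (trans (^-congˡ k (solve 2 (λ y z → y :* z := (:- y) :* (:- z)) refl y z)) (^-distrib-* (- y) (- z) k))) (+-congˡ (1^ k)) ⟩
        (- Y + Y * Z) + (- Z + 1#)
          ≈⟨ solve 2 (λ Y Z → (:- Y :+ Y :* Z) :+ (:- Z :+ con (pos 1)) := (con (pos 1) :- Y) :* (con (pos 1) :- Z)) refl Y Z ⟩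
        (1# - Y) * (1# - Z) ∎
        where
        k : ℕ
        k = suc n
        Y Z : Carrier
        Y = (- y) ^ k
        Z = (- z) ^ k
      ×-pointwise : ∀ m (f : ℕ → Carrier) k → (m P.× f) k ≈ m × f k
      ×-pointwise zero f k = refl
      ×-pointwise (suc m) f k = +-congˡ (×-pointwise m f k)
      F-log : LogDerivative q (F P.^ m)
      F-log = P.trans (LogD-^ {l} {F} m (LogD-⋆ {logLin y P.+ logGeo (y * z)} {lin y ⋆ geo (y * z)} (LogD-⋆ {logLin y} {lin y} (LogD-lin y) (LogD-geo (y * z))) (LogD-⋆ {logLin z} {lin z} (LogD-lin z) (LogD-geo 1#))))
        (P.*-congʳ (λ k → trans (×-pointwise m l k) (×-congʳ m (l≈ k))))
      c-log : LogDerivative q (λ n → Σλ n n w)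
      c-log n = trans (partition-recurrence torsionFree q w w-z n) (sym (trans (⋆-∑< q (λ n → Σλ n n w) n)
        (trans (+-congʳ (trans (*-congʳ q0) (zeroˡ _))) (+-identityˡ _))))
      F0 : ∀ m → (F P.^ m) 0 ≈ 1#
      F0 zero = refl
      F0 (suc m) = trans (*-congˡ (F0 m)) (solve 0 ((con (pos 1) :* con (pos 1)) :* (con (pos 1) :* con (pos 1)) :* con (pos 1) := con (pos 1)) refl)
      e0 : (F P.^ m) 0 ≈ w List.[]
      e0 = trans (F0 m) (sym (trans (sym (+-identityʳ _)) (w-z All.[])))

    -- The factor (ij)^l is separated into a power of i and a power of j, so that each of the two
    -- summations becomes an instance of Carlitz's identity.
    power-partitions-ij : ∀ y z i j (w₀ : List ℕ → Carrier) →
      (∀ {p} → All (1 ℕ.≤_) p → zλ p × w₀ p ≈ qProduct (λ k → (1# - (- y) ^ k) * (1# - (- z) ^ k)) p) →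
      ∀ n → (((lin y ⋆ geo (y * z)) ⋆ (lin z ⋆ geo 1#)) P.^ (i ℕ.* j)) n ≈ Σλ n n (λ p → (i × 1#) ^ length p * ((j × 1#) ^ length p * w₀ p))
    power-partitions-ij y z i j w₀ w₀-z = power-partitions y z (i ℕ.* j) _ w-z
      where
      q : ℕ → Carrier
      q k = (1# - (- y) ^ k) * (1# - (- z) ^ k)
      w-z : ∀ {p} → All (1 ℕ.≤_) p → zλ p × ((i × 1#) ^ length p * ((j × 1#) ^ length p * w₀ p)) ≈ qProduct (λ k → (i ℕ.* j) × q k) p
      w-z {p} hs = begin
        zλ p × (a * (b * w₀ p))                       ≈⟨ trans (*-congˡ (×-comm-* (zλ p) b (w₀ p))) (×-comm-* (zλ p) a (b * w₀ p)) ⟨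
        a * (b * (zλ p × w₀ p))                       ≈⟨ *-congˡ (*-congˡ (w₀-z hs)) ⟩
        a * (b * qProduct q p)                        ≈⟨ *-assoc a b _ ⟨
        a * b * qProduct q p                          ≈⟨ *-congʳ (^-distrib-* (i × 1#) (j × 1#) (length p)) ⟨
        ((i × 1#) * (j × 1#)) ^ length p * qProduct q p ≈⟨ *-congʳ (^-congˡ (length p) (×1-homo-* i j)) ⟨
        ((i ℕ.* j) × 1#) ^ length p * qProduct q p    ≈⟨ qProduct-scale q (i ℕ.* j) p ⟨
        qProduct (λ k → (i ℕ.* j) × q k) p            ∎
        where
        a b : Carrier
        a = (i × 1#) ^ length p
        b = (j × 1#) ^ length p

-- Products of generating functions, and fractions that represent ring elements.

module Fractions {c ℓ : Level} (R : CommutativeRing c ℓ) where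

  open RingKit R

  unit-cancel : ∀ {d e a b} → d * e ≈ 1# → d * a ≈ d * b → a ≈ b
  unit-cancel {d} {e} {a} {b} de eq = begin
    a           ≈⟨ lem a ⟩
    e * (d * a) ≈⟨ *-congˡ eq ⟩
    e * (d * b) ≈⟨ lem b ⟨
    b           ∎
    where
    lem : ∀ a → a ≈ e * (d * a)
    lem a = sym (trans (solve 3 (λ d e a → e :* (d :* a) := (d :* e) :* a) refl d e a) (trans (*-congʳ de) (*-identityˡ a)))

  module _ {p} (FreeS FreeT : Carrier → Set p)
           (genS genT : (ℕ → Carrier) → Carrier)
           (genT-cong : ∀ {f g} → (∀ i → f i ≈ g i) → genT f ≈ genT g)
           {ds es dt : Carrier} (inv : ds * es ≈ 1#)
           (A B : ℕ → Carrier) (P Q m : Carrier)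
           (hS : ∀ m → FreeS m → ds * genS (λ i → A i * m) ≈ P * m)
           (hT : ∀ m → FreeT m → dt * genT (λ i → B i * m) ≈ Q * m)
           (free-1 : FreeS 1#)
           (free-B : ∀ j → FreeS (B j * m))
           (free-A : FreeT (genS (λ i → A i * 1#) * m)) where

    -- That a factor may be taken out of `genS` is derived rather than assumed: `hS`, applied to B j
    -- * m and to `1#`, gives it up to `ds`, and `ds` is a unit.
    generating-product : ds * (dt * genT (λ j → genS (λ i → A i * (B j * m)))) ≈ P * Q * m
    generating-product = begin
      ds * (dt * genT (λ j → genS (λ i → A i * (B j * m))))
        ≈⟨ *-congˡ (*-congˡ (genT-cong inner)) ⟩
      ds * (dt * genT (λ j → B j * (a * m)))
        ≈⟨ *-congˡ (hT (a * m) free-A) ⟩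
      ds * (Q * (a * m))
        ≈⟨ solve 4 (λ d q a m → d :* (q :* (a :* m)) := (d :* a) :* (q :* m)) refl ds Q a m ⟩
      (ds * a) * (Q * m)
        ≈⟨ *-congʳ (hS 1# free-1) ⟩
      P * 1# * (Q * m)
        ≈⟨ solve 3 (λ p q m → p :* con (pos 1) :* (q :* m) := p :* q :* m) refl P Q m ⟩
      P * Q * m ∎
      where
      a : Carrier
      a = genS (λ i → A i * 1#)
      inner : ∀ j → genS (λ i → A i * (B j * m)) ≈ B j * (a * m)
      inner j = unit-cancel inv (begin
        ds * genS (λ i → A i * (B j * m))   ≈⟨ hS (B j * m) (free-B j) ⟩
        P * (B j * m)                       ≈⟨ solve 3 (λ p b m → p :* (b :* m) := b :* ((p :* con (pos 1)) :* m)) refl P (B j) m ⟩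
        B j * ((P * 1#) * m)                ≈⟨ *-congˡ (*-congʳ (hS 1# free-1)) ⟨
        B j * ((ds * a) * m)                ≈⟨ solve 4 (λ d a b m → b :* ((d :* a) :* m) := d :* (b :* (a :* m))) refl ds a (B j) m ⟩
        ds * (B j * (a * m))                ∎)

  -- That the fraction a/b equals the ring element f is expressed by a ≈ f * b.
  fraction-* : ∀ {a b f a′ b′ f′} → a ≈ f * b → a′ ≈ f′ * b′ → a * a′ ≈ (f * f′) * (b * b′)
  fraction-* e e′ = trans (*-cong e e′) (solve 4 (λ f b f′ b′ → (f :* b) :* (f′ :* b′) := (f :* f′) :* (b :* b′)) refl _ _ _ _)

  fraction-+ : ∀ {a b f a′ b′ f′} → a ≈ f * b → a′ ≈ f′ * b′ → a * b′ + a′ * b ≈ (f + f′) * (b * b′)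
  fraction-+ e e′ = trans (+-cong (*-congʳ e) (*-congʳ e′)) (solve 4 (λ f b f′ b′ → (f :* b) :* b′ :+ (f′ :* b′) :* b := (f :+ f′) :* (b :* b′)) refl _ _ _ _)

  -- A factorization f = g * k takes the place of an inverse of k.
  fraction-/ : ∀ {a b f k g} → a ≈ f * b → f ≈ g * k → a * 1# ≈ g * (b * k)
  fraction-/ e e′ = trans (*-identityʳ _) (trans e (trans (*-congʳ e′) (solve 3 (λ g k b → g :* k :* b := g :* (b :* k)) refl _ _ _)))

  fraction-unit : ∀ {a b e} → b * e ≈ 1# → a * 1# ≈ (a * e) * (1# * b)
  fraction-unit {a} {b} {e} be = trans (*-congˡ (sym be)) (solve 3 (λ a b e → a :* (b :* e) := (a :* e) :* (con (pos 1) :* b)) refl a b e)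

  fraction-cross : ∀ {a b f a′ b′} → a ≈ f * b → a′ ≈ f * b′ → a * b′ ≈ a′ * b
  fraction-cross e e′ = trans (*-congʳ e) (trans (solve 3 (λ f b b′ → (f :* b) :* b′ := (f :* b′) :* b) refl _ _ _) (*-congʳ (sym e′)))

  fraction-quadruple : ∀ {y z s t y′ z′ s′ t′ h h′} → y * s ≈ h * (y′ * s′) → z * t ≈ h′ * (z′ * t′) →
    y * z * s * t ≈ (h * h′) * (y′ * z′ * s′ * t′)
  fraction-quadruple {y} {z} {s} {t} {y′} {z′} {s′} {t′} {h} {h′} e e′ =
    trans (solve 4 (λ y z s t → y :* z :* s :* t := (y :* s) :* (z :* t)) refl y z s t) (trans (*-cong e e′)
      (solve 6 (λ h h′ y z s t → (h :* (y :* s)) :* (h′ :* (z :* t)) := (h :* h′) :* (y :* z :* s :* t)) refl h h′ y′ z′ s′ t′))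

  -- The powers of k and k′ turn the monomials h, h′ into the totals g, g′ up to the factors m, m′,
  -- and `es`, `et` undo the powers of `ds`, `dt` in front of G. What is left over, m * m′, is the
  -- final denominator in the theorem.
  prefactor : ∀ {a} {I : Set a} (xs : List I) {k k′ m m′ ds es dt et G : Carrier} N (h h′ g g′ : I → Carrier) →
    ds * es ≈ 1# → dt * et ≈ 1# →
    ds ^ N * (dt ^ N * G) ≈ ∑ xs (λ x → g x * g′ x) →
    ∑ xs (λ x → (k ^ N * h x) * (k′ ^ N * h′ x)) ≈ ∑ xs (λ x → (m * g x) * (m′ * g′ x)) →
    (k * k′ * (es * et)) ^ N * ∑ xs (λ x → h x * h′ x) ≈ G * (m * m′)
  prefactor xs {k} {k′} {m} {m′} {ds} {es} {dt} {et} {G} N h h′ g g′ is it eG eh = begin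
    (k * k′ * (es * et)) ^ N * H
      ≈⟨ *-congʳ (trans (^-distrib-* (k * k′) (es * et) N) (*-cong (^-distrib-* k k′ N) (^-distrib-* es et N))) ⟩
    (k ^ N * k′ ^ N) * (es ^ N * et ^ N) * H
      ≈⟨ solve 5 (λ a b c d h → (a :* b) :* (c :* d) :* h := (c :* d) :* ((a :* b) :* h)) refl _ _ _ _ _ ⟩
    (es ^ N * et ^ N) * ((k ^ N * k′ ^ N) * H)
      ≈⟨ *-congˡ (∑-*ˡ xs (k ^ N * k′ ^ N) (λ x → h x * h′ x)) ⟨
    (es ^ N * et ^ N) * ∑ xs (λ x → (k ^ N * k′ ^ N) * (h x * h′ x))
      ≈⟨ *-congˡ (∑-cong xs (λ x → solve 4 (λ a b c d → (a :* b) :* (c :* d) := (a :* c) :* (b :* d)) refl _ _ _ _)) ⟩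
    (es ^ N * et ^ N) * ∑ xs (λ x → (k ^ N * h x) * (k′ ^ N * h′ x))
      ≈⟨ *-congˡ eh ⟩
    (es ^ N * et ^ N) * ∑ xs (λ x → (m * g x) * (m′ * g′ x))
      ≈⟨ *-congˡ (∑-cong xs (λ x → solve 4 (λ a b c d → (a :* b) :* (c :* d) := (a :* c) :* (b :* d)) refl _ _ _ _)) ⟩
    (es ^ N * et ^ N) * ∑ xs (λ x → (m * m′) * (g x * g′ x))
      ≈⟨ *-congˡ (trans (∑-*ˡ xs (m * m′) (λ x → g x * g′ x)) (*-congˡ (sym eG))) ⟩
    (es ^ N * et ^ N) * ((m * m′) * (ds ^ N * (dt ^ N * G)))
      ≈⟨ solve 6 (λ es et m ds dt G → (es :* et) :* (m :* (ds :* (dt :* G))) := ((ds :* es) :* (dt :* et)) :* (G :* m)) refl _ _ _ _ _ _ ⟩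
    ((ds ^ N * es ^ N) * (dt ^ N * et ^ N)) * (G * (m * m′))
      ≈⟨ trans (*-congʳ (trans (*-cong (inverse-^ N is) (inverse-^ N it)) (*-identityˡ 1#))) (*-identityˡ _) ⟩
    G * (m * m′) ∎
    where
    H : Carrier
    H = ∑ xs (λ x → h x * h′ x)

  partition-fraction : ∀ {z N ES ET ds dt w g} → z * w ≈ N → ds * (dt * g) ≈ ES * ET * w → N * ES * ET ≈ g * (z * ds * dt)
  partition-fraction {z} {N} {ES} {ET} {ds} {dt} {w} {g} zw eg = sym (begin
    g * (z * ds * dt)      ≈⟨ solve 4 (λ g z a b → g :* (z :* a :* b) := z :* (a :* (b :* g))) refl g z ds dt ⟩
    z * (ds * (dt * g))    ≈⟨ *-congˡ eg ⟩
    z * (ES * ET * w)      ≈⟨ solve 4 (λ z a b w → z :* (a :* b :* w) := z :* w :* a :* b) refl z ES ET w ⟩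
    z * w * ES * ET        ≈⟨ *-congʳ (*-congʳ zw) ⟩
    N * ES * ET            ∎)

  ∑-scale₂ : ∀ {a} {I : Set a} (xs : List I) d e f → d * (e * ∑ xs f) ≈ ∑ xs (λ x → d * (e * f x))
  ∑-scale₂ xs d e f = trans (*-congˡ (sym (∑-*ˡ xs e f))) (sym (∑-*ˡ xs d (λ x → e * f x)))

-- Multivariate power series as a commutative ring.

module SeriesRing where

  open import Data.Vec.Base using (Vec; []; _∷_)
  open import Data.Product.Base using (_×_; _,_; proj₁; proj₂)
  open import Data.Rational as Q using (ℚ; 0ℚ; 1ℚ)
  import Data.Rational.Properties as Qₚ
  open import Algebra.Bundles.Raw using (RawRing)
  open import Algebra.Morphism.Structures using (module RingMorphisms)
  import Algebra.Morphism.RingMonomorphism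
  open import Defs

  private
    module Qk = RingKit Qₚ.+-*-commutativeRing

  iterated : ℕ → CommutativeRing 0ℓ 0ℓ
  iterated zero = Qₚ.+-*-commutativeRing
  iterated (suc k) = PowerSeries.powerSeries (iterated k)

  -- The operations copy those of the statement, with negation as multiplication by -1 and zero as a
  -- tested constant, so that for five variables they agree with them by computation.
  rawSeries : ℕ → RawRing 0ℓ 0ℓ
  rawSeries k = record
    { Carrier = Vec ℕ k → ℚ
    ; _≈_ = λ f g → ∀ w → f w ≡ g w
    ; _+_ = λ f g w → f w Q.+ g w
    ; _*_ = λ f g w → sumℚ (map (λ p → f (proj₁ p) Q.* g (proj₂ p)) (splits w))
    ; -_ = λ f w → (Q.- 1ℚ) Q.* f w
    ; 0# = λ w → if isZeroVec w then 0ℚ else 0ℚ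
    ; 1# = λ w → if isZeroVec w then 1ℚ else 0ℚ
    }

  module I k = CommutativeRing (iterated k)
  module V k = RawRing (rawSeries k)

  -- Currying turns a series in k variables into an iterated series in one variable at a time; the
  -- ring laws are pulled back along this injection.
  cur : ∀ k → V.Carrier k → I.Carrier k
  cur zero f = f []
  cur (suc k) f a = cur k (λ w → f (a ∷ w))

  cur-cong : ∀ k {f g} → V._≈_ k f g → I._≈_ k (cur k f) (cur k g)
  cur-cong zero e = e []
  cur-cong (suc k) e a = cur-cong k (λ w → e (a ∷ w))

  cur-inj : ∀ k {f g} → I._≈_ k (cur k f) (cur k g) → V._≈_ k f g
  cur-inj zero e [] = e
  cur-inj (suc k) e (a ∷ w) = cur-inj k (e a) w

  cur-+ : ∀ k f g → I._≈_ k (cur k (V._+_ k f g)) (I._+_ k (cur k f) (cur k g))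
  cur-+ zero f g = ≡.refl
  cur-+ (suc k) f g a = cur-+ k _ _

  cur-neg : ∀ k f → I._≈_ k (cur k (V.-_ k f)) (I.-_ k (cur k f))
  cur-neg zero f = Qk.trans (Qk.sym (Qₚ.neg-distribˡ-* 1ℚ (f []))) (≡.cong Q.-_ (Qₚ.*-identityˡ (f [])))
  cur-neg (suc k) f a = cur-neg k _

  cur-const0 : ∀ k {f} → (∀ w → f w ≡ 0ℚ) → I._≈_ k (cur k f) (I.0# k)
  cur-const0 zero e = e []
  cur-const0 (suc k) e a = cur-const0 k (λ w → e (a ∷ w))

  if-same : ∀ b {x : ℚ} → (if b then x else x) ≡ x
  if-same true = ≡.refl
  if-same false = ≡.refl

  cur-1 : ∀ k → I._≈_ k (cur k (V.1# k)) (I.1# k)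
  cur-1 zero = ≡.refl
  cur-1 (suc k) zero = cur-1 k
  cur-1 (suc k) (suc a) = cur-const0 k (λ w → ≡.refl)

  sumℚ-∑ : ∀ {a} {A : Set a} (f : A → ℚ) xs → sumℚ (map f xs) ≡ Qk.∑ xs f
  sumℚ-∑ f [] = ≡.refl
  sumℚ-∑ f (x ∷ xs) = ≡.cong (f x Q.+_) (sumℚ-∑ f xs)

  V-*-cons : ∀ k f g a w → V._*_ (suc k) f g (a ∷ w) ≡
    Qk.∑< (suc a) (λ i → V._*_ k (λ u → f (i ∷ u)) (λ u → g (a ∸ i ∷ u)) w)
  V-*-cons k f g a w = begin
    sumℚ (map F (splits (a ∷ w)))                            ≡⟨ sumℚ-∑ F (splits (a ∷ w)) ⟩
    Qk.∑ (splits (a ∷ w)) F                                  ≡⟨ Qk.∑-concatMap row (upTo (suc a)) F ⟩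
    Qk.∑ (upTo (suc a)) (λ i → Qk.∑ (row i) F)               ≡⟨ Qk.∑-upTo (suc a) (λ i → Qk.∑ (row i) F) ⟩
    Qk.∑< (suc a) (λ i → Qk.∑ (row i) F)
      ≡⟨ Qk.∑<-cong′ (suc a) (λ i → ≡.trans (Qk.∑-map (cell i) (splits w) F) (≡.sym (sumℚ-∑ (λ p → F (cell i p)) (splits w)))) ⟩
    Qk.∑< (suc a) (λ i → V._*_ k (λ u → f (i ∷ u)) (λ u → g (a ∸ i ∷ u)) w) ∎
    where
    open ≡.≡-Reasoning
    F : Vec ℕ (suc k) × Vec ℕ (suc k) → ℚ
    F p = f (proj₁ p) Q.* g (proj₂ p)
    cell : ℕ → Vec ℕ k × Vec ℕ k → Vec ℕ (suc k) × Vec ℕ (suc k)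
    cell i p = (i ∷ proj₁ p) , ((a ∸ i) ∷ proj₂ p)
    row : ℕ → List (Vec ℕ (suc k) × Vec ℕ (suc k))
    row i = map (cell i) (splits w)

  cur-∑< : ∀ k n (F : ℕ → V.Carrier k) →
    I._≈_ k (cur k (λ w → Qk.∑< n (λ i → F i w))) (RingKit.∑< (iterated k) n (λ i → cur k (F i)))
  cur-∑< k zero F = cur-const0 k (λ _ → ≡.refl)
  cur-∑< k (suc n) F = I.trans k (cur-+ k (F 0) (λ w → Qk.∑< n (λ i → F (suc i) w))) (I.+-congˡ k (cur-∑< k n (λ i → F (suc i))))

  cur-* : ∀ k f g → I._≈_ k (cur k (V._*_ k f g)) (I._*_ k (cur k f) (cur k g))
  cur-* zero f g = Qₚ.+-identityʳ _
  cur-* (suc k) f g a = begin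
    cur k (λ w → V._*_ (suc k) f g (a ∷ w))
      ≈⟨ cur-cong k (V-*-cons k f g a) ⟩
    cur k (λ w → Qk.∑< (suc a) (λ i → V._*_ k (λ u → f (i ∷ u)) (λ u → g (a ∸ i ∷ u)) w))
      ≈⟨ cur-∑< k (suc a) (λ i → V._*_ k (λ u → f (i ∷ u)) (λ u → g (a ∸ i ∷ u))) ⟩
    ∑< (suc a) (λ i → cur k (V._*_ k (λ u → f (i ∷ u)) (λ u → g (a ∸ i ∷ u))))
      ≈⟨ ∑<-cong′ (suc a) (λ i → cur-* k (λ u → f (i ∷ u)) (λ u → g (a ∸ i ∷ u))) ⟩
    ∑< (suc a) (λ i → I._*_ k (cur (suc k) f i) (cur (suc k) g (a ∸ i)))
      ≈⟨ PowerSeries.⋆-∑< (iterated k) (cur (suc k) f) (cur (suc k) g) a ⟨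
    I._*_ (suc k) (cur (suc k) f) (cur (suc k) g) a ∎
    where open RingKit (iterated k)

  seriesRing : ℕ → CommutativeRing 0ℓ 0ℓ
  seriesRing k = record
    { RawRing (rawSeries k)
    ; isCommutativeRing = RM.isCommutativeRing (I.isCommutativeRing k) }
    where
    mono : RingMorphisms.IsRingMonomorphism (rawSeries k) (I.rawRing k) (cur k)
    mono = record
      { isRingHomomorphism = record
        { isSemiringHomomorphism = record
          { isNearSemiringHomomorphism = record
            { +-isMonoidHomomorphism = record
              { isMagmaHomomorphism = record
                { isRelHomomorphism = record { cong = cur-cong k }
                ; homo = cur-+ k }
              ; ε-homo = cur-const0 k (λ w → if-same (isZeroVec w)) }
            ; *-homo = cur-* k }
          ; 1#-homo = cur-1 k }
        ; -‿homo = cur-neg k }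
      ; injective = cur-inj k }
    module RM = Algebra.Morphism.RingMonomorphism mono

  𝕊 : CommutativeRing 0ℓ 0ℓ
  𝕊 = seriesRing 5

-- Products with constants and variables, and geometric series.

module SeriesProducts where

  open import Data.Fin.Base using (Fin; zero; suc)
  open import Data.List.Relation.Unary.All as All using (All; []; _∷_)
  import Data.List.Relation.Unary.All.Properties as Allₚ
  open import Data.Vec.Base using (Vec; []; _∷_; zipWith; replicate; updateAt)
  open import Data.Product.Base using (_×_; proj₁; proj₂)
  open import Data.Rational as Q using (ℚ; 0ℚ; 1ℚ)
  import Data.Rational.Properties as Qₚ
  open import Defs using (Series; splits; isZeroVec; eqVec; totalDeg; sumℚ; geom; _⊗_)
  open SeriesRing

  private
    module Qk = RingKit Qₚ.+-*-commutativeRing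

  ∑<-first : ∀ n (f : ℕ → ℚ) → (∀ i → f (suc i) ≡ 0ℚ) → Qk.∑< (suc n) f ≡ f 0
  ∑<-first n f e = ≡.trans (cong (f 0 Q.+_) (Qk.∑<-0 n (λ i _ → e i))) (Qₚ.+-identityʳ (f 0))

  V-*-zeroˡ : ∀ k {f g : Vec ℕ k → ℚ} → (∀ w → f w ≡ 0ℚ) → ∀ w → V._*_ k f g w ≡ 0ℚ
  V-*-zeroˡ k {f} {g} e w = ≡.trans (sumℚ-∑ _ (splits w)) (Qk.∑-0 (splits w) (λ p → ≡.trans (cong (Q._* g (proj₂ p)) (e (proj₁ p))) (Qₚ.*-zeroˡ (g (proj₂ p)))))

  V-*-zeroʳ : ∀ k {f g : Vec ℕ k → ℚ} → (∀ w → g w ≡ 0ℚ) → ∀ w → V._*_ k f g w ≡ 0ℚ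
  V-*-zeroʳ k {f} {g} e w = ≡.trans (sumℚ-∑ _ (splits w)) (Qk.∑-0 (splits w) (λ p → ≡.trans (cong (f (proj₁ p) Q.*_) (e (proj₂ p))) (Qₚ.*-zeroʳ (f (proj₁ p)))))

  constV : ∀ k → ℚ → Vec ℕ k → ℚ
  constV k a w = if isZeroVec w then a else 0ℚ

  constV-* : ∀ k a f w → V._*_ k (constV k a) f w ≡ a Q.* f w
  constV-* zero a f [] = Qₚ.+-identityʳ _
  constV-* (suc k) a f (b ∷ w) = ≡.trans (V-*-cons k (constV (suc k) a) f b w)
    (≡.trans (∑<-first b (λ i → V._*_ k (λ u → constV (suc k) a (i ∷ u)) (λ u → f (b ∸ i ∷ u)) w)
      (λ i → V-*-zeroˡ k {g = λ u → f (b ∸ suc i ∷ u)} (λ _ → ≡.refl) w)) (constV-* k a (λ u → f (b ∷ u)) w))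

  varV : ∀ k → Fin k → Vec ℕ k → ℚ
  varV k i w = if eqVec w (updateAt (replicate k 0) i (λ _ → 1)) then 1ℚ else 0ℚ

  shiftAt : ∀ {k} → Fin k → (Vec ℕ k → ℚ) → Vec ℕ k → ℚ
  shiftAt zero f (zero ∷ w) = 0ℚ
  shiftAt zero f (suc a ∷ w) = f (a ∷ w)
  shiftAt (suc i) f (a ∷ w) = shiftAt i (λ u → f (a ∷ u)) w

  eqVec-zero : ∀ k (w : Vec ℕ k) → eqVec w (replicate k 0) ≡ isZeroVec w
  eqVec-zero zero [] = ≡.refl
  eqVec-zero (suc k) (a ∷ w) = cong ((a ≡ᵇ 0) ∧_) (eqVec-zero k w)

  varV-* : ∀ k i f w → V._*_ k (varV k i) f w ≡ shiftAt i f w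
  varV-* (suc k) zero f (zero ∷ w) = ≡.trans (V-*-cons k (varV (suc k) zero) f 0 w)
    (≡.trans (Qₚ.+-identityʳ _) (V-*-zeroˡ k {g = λ u → f (0 ∷ u)} (λ _ → ≡.refl) w))
  varV-* (suc k) zero f (suc a ∷ w) = begin
    V._*_ (suc k) x f (suc a ∷ w)        ≡⟨ V-*-cons k x f (suc a) w ⟩
    F 0 Q.+ Qk.∑< (suc a) (λ i → F (suc i)) ≡⟨ cong₂ Q._+_ (V-*-zeroˡ k {g = λ u → f (suc a ∷ u)} (λ _ → ≡.refl) w) (∑<-first a (λ i → F (suc i)) (λ i → V-*-zeroˡ k {g = λ u → f (a ∸ suc i ∷ u)} (λ _ → ≡.refl) w)) ⟩
    0ℚ Q.+ F 1                           ≡⟨ Qₚ.+-identityˡ (F 1) ⟩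
    F 1                                  ≡⟨ CommutativeRing.*-congʳ (seriesRing k) (λ u → cong (if_then 1ℚ else 0ℚ) (eqVec-zero k u)) w ⟩
    V._*_ k (V.1# k) (λ u → f (a ∷ u)) w ≡⟨ CommutativeRing.*-identityˡ (seriesRing k) (λ u → f (a ∷ u)) w ⟩
    f (a ∷ w)                            ∎
    where
    open ≡.≡-Reasoning
    x : Vec ℕ (suc k) → ℚ
    x = varV (suc k) zero
    F : ℕ → ℚ
    F i = V._*_ k (λ u → x (i ∷ u)) (λ u → f (suc a ∸ i ∷ u)) w
  varV-* (suc k) (suc i) f (a ∷ w) = ≡.trans (V-*-cons k (varV (suc k) (suc i)) f a w)
    (≡.trans (∑<-first a (λ j → V._*_ k (λ u → varV (suc k) (suc i) (j ∷ u)) (λ u → f (a ∸ j ∷ u)) w)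
      (λ j → V-*-zeroˡ k {g = λ u → f (a ∸ suc j ∷ u)} (λ _ → ≡.refl) w)) (varV-* k i (λ u → f (a ∷ u)) w))

  applyUpTo-All : ∀ {A : Set} {P : A → Set} (f : ℕ → A) n → (∀ i → i ℕ.< n → P (f i)) → All P (applyUpTo f n)
  applyUpTo-All f zero h = []
  applyUpTo-All f (suc n) h = h 0 (s≤s z≤n) ∷ applyUpTo-All (λ i → f (suc i)) n (λ i i<n → h (suc i) (s≤s i<n))

  splits-sum : ∀ {k} (w : Vec ℕ k) → All (λ p → zipWith ℕ._+_ (proj₁ p) (proj₂ p) ≡ w) (splits w)
  splits-sum [] = ≡.refl ∷ []
  splits-sum (a ∷ w) = Allₚ.concat⁺ (Allₚ.map⁺ (applyUpTo-All (λ i → i) (suc a) (λ { i (s≤s i≤a) →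
    Allₚ.map⁺ (All.map (λ e → cong₂ _∷_ (ℕₚ.m+[n∸m]≡n i≤a) e) (splits-sum w)) })))

  sumℚ-All : ∀ {A : Set} {P : A → Set} {f g : A → ℚ} {xs} → All P xs → (∀ x → P x → f x ≡ g x) → sumℚ (map f xs) ≡ sumℚ (map g xs)
  sumℚ-All [] e = ≡.refl
  sumℚ-All (px ∷ pxs) e = cong₂ Q._+_ (e _ px) (sumℚ-All pxs e)

  -- `splits w` contains only pairs with sum w, so a coefficient of a product sees no other values
  -- of its factors.
  V-*-local : ∀ k {f f′ g g′ : Vec ℕ k → ℚ} w → (∀ u v → zipWith ℕ._+_ u v ≡ w → f u Q.* g v ≡ f′ u Q.* g′ v) →
    V._*_ k f g w ≡ V._*_ k f′ g′ w
  V-*-local k w e = sumℚ-All (splits-sum w) (λ p → e (proj₁ p) (proj₂ p))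

  totalDeg-+ : ∀ {k} (u v : Vec ℕ k) → totalDeg (zipWith ℕ._+_ u v) ≡ totalDeg u ℕ.+ totalDeg v
  totalDeg-+ [] [] = ≡.refl
  totalDeg-+ (a ∷ u) (b ∷ v) = ≡.trans (cong (a ℕ.+ b ℕ.+_) (totalDeg-+ u v)) (swap a b (totalDeg u) (totalDeg v))
    where
    swap : ∀ a b c d → a ℕ.+ b ℕ.+ (c ℕ.+ d) ≡ a ℕ.+ c ℕ.+ (b ℕ.+ d)
    swap a b c d = ≡.trans (ℕₚ.+-assoc a b (c ℕ.+ d)) (≡.trans (cong (a ℕ.+_) (≡.trans (≡.sym (ℕₚ.+-assoc b c d))
      (≡.trans (cong (ℕ._+ d) (ℕₚ.+-comm b c)) (ℕₚ.+-assoc c b d)))) (≡.sym (ℕₚ.+-assoc a c (b ℕ.+ d))))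

  open RingKit 𝕊 hiding (_×_)

  ^-Defs : ∀ f n → f Defs.^ n ≡ f ^ n
  ^-Defs f zero = ≡.refl
  ^-Defs f (suc n) = cong (f ⊗_) (^-Defs f n)

  0#-0 : ∀ w → 0# w ≡ 0ℚ
  0#-0 w = if-same (isZeroVec w)

  ∑<-at : ∀ n (h : ℕ → Series) w → ∑< n h w ≡ Qk.∑< n (λ k → h k w)
  ∑<-at zero h w = 0#-0 w
  ∑<-at (suc n) h w = cong (h 0 w Q.+_) (∑<-at n (λ i → h (suc i)) w)

  module _ (g : Series) (g₀ : ∀ w → totalDeg w ≡ 0 → g w ≡ 0ℚ) where

    ^-low : ∀ k w → totalDeg w ℕ.< k → (g ^ k) w ≡ 0ℚ
    ^-low (suc k) w h = ≡.trans (V-*-local 5 {g} {g} {g ^ k} {λ _ → 0ℚ} w term) (V-*-zeroʳ 5 {g} {λ _ → 0ℚ} (λ _ → ≡.refl) w)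
      where
      term : ∀ u v → zipWith ℕ._+_ u v ≡ w → g u Q.* (g ^ k) v ≡ g u Q.* 0ℚ
      term u v e with totalDeg u in d
      ... | zero = ≡.trans (cong (Q._* (g ^ k) v) (g₀ u d)) (≡.trans (Qₚ.*-zeroˡ ((g ^ k) v)) (≡.sym (Qₚ.*-zeroʳ (g u))))
      ... | suc m = cong (g u Q.*_) (^-low k v (ℕₚ.<-≤-trans (s≤s (ℕₚ.m≤n+m (totalDeg v) m))
        (ℕₚ.≤-trans (ℕₚ.≤-reflexive (≡.trans (cong (ℕ._+ totalDeg v) (≡.sym d)) (≡.trans (≡.sym (totalDeg-+ u v)) (cong totalDeg e)))) (ℕ.s≤s⁻¹ h))))

    -- The cut-off in `geom` varies with the exponent; a common cut-off for all exponents below a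
    -- given one is what algebra with `geom` requires.
    geom-∑< : ∀ w n → totalDeg w ℕ.≤ n → geom g w ≡ ∑< (suc n) (g ^_) w
    geom-∑< w n h = ≡.trans (≡.trans (sumℚ-∑ (λ k → (g Defs.^ k) w) (upTo (suc (totalDeg w))))
        (≡.trans (Qk.∑-upTo (suc (totalDeg w)) (λ k → (g Defs.^ k) w)) (Qk.∑<-cong′ (suc (totalDeg w)) (λ k → cong (λ f → f w) (^-Defs g k)))))
      (≡.trans (≡.sym (extend (n ∸ totalDeg w))) (≡.trans (cong (λ m → Qk.∑< (suc m) (λ k → (g ^ k) w)) (ℕₚ.m∸n+n≡m h)) (≡.sym (∑<-at (suc n) (g ^_) w))))
      where
      extend : ∀ d → Qk.∑< (suc (d ℕ.+ totalDeg w)) (λ k → (g ^ k) w) ≡ Qk.∑< (suc (totalDeg w)) (λ k → (g ^ k) w)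
      extend zero = ≡.refl
      extend (suc d) = ≡.trans (Qk.∑<-last (suc (d ℕ.+ totalDeg w)) (λ k → (g ^ k) w))
        (≡.trans (cong₂ Q._+_ (extend d) (^-low (suc (d ℕ.+ totalDeg w)) w (s≤s (ℕₚ.m≤n+m (totalDeg w) d)))) (Qₚ.+-identityʳ _))

    -- At a fixed exponent all values of `geom g` may come from one polynomial in g, and the surplus
    -- power after multiplication by g has too high a degree to contribute.
    geom-fixed : geom g ≈ 1# + g * geom g
    geom-fixed w = ≡.sym (Qk.begin
      1# w Q.+ (g * geom g) w
        Qk.≡⟨ cong (1# w Q.+_) (V-*-local 5 {g} {g} {geom g} {∑< (suc N) (g ^_)} w (λ u v e → cong (g u Q.*_) (geom-∑< v N (degree u v e)))) ⟩
      1# w Q.+ (g * ∑< (suc N) (g ^_)) w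
        Qk.≡⟨ cong (1# w Q.+_) (∑<-*ˡ (suc N) g (g ^_) w) ⟨
      1# w Q.+ ∑< (suc N) (λ k → g ^ suc k) w
        Qk.≡⟨ cong (1# w Q.+_) (∑<-last N (λ k → g ^ suc k) w) ⟩
      1# w Q.+ (∑< N (λ k → g ^ suc k) w Q.+ (g ^ suc N) w)
        Qk.≡⟨ cong (1# w Q.+_) (≡.trans (cong (∑< N (λ k → g ^ suc k) w Q.+_) (^-low (suc N) w ℕₚ.≤-refl)) (Qₚ.+-identityʳ _)) ⟩
      ∑< (suc N) (g ^_) w
        Qk.≡⟨ geom-∑< w N ℕₚ.≤-refl ⟨
      geom g w Qk.∎)
      where
      N : ℕ
      N = totalDeg w
      degree : ∀ u v → zipWith ℕ._+_ u v ≡ w → totalDeg v ℕ.≤ N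
      degree u v e = ℕₚ.≤-trans (ℕₚ.m≤n+m (totalDeg v) (totalDeg u)) (ℕₚ.≤-reflexive (≡.trans (≡.sym (totalDeg-+ u v)) (cong totalDeg e)))

    geom-inverse : (1# - g) * geom g ≈ 1#
    geom-inverse = begin
      (1# - g) * geom g            ≈⟨ solve 2 (λ g h → (con (pos 1) :- g) :* h := h :- g :* h) refl g (geom g) ⟩
      geom g - g * geom g          ≈⟨ +-congʳ geom-fixed ⟩
      (1# + g * geom g) - g * geom g ≈⟨ solve 1 (λ h → (con (pos 1) :+ h) :- h := con (pos 1)) refl (g * geom g) ⟩
      1#                           ∎

-- Freeness of a variable, generating functions and coefficients in x.

module SeriesOperators where

  open import Data.Fin.Base using (Fin; zero; suc)
  open import Data.Vec.Base using (Vec; []; _∷_; lookup; zipWith)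
  import Data.Vec.Properties as Vecₚ
  open import Data.Integer.Base as ℤ using (+_)
  open import Data.Rational as Q using (ℚ; 0ℚ; 1ℚ)
  open import Data.Rational.Unnormalised.Base using (mkℚᵘ; *≡*)
  import Data.Rational.Unnormalised.Properties as Qᵘₚ
  import Data.Rational.Properties as Qₚ
  import Data.Integer.Properties as ℤₚ
  open import Data.Empty using (⊥-elim)
  open import Relation.Binary.PropositionalEquality as ≡ using (_≢_)
  open import Defs using (Series; ℕtoℚ; totalDeg; const; var; X; Y; Z; S; T; geom; xCoeff; Fser; onePlus)
  open SeriesRing
  open SeriesProducts

  private
    module Qk = RingKit Qₚ.+-*-commutativeRing

  open RingKit 𝕊
  open PowerSeries 𝕊
  open WordSums 𝕊 using (grow; layers)
  open WordSeries 𝕊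

  -- Needed since `genS` and `genT` look at their arguments only at exponent 0 of s and t
  -- respectively.
  Free : Fin 5 → Series → Set
  Free k f = ∀ w → lookup w k ≢ 0 → f w ≡ 0ℚ

  Free-* : ∀ k {f g} → Free k f → Free k g → Free k (f * g)
  Free-* k {f} {g} hf hg w w≢0 = ≡.trans (V-*-local 5 {f} {f} {g} {λ _ → 0ℚ} w term) (V-*-zeroʳ 5 {f} {λ _ → 0ℚ} (λ _ → ≡.refl) w)
    where
    term : ∀ u v → zipWith ℕ._+_ u v ≡ w → f u Q.* g v ≡ f u Q.* 0ℚ
    term u v e with lookup u k in d
    ... | suc _ = ≡.trans (cong (Q._* g v) fu) (≡.trans (Qₚ.*-zeroˡ (g v)) (≡.sym (≡.trans (cong (Q._* 0ℚ) fu) (Qₚ.*-zeroˡ 0ℚ))))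
      where
      fu : f u ≡ 0ℚ
      fu = hf u (λ z → ℕₚ.1+n≢0 (≡.trans (≡.sym d) z))
    ... | zero = cong (f u Q.*_) (hg v (λ z → w≢0 (≡.trans (cong (λ x → lookup x k) (≡.sym e))
      (≡.trans (Vecₚ.lookup-zipWith ℕ._+_ k u v) (cong₂ ℕ._+_ d z)))))

  Free-+ : ∀ k {f g} → Free k f → Free k g → Free k (f + g)
  Free-+ k hf hg w h = ≡.trans (cong₂ Q._+_ (hf w h) (hg w h)) (Qₚ.+-identityˡ 0ℚ)

  Free-neg : ∀ k {f} → Free k f → Free k (- f)
  Free-neg k hf w h = ≡.trans (cong ((Q.- 1ℚ) Q.*_) (hf w h)) (Qₚ.*-zeroʳ (Q.- 1ℚ))

  Free-0 : ∀ k → Free k 0#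
  Free-0 k w _ = 0#-0 w

  Free-const : ∀ k c → Free k (const c)
  Free-const k c w h = lem w k h
    where
    lem : ∀ {n} (w : Vec ℕ n) k → lookup w k ≢ 0 → constV n c w ≡ 0ℚ
    lem (zero ∷ w) zero h = ⊥-elim (h ≡.refl)
    lem (suc a ∷ w) zero h = ≡.refl
    lem (zero ∷ w) (suc k) h = lem w k h
    lem (suc a ∷ w) (suc k) h = ≡.refl

  Free-^ : ∀ k {f} n → Free k f → Free k (f ^ n)
  Free-^ k zero h = Free-const k 1ℚ
  Free-^ k {f} (suc n) h = Free-* k {f} h (Free-^ k n h)

  Free-if : ∀ k b {f g} → Free k f → Free k g → Free k (if b then f else g)
  Free-if k true hf hg = hf
  Free-if k false hf hg = hg

  Free-grow : ∀ k {A : Set} (r : A → A → Bool) p {g} → Free k p → (∀ w → Free k (g w)) → ∀ w → Free k (grow r p g w)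
  Free-grow k r p hp hg [] = hg []
  Free-grow k r p {g} hp hg (x ∷ []) = Free-+ k {g (x ∷ [])} (hg _) (Free-* k {p} hp (hg []))
  Free-grow k r p {g} hp hg (x ∷ y ∷ w) = Free-+ k {g (x ∷ y ∷ w)} (hg _)
    (Free-* k {p} hp (Free-if k (r x y) (Free-grow k r p hp hg (y ∷ w)) (hg (y ∷ w))))

  Free-layers : ∀ k {A : Set} (r : A → A → Bool) y → Free k y → ∀ i w → Free k (layers r y 1# i w)
  Free-layers k r y hy zero [] = Free-const k 1ℚ
  Free-layers k r y hy zero (_ ∷ _) = Free-0 k
  Free-layers k r y hy (suc i) = Free-grow k _ y hy (Free-grow k r 1# (Free-const k 1ℚ) (Free-layers k r y hy i))

  shiftAt-lookup : ∀ {n} (k : Fin n) f w → lookup w k ≡ 0 → shiftAt k f w ≡ 0ℚ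
  shiftAt-lookup zero f (zero ∷ w) h = ≡.refl
  shiftAt-lookup (suc k) f (a ∷ w) h = shiftAt-lookup k _ w h

  shiftAt-0 : ∀ {n} (k : Fin n) {f} → (∀ w → f w ≡ 0ℚ) → ∀ w → shiftAt k f w ≡ 0ℚ
  shiftAt-0 zero h (zero ∷ w) = ≡.refl
  shiftAt-0 zero h (suc a ∷ w) = h (a ∷ w)
  shiftAt-0 (suc k) h (a ∷ w) = shiftAt-0 k (λ u → h (a ∷ u)) w

  shiftAt-free : ∀ {n} {k k′ : Fin n} {f} → k ≢ k′ → (∀ w → lookup w k ≢ 0 → f w ≡ 0ℚ) → ∀ w → lookup w k ≢ 0 → shiftAt k′ f w ≡ 0ℚ
  shiftAt-free {k = zero} {zero} k≢k′ h w w≢0 = ⊥-elim (k≢k′ ≡.refl)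
  shiftAt-free {k = zero} {suc k′} k≢k′ h (a ∷ w) w≢0 = shiftAt-0 k′ (λ u → h (a ∷ u) w≢0) w
  shiftAt-free {k = suc k} {zero} k≢k′ h (zero ∷ w) w≢0 = ≡.refl
  shiftAt-free {k = suc k} {zero} k≢k′ h (suc a ∷ w) w≢0 = h (a ∷ w) w≢0
  shiftAt-free {k = suc k} {suc k′} k≢k′ h (a ∷ w) w≢0 = shiftAt-free (λ e → k≢k′ (cong suc e)) (λ u → h (a ∷ u)) w w≢0

  Free-var : ∀ k k′ → k ≢ k′ → Free k (var k′)
  Free-var k k′ k≢k′ w w≢0 = ≡.trans (≡.sym (*-identityʳ (var k′) w))
    (≡.trans (varV-* 5 k′ 1# w) (shiftAt-free k≢k′ (Free-const k 1ℚ) w w≢0))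

  totalDeg-lookup : ∀ {n} (w : Vec ℕ n) k → totalDeg w ≡ 0 → lookup w k ≡ 0
  totalDeg-lookup (a ∷ w) zero h = ℕₚ.m+n≡0⇒m≡0 a h
  totalDeg-lookup (a ∷ w) (suc k) h = totalDeg-lookup w k (ℕₚ.m+n≡0⇒n≡0 a h)

  NoConstant : Series → Set
  NoConstant g = ∀ w → totalDeg w ≡ 0 → g w ≡ 0ℚ

  var*-noConstant : ∀ k f → NoConstant (var k * f)
  var*-noConstant k f w h = ≡.trans (varV-* 5 k f w) (shiftAt-lookup k f w (totalDeg-lookup w k h))

  var-noConstant : ∀ k → NoConstant (var k)
  var-noConstant k w h = ≡.trans (≡.sym (*-identityʳ (var k) w)) (var*-noConstant k 1# w h)

  -- genS f and genT f are Σ fᵢ sⁱ and Σ fᵢ tⁱ, provided that the fᵢ do not involve s and t respectively.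
  genS genT : (ℕ → Series) → Series
  genS f (a ∷ b ∷ c ∷ i ∷ j ∷ []) = f i (a ∷ b ∷ c ∷ 0 ∷ j ∷ [])
  genT f (a ∷ b ∷ c ∷ i ∷ j ∷ []) = f j (a ∷ b ∷ c ∷ i ∷ 0 ∷ [])

  genS-cong : ∀ {f g} → (∀ i → f i ≈ g i) → genS f ≈ genS g
  genS-cong e (a ∷ b ∷ c ∷ i ∷ j ∷ []) = e i _

  genT-cong : ∀ {f g} → (∀ i → f i ≈ g i) → genT f ≈ genT g
  genT-cong e (a ∷ b ∷ c ∷ i ∷ j ∷ []) = e j _

  genS-+ : ∀ f g → genS (λ i → f i + g i) ≈ genS f + genS g
  genS-+ f g (a ∷ b ∷ c ∷ i ∷ j ∷ []) = ≡.refl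

  genT-+ : ∀ f g → genT (λ i → f i + g i) ≈ genT f + genT g
  genT-+ f g (a ∷ b ∷ c ∷ i ∷ j ∷ []) = ≡.refl

  genS-0 : genS (λ _ → 0#) ≈ 0#
  genS-0 w@(a ∷ b ∷ c ∷ i ∷ j ∷ []) = ≡.trans (0#-0 (a ∷ b ∷ c ∷ 0 ∷ j ∷ [])) (≡.sym (0#-0 w))

  genT-0 : genT (λ _ → 0#) ≈ 0#
  genT-0 w@(a ∷ b ∷ c ∷ i ∷ j ∷ []) = ≡.trans (0#-0 (a ∷ b ∷ c ∷ i ∷ 0 ∷ [])) (≡.sym (0#-0 w))

  genS-Y : ∀ f → genS (λ i → Y * f i) ≈ Y * genS f
  genS-Y f w@(a ∷ b ∷ c ∷ i ∷ j ∷ []) = ≡.trans (varV-* 5 (suc zero) (f i) (a ∷ b ∷ c ∷ 0 ∷ j ∷ []))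
    (≡.trans (lem b) (≡.sym (varV-* 5 (suc zero) (genS f) w)))
    where
    lem : ∀ b → shiftAt (suc zero) (f i) (a ∷ b ∷ c ∷ 0 ∷ j ∷ []) ≡ shiftAt (suc zero) (genS f) (a ∷ b ∷ c ∷ i ∷ j ∷ [])
    lem zero = ≡.refl
    lem (suc b) = ≡.refl

  genT-Z : ∀ f → genT (λ i → Z * f i) ≈ Z * genT f
  genT-Z f w@(a ∷ b ∷ c ∷ i ∷ j ∷ []) = ≡.trans (varV-* 5 (suc (suc zero)) (f j) (a ∷ b ∷ c ∷ i ∷ 0 ∷ []))
    (≡.trans (lem c) (≡.sym (varV-* 5 (suc (suc zero)) (genT f) w)))
    where
    lem : ∀ c → shiftAt (suc (suc zero)) (f j) (a ∷ b ∷ c ∷ i ∷ 0 ∷ []) ≡ shiftAt (suc (suc zero)) (genT f) (a ∷ b ∷ c ∷ i ∷ j ∷ [])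
    lem zero = ≡.refl
    lem (suc c) = ≡.refl

  genS-X : ∀ f → genS (X· f) ≈ S * genS f
  genS-X f w@(a ∷ b ∷ c ∷ zero ∷ j ∷ []) = ≡.trans (0#-0 (a ∷ b ∷ c ∷ 0 ∷ j ∷ [])) (≡.sym (varV-* 5 (suc (suc (suc zero))) (genS f) w))
  genS-X f w@(a ∷ b ∷ c ∷ suc i ∷ j ∷ []) = ≡.sym (varV-* 5 (suc (suc (suc zero))) (genS f) w)

  genT-X : ∀ f → genT (X· f) ≈ T * genT f
  genT-X f w@(a ∷ b ∷ c ∷ i ∷ zero ∷ []) = ≡.trans (0#-0 (a ∷ b ∷ c ∷ i ∷ 0 ∷ [])) (≡.sym (varV-* 5 (suc (suc (suc (suc zero)))) (genT f) w))
  genT-X f w@(a ∷ b ∷ c ∷ i ∷ suc j ∷ []) = ≡.sym (varV-* 5 (suc (suc (suc (suc zero)))) (genT f) w)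

  genS-C : ∀ m → Free (suc (suc (suc zero))) m → genS (C m) ≈ m
  genS-C m h (a ∷ b ∷ c ∷ zero ∷ j ∷ []) = ≡.refl
  genS-C m h w@(a ∷ b ∷ c ∷ suc i ∷ j ∷ []) = ≡.trans (0#-0 (a ∷ b ∷ c ∷ 0 ∷ j ∷ [])) (≡.sym (h w (λ ())))

  genT-C : ∀ m → Free (suc (suc (suc (suc zero)))) m → genT (C m) ≈ m
  genT-C m h (a ∷ b ∷ c ∷ i ∷ zero ∷ []) = ≡.refl
  genT-C m h w@(a ∷ b ∷ c ∷ i ∷ suc j ∷ []) = ≡.trans (0#-0 (a ∷ b ∷ c ∷ i ∷ 0 ∷ [])) (≡.sym (h w (λ ())))

  genS-Free : ∀ {f} → (∀ i → Free (suc (suc (suc (suc zero)))) (f i)) → Free (suc (suc (suc (suc zero)))) (genS f)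
  genS-Free h (a ∷ b ∷ c ∷ i ∷ j ∷ []) j≢0 = h i _ j≢0

  private
    ι : (Vec ℕ 4 → ℚ) → Series
    ι h (a ∷ w) = if a ≡ᵇ 0 then h w else 0ℚ

    ι-* : ∀ h h′ → ι h * ι h′ ≈ ι (V._*_ 4 h h′)
    ι-* h h′ (zero ∷ w) = ≡.trans (V-*-cons 4 (ι h) (ι h′) 0 w) (Qₚ.+-identityʳ _)
    ι-* h h′ (suc a ∷ w) = ≡.trans (V-*-cons 4 (ι h) (ι h′) (suc a) w) (Qk.∑<-0 (suc (suc a)) (λ i _ → term i))
      where
      term : ∀ i → V._*_ 4 (λ u → ι h (i ∷ u)) (λ u → ι h′ (suc a ∸ i ∷ u)) w ≡ 0ℚ
      term zero = V-*-zeroʳ 4 {h} (λ _ → ≡.refl) w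
      term (suc i) = V-*-zeroˡ 4 {g = λ u → ι h′ (a ∸ i ∷ u)} (λ _ → ≡.refl) w

    xCoeff-ι : ∀ n f → xCoeff n f ≈ ι (λ u → f (n ∷ u))
    xCoeff-ι n f (a ∷ w) = ≡.refl

  xCoeff-cong : ∀ n {f g} → f ≈ g → xCoeff n f ≈ xCoeff n g
  xCoeff-cong n e (zero ∷ w) = e (n ∷ w)
  xCoeff-cong n e (suc a ∷ w) = ≡.refl

  xCoeff-+ : ∀ n f g → xCoeff n (f + g) ≈ xCoeff n f + xCoeff n g
  xCoeff-+ n f g (zero ∷ w) = ≡.refl
  xCoeff-+ n f g (suc a ∷ w) = ≡.sym (Qₚ.+-identityˡ 0ℚ)

  xCoeff-neg : ∀ n f → xCoeff n (- f) ≈ - xCoeff n f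
  xCoeff-neg n f (zero ∷ w) = ≡.refl
  xCoeff-neg n f (suc a ∷ w) = ≡.sym (Qₚ.*-zeroʳ (Q.- 1ℚ))

  -- This makes extraction of x-coefficients a multiplicative map into the one-variable series over
  -- `𝕊`, where the word sums live.
  xCoeff-* : ∀ n f g → xCoeff n (f * g) ≈ ((λ i → xCoeff i f) ⋆ (λ i → xCoeff i g)) n
  xCoeff-* n f g w = ≡.sym (≡.trans (⋆-∑< (λ i → xCoeff i f) (λ i → xCoeff i g) n w)
    (≡.trans (∑<-at (suc n) (λ i → xCoeff i f * xCoeff (n ∸ i) g) w)
      (≡.trans (Qk.∑<-cong′ (suc n) (λ i → ≡.trans (*-cong (xCoeff-ι i f) (xCoeff-ι (n ∸ i) g) w) (ι-* (λ u → f (i ∷ u)) (λ u → g (n ∸ i ∷ u)) w))) (lem w))))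
    where
    lem : ∀ w → Qk.∑< (suc n) (λ i → ι (V._*_ 4 (λ u → f (i ∷ u)) (λ u → g (n ∸ i ∷ u))) w) ≡ xCoeff n (f * g) w
    lem (zero ∷ w) = ≡.sym (V-*-cons 4 f g n w)
    lem (suc a ∷ w) = Qk.∑<-0 (suc n) (λ _ _ → ≡.refl)

  xCoeff-1 : ∀ n → xCoeff n 1# ≈ one n
  xCoeff-1 zero (zero ∷ w) = ≡.refl
  xCoeff-1 zero (suc a ∷ w) = ≡.refl
  xCoeff-1 (suc n) (zero ∷ w) = ≡.sym (0#-0 (zero ∷ w))
  xCoeff-1 (suc n) (suc a ∷ w) = ≡.refl

  xCoeff-X : ∀ n f → xCoeff n (X * f) ≈ X· (λ i → xCoeff i f) n
  xCoeff-X zero f (zero ∷ w) = ≡.trans (varV-* 5 zero f (zero ∷ w)) (≡.sym (0#-0 (zero ∷ w)))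
  xCoeff-X zero f (suc a ∷ w) = ≡.refl
  xCoeff-X (suc n) f (zero ∷ w) = varV-* 5 zero f (suc n ∷ w)
  xCoeff-X (suc n) f (suc a ∷ w) = ≡.refl

  -- Expresses that p is free of x by the consequence in use.
  XLinear : Series → Set
  XLinear p = ∀ n f → xCoeff n (p * f) ≈ p * xCoeff n f

  XLinear-var : ∀ k → XLinear (var (suc k))
  XLinear-var k n f (zero ∷ w) = ≡.trans (varV-* 5 (suc k) f (n ∷ w)) (≡.sym (varV-* 5 (suc k) (xCoeff n f) (zero ∷ w)))
  XLinear-var k n f (suc a ∷ w) = ≡.sym (≡.trans (varV-* 5 (suc k) (xCoeff n f) (suc a ∷ w)) (shiftAt-0 k (λ _ → ≡.refl) w))

  XLinear-* : ∀ p q → XLinear p → XLinear q → XLinear (p * q)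
  XLinear-* p q hp hq n f = trans (xCoeff-cong n (*-assoc p q f)) (trans (hp n (q * f)) (trans (*-congˡ {p} (hq n f)) (sym (*-assoc p q (xCoeff n f)))))

  XLinear-1 : XLinear 1#
  XLinear-1 n f = trans (xCoeff-cong n (*-identityˡ f)) (sym (*-identityˡ (xCoeff n f)))

  xCoeff-pX : ∀ p → XLinear p → ∀ n → xCoeff n (p * X) ≈ p * X· one n
  xCoeff-pX p h n = trans (h n X) (*-congˡ {p} (trans (xCoeff-cong n (sym (*-identityʳ X))) (trans (xCoeff-X n 1#) (lem n))))
    where
    lem : ∀ n → X· (λ i → xCoeff i 1#) n ≈ X· one n
    lem zero = refl
    lem (suc n) = xCoeff-1 n

  xCoeff-1+pX : ∀ p → XLinear p → ∀ n → xCoeff n (1# + p * X) ≈ lin p n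
  xCoeff-1+pX p h n = trans (xCoeff-+ n 1# (p * X)) (trans (+-cong (xCoeff-1 n) (xCoeff-pX p h n)) (one+pX p n))

  xCoeff-1-pX : ∀ p → XLinear p → ∀ n → xCoeff n (1# - p * X) ≈ lin (- p) n
  xCoeff-1-pX p h n = trans (xCoeff-+ n 1# (- (p * X)))
    (trans (+-cong (xCoeff-1 n) (trans (xCoeff-neg n (p * X)) (trans (-‿cong (xCoeff-pX p h n)) (-‿distribˡ-* p (X· one n))))) (one+pX (- p) n))

  pX-noConstant : ∀ p → NoConstant (p * X)
  pX-noConstant p w h = ≡.trans (*-comm p X w) (var*-noConstant zero p w h)

  -- `geom` is not expanded: the equation (1 - pX) f = 1 determines the coefficients.
  xCoeff-geom : ∀ p → XLinear p → ∀ n → xCoeff n (geom (p * X)) ≈ geo p n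
  xCoeff-geom p h = geo-unique p (λ n → xCoeff n (geom (p * X))) (λ n →
    trans (⋆-cong (λ i → sym (xCoeff-1-pX p h i)) (λ _ → refl) n)
      (trans (sym (xCoeff-* n (1# - p * X) (geom (p * X))))
        (trans (xCoeff-cong n (geom-inverse (p * X) (pX-noConstant p))) (xCoeff-1 n))))

  geom-cong : ∀ {f g} → f ≈ g → geom f ≈ geom g
  geom-cong {f} {g} e w = ≡.trans (sumℚ-∑ (λ k → (f Defs.^ k) w) ks) (≡.trans
    (Qk.∑-cong ks (λ k → ≡.trans (cong (λ h → h w) (^-Defs f k)) (≡.trans (^-congˡ k e w) (cong (λ h → h w) (≡.sym (^-Defs g k))))))
    (≡.sym (sumℚ-∑ (λ k → (g Defs.^ k) w) ks)))
    where
    ks : List ℕ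
    ks = upTo (suc (totalDeg w))

  -- The factors of F, regrouped into one for decreasing and one for increasing words.
  Fκ : ℕ → Series
  Fκ = (lin Y ⋆ geo (Y * Z)) ⋆ (lin Z ⋆ geo 1#)

  xCoeff-F : ∀ n → xCoeff n Fser ≈ Fκ n
  xCoeff-F n = trans (xCoeff-* n (F₁ * F₂ * F₃) F₄) (trans
    (⋆-cong (λ i → trans (xCoeff-* i (F₁ * F₂) F₃) (⋆-cong (λ j → trans (xCoeff-* j F₁ F₂)
        (⋆-cong (xCoeff-1+pX Y (XLinear-var zero)) (xCoeff-1+pX Z (XLinear-var (suc zero))) j))
        (xCoeff-geom (Y * Z) (XLinear-* Y Z (XLinear-var zero) (XLinear-var (suc zero)))) i))
      (λ i → trans (xCoeff-cong i (geom-cong (sym (*-identityˡ X)))) (xCoeff-geom 1# XLinear-1 i)) n)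
    (lin-geo-arrange Y Z n))
    where
    F₁ F₂ F₃ F₄ : Series
    F₁ = onePlus (Y * X)
    F₂ = onePlus (Z * X)
    F₃ = geom (Y * Z * X)
    F₄ = geom X

  xCoeff-F^ : ∀ m n → xCoeff n (Fser ^ m) ≈ (Fκ P.^ m) n
  xCoeff-F^ zero n = xCoeff-1 n
  xCoeff-F^ (suc m) n = trans (xCoeff-* n Fser (Fser ^ m)) (⋆-cong xCoeff-F (xCoeff-F^ m) n)

  const-* : ∀ a f → const a * f ≈ Defs.scale a f
  const-* a f w = constV-* 5 a f w

  ℕtoℚ-suc : ∀ n → ℕtoℚ (suc n) ≡ 1ℚ Q.+ ℕtoℚ n
  ℕtoℚ-suc n = Qₚ.toℚᵘ-injective (Qᵘₚ.≃-trans (Qₚ.toℚᵘ-fromℚᵘ (mkℚᵘ (+ suc n) 0))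
    (Qᵘₚ.≃-trans (*≡* eq) (Qᵘₚ.≃-sym (Qᵘₚ.≃-trans (Qₚ.toℚᵘ-homo-+ 1ℚ (ℕtoℚ n)) (Qᵘₚ.+-cong {mkℚᵘ (+ 1) 0} Qᵘₚ.≃-refl (Qₚ.toℚᵘ-fromℚᵘ (mkℚᵘ (+ n) 0)))))))
    where
    eq : + suc n ℤ.* + 1 ≡ ((+ 1 ℤ.* + 1) ℤ.+ (+ n ℤ.* + 1)) ℤ.* + 1
    eq = cong (ℤ._* + 1) (cong (λ x → + 1 ℤ.+ x) (≡.sym (ℤₚ.*-identityʳ (+ n))))

  ×-at : ∀ n f w → (n × f) w ≡ ℕtoℚ n Q.* f w
  ×-at zero f w = ≡.trans (0#-0 w) (≡.sym (Qₚ.*-zeroˡ (f w)))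
  ×-at (suc n) f w = ≡.trans (cong (f w Q.+_) (×-at n f w)) (≡.sym (≡.trans (cong (Q._* f w) (ℕtoℚ-suc n))
    (≡.trans (Qₚ.*-distribʳ-+ (f w) 1ℚ (ℕtoℚ n)) (cong (Q._+ ℕtoℚ n Q.* f w) (Qₚ.*-identityˡ (f w))))))

  ℕtoℚ-nonZero : ∀ n → .{{NonZero n}} → Q.NonZero (ℕtoℚ n)
  ℕtoℚ-nonZero n = Qₚ.pos⇒nonZero (ℕtoℚ n) {{Qₚ.normalize-pos n 1}}

  torsionFree : ∀ n {f g} → .{{NonZero n}} → n × f ≈ n × g → f ≈ g
  torsionFree n {f} {g} e w = ≡.trans (≡.sym (back (f w))) (≡.trans (cong (Q.1/ ℕtoℚ n Q.*_) (≡.trans (≡.sym (×-at n f w)) (≡.trans (e w) (×-at n g w)))) (back (g w)))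
    where
    instance _ = ℕtoℚ-nonZero n
    back : ∀ x → Q.1/ ℕtoℚ n Q.* (ℕtoℚ n Q.* x) ≡ x
    back x = ≡.trans (≡.sym (Qₚ.*-assoc (Q.1/ ℕtoℚ n) (ℕtoℚ n) x)) (≡.trans (cong (Q._* x) (Qₚ.*-inverseˡ (ℕtoℚ n))) (Qₚ.*-identityˡ x))

-- The sides of both identities as representations of one series.

module Assembly where

  open import Data.Fin.Base using (Fin; zero; suc)
  open import Data.List.Relation.Unary.All as All using (All; []; _∷_)
  import Data.List.Relation.Unary.All.Properties as Allₚ
  open import Data.Vec.Base using ([]; _∷_)
  open import Data.Product.Base using (_,_; proj₁; proj₂)
  open import Data.Rational as Q using (ℚ; 0ℚ; 1ℚ)
  import Data.Rational.Properties as Qₚ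
  open import Defs using (Series; Frac; distinct; ℕtoℚ; constℕ; Y; Z; S; T; geom; xCoeff; Fser; onePlus; oneMinus; scale; RHSa; RHSb; LHSn; LHSa-coeff; 𝔖; inverse; pk; des; ipk; ides; Eulerian; sumS; prodS; partitions; parts; zλ; toF; _*F_; _/F_; _^F_; sumF; Pn; _≈F_)
  open SeriesRing
  open SeriesProducts
  open SeriesOperators
  open WordLemmas
  open PartitionLemmas using (zλ-nonZero)

  open RingKit 𝕊
  open PowerSeries 𝕊 using (X·; C)
  open WordSums 𝕊 using (layers)
  open PermutationSums 𝕊 using (permSum; permSum-cong; ∑-𝔖)
  open Standardization 𝕊 using (permSum-layers; permSum-power)
  open WordSeries 𝕊 using (wordSum-layers; module P)
  open Transfer 𝕊
  open PartitionSums 𝕊 using (∑-parts; qProduct; Σλ)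
  open LogarithmicDerivative 𝕊 using (power-partitions-ij)
  open Fractions 𝕊

  y∙ z∙ s∙ t∙ : Fin 5
  y∙ = suc zero
  z∙ = suc (suc zero)
  s∙ = suc (suc (suc zero))
  t∙ = suc (suc (suc (suc zero)))

  Ds Es Dt Et : Series
  Ds = 1# - S
  Es = geom S
  Dt = 1# - T
  Et = geom T

  Ds-inverse : Ds * Es ≈ 1#
  Ds-inverse = geom-inverse S (var-noConstant s∙)

  Dt-inverse : Dt * Et ≈ 1#
  Dt-inverse = geom-inverse T (var-noConstant t∙)

  Ks Js Kt Jt : Series
  Ks = 1# + Y * S
  Js = geom (- (Y * S))
  Kt = 1# + Z * T
  Jt = geom (- (Z * T))

  neg-noConstant : ∀ g → NoConstant g → NoConstant (- g)
  neg-noConstant g h w e = ≡.trans (cong ((Q.- 1ℚ) Q.*_) (h w e)) (Qₚ.*-zeroʳ (Q.- 1ℚ))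

  one-plus-inverse : ∀ g → NoConstant g → (1# + g) * geom (- g) ≈ 1#
  one-plus-inverse g h = trans (*-congʳ {geom (- g)} {1# + g} {1# - (- g)} (+-congˡ {1#} {g} { - (- g)} (sym (-‿involutive g)))) (geom-inverse (- g) (neg-noConstant g h))

  Ks-inverse : Ks * Js ≈ 1#
  Ks-inverse = one-plus-inverse (Y * S) (var*-noConstant (suc zero) S)

  Kt-inverse : Kt * Jt ≈ 1#
  Kt-inverse = one-plus-inverse (Z * T) (var*-noConstant (suc (suc zero)) T)

  Y-free-S : Free s∙ Y
  Y-free-S = Free-var s∙ y∙ (λ ())

  Y-free-T : Free t∙ Y
  Y-free-T = Free-var t∙ y∙ (λ ())

  Z-free-S : Free s∙ Z
  Z-free-S = Free-var s∙ z∙ (λ ())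

  Z-free-T : Free t∙ Z
  Z-free-T = Free-var t∙ z∙ (λ ())

  genS-∑ : ∀ {A : Set} (xs : List A) (f : ℕ → A → Series) → genS (λ i → ∑ xs (f i)) ≈ ∑ xs (λ x → genS (λ i → f i x))
  genS-∑ [] f = genS-0
  genS-∑ (x ∷ xs) f = trans (genS-+ (λ i → f i x) (λ i → ∑ xs (f i))) (+-congˡ {genS (λ i → f i x)} (genS-∑ xs f))

  genT-∑ : ∀ {A : Set} (xs : List A) (f : ℕ → A → Series) → genT (λ i → ∑ xs (f i)) ≈ ∑ xs (λ x → genT (λ i → f i x))
  genT-∑ [] f = genT-0
  genT-∑ (x ∷ xs) f = trans (genT-+ (λ i → f i x) (λ i → ∑ xs (f i))) (+-congˡ {genT (λ i → f i x)} (genT-∑ xs f))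

  genTS-∑ : ∀ {A : Set} (xs : List A) (f : ℕ → ℕ → A → Series) →
    genT (λ j → genS (λ i → ∑ xs (f i j))) ≈ ∑ xs (λ x → genT (λ j → genS (λ i → f i j x)))
  genTS-∑ xs f = trans (genT-cong (λ j → genS-∑ xs (λ i → f i j))) (genT-∑ xs (λ j x → genS (λ i → f i j x)))

  G : ℕ → Series
  G n = genT (λ j → genS (λ i → xCoeff n (Fser ^ (i ℕ.* j))))

  -- `RHSa` reads the powers of F at exponent 0 of s and t, just as the nested `genT` and `genS` do.
  xCoeff-RHSa : ∀ n → xCoeff n RHSa ≈ G n
  xCoeff-RHSa n (zero ∷ b ∷ c ∷ i ∷ j ∷ []) = cong (λ f → f (n ∷ b ∷ c ∷ 0 ∷ 0 ∷ [])) (^-Defs Fser (i ℕ.* j))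
  xCoeff-RHSa n (suc a ∷ b ∷ c ∷ i ∷ j ∷ []) = ≡.refl

  α β : ℕ → List ℕ → Series
  α = layers _<ᵇ_ Y 1#
  β = layers _<ᵇ_ Z 1#

  totS totT : List ℕ → Series
  totS = total _<ᵇ_ Y S
  totT = total _<ᵇ_ Z T

  -- The trailing `1#` is the factor m of `generating-product`; for partitions that place is taken
  -- by `w₀ p`.
  G-term : List ℕ → Series
  G-term π = genT (λ j → genS (λ i → α i π * (β j (inverse π) * 1#)))

  G-permutations : ∀ n → G n ≈ ∑ (𝔖 n) G-term
  G-permutations n = trans (genT-cong (λ j → genS-cong (λ i → coefficient i j))) (genTS-∑ (𝔖 n) (λ i j π → α i π * (β j (inverse π) * 1#)))
    where
    coefficient : ∀ i j → xCoeff n (Fser ^ (i ℕ.* j)) ≈ ∑ (𝔖 n) (λ π → α i π * (β j (inverse π) * 1#))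
    coefficient i j = trans (xCoeff-F^ (i ℕ.* j) n) (trans (sym (wordSum-layers Y Z j i n)) (trans (sym (permSum-layers Y i Z 1# j n))
      (trans (sym (∑-𝔖 n (λ π → α i π * β j (inverse π)))) (∑-cong (𝔖 n) (λ π → *-congˡ {α i π} (sym (*-identityʳ (β j (inverse π)))))))))

  genS-total : ∀ n v → length v ≡ suc n → ∀ m → Free s∙ m → Ds ^ suc (suc n) * genS (λ i → α i v * m) ≈ S * totS v * m
  genS-total _ (x ∷ w) ≡.refl m h = layers-total _<ᵇ_ Y S genS genS-cong genS-+ genS-Y genS-X m (genS-C m h) x w

  genT-total : ∀ n v → length v ≡ suc n → ∀ m → Free t∙ m → Dt ^ suc (suc n) * genT (λ i → β i v * m) ≈ T * totT v * m
  genT-total _ (x ∷ w) ≡.refl m h = layers-total _<ᵇ_ Z T genT genT-cong genT-+ genT-Z genT-X m (genT-C m h) x w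

  1-free : ∀ k → Free k 1#
  1-free k = Free-const k 1ℚ

  G-term-total : ∀ n π → Perm (suc n) π → Ds ^ suc (suc n) * (Dt ^ suc (suc n) * G-term π) ≈ (S * totS π) * (T * totT (inverse π))
  G-term-total n π P = trans
    (generating-product (Free s∙) (Free t∙) genS genT genT-cong {Ds ^ suc (suc n)} {Es ^ suc (suc n)} {Dt ^ suc (suc n)}
      (inverse-^ {Ds} {Es} (suc (suc n)) Ds-inverse) (λ i → α i π) (λ j → β j (inverse π)) (S * totS π) (T * totT (inverse π)) 1#
      (genS-total n π (Perm-length P))
      (genT-total n (inverse π) (≡.trans (inverse-length π) (Perm-length P)))
      (1-free s∙)
      (λ j → Free-* s∙ {β j (inverse π)} {1#} (Free-layers s∙ _<ᵇ_ Z Z-free-S j (inverse π)) (1-free s∙))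
      (Free-* t∙ {genS (λ i → α i π * 1#)} {1#} (genS-Free (λ i → Free-* t∙ {α i π} {1#} (Free-layers t∙ _<ᵇ_ Y Y-free-T i π) (1-free t∙))) (1-free t∙)))
    (*-identityʳ ((S * totS π) * (T * totT (inverse π))))

  ∑-𝔖-cong : ∀ n {f g : List ℕ → Series} → (∀ π → Perm n π → f π ≈ g π) → ∑ (𝔖 n) f ≈ ∑ (𝔖 n) g
  ∑-𝔖-cong n {f} {g} e = trans (∑-𝔖 n f) (trans (permSum-cong n e) (sym (∑-𝔖 n g)))

  G-total : ∀ n → Ds ^ suc (suc n) * (Dt ^ suc (suc n) * G (suc n)) ≈ ∑ (𝔖 (suc n)) (λ π → (S * totS π) * (T * totT (inverse π)))
  G-total n = trans (*-congˡ {Ds ^ suc (suc n)} (*-congˡ {Dt ^ suc (suc n)} (G-permutations (suc n))))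
    (trans (∑-scale₂ (𝔖 (suc n)) (Ds ^ suc (suc n)) (Dt ^ suc (suc n)) G-term) (∑-𝔖-cong (suc n) (G-term-total n)))

  G-zero : Ds * (Dt * G 0) ≈ 1#
  G-zero = trans (*-cong {Ds} {Ds ^ 1} (sym (*-identityʳ Ds)) (*-cong {Dt} {Dt ^ 1} (sym (*-identityʳ Dt)) (trans (G-permutations 0) (+-identityʳ (G-term [])))))
    (trans (generating-product (Free s∙) (Free t∙) genS genT genT-cong {Ds ^ 1} {Es ^ 1} {Dt ^ 1}
      (inverse-^ {Ds} {Es} 1 Ds-inverse) (λ i → α i []) (λ j → β j []) 1# 1# 1#
      (λ m h → trans (layers-[] _<ᵇ_ Y S genS genS-cong genS-+ genS-Y genS-X m (genS-C m h)) (sym (*-identityˡ m)))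
      (λ m h → trans (layers-[] _<ᵇ_ Z T genT genT-cong genT-+ genT-Z genT-X m (genT-C m h)) (sym (*-identityˡ m)))
      (1-free s∙)
      (λ j → Free-* s∙ {β j []} {1#} (Free-layers s∙ _<ᵇ_ Z Z-free-S j []) (1-free s∙))
      (Free-* t∙ {genS (λ i → α i [] * 1#)} {1#} (genS-Free (λ i → Free-* t∙ {α i []} {1#} (Free-layers t∙ _<ᵇ_ Y Y-free-T i []) (1-free t∙))) (1-free t∙)))
      (trans (*-identityʳ (1# * 1#)) (*-identityʳ 1#)))

  Represents : Frac → Series → Set
  Represents (a , b) f = a ≈ f * b

  represents-* : ∀ p q f g → Represents p f → Represents q g → Represents (p *F q) (f * g)
  represents-* (a , b) (c , d) f g e e′ = fraction-* {a} {b} {f} {c} {d} {g} e e′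

  represents-^ : ∀ p f n → Represents p f → Represents (p ^F n) (f ^ n)
  represents-^ p f zero e = sym (*-identityʳ 1#)
  represents-^ p f (suc n) e = represents-* p (p ^F n) f (f ^ n) e (represents-^ p f n e)

  represents-sum : ∀ {A : Set} {xs : List A} (t : A → Frac) (h : A → Series) → All (λ x → Represents (t x) (h x)) xs → Represents (sumF (map t xs)) (∑ xs h)
  represents-sum t h [] = sym (*-identityʳ 0#)
  represents-sum {xs = x ∷ xs} t h (e ∷ es) = fraction-+ {proj₁ (t x)} {proj₂ (t x)} {h x} {proj₁ (sumF (map t xs))} {proj₂ (sumF (map t xs))} {∑ xs h} e (represents-sum t h es)

  ^F-proj₁ : ∀ a b n → proj₁ ((a , b) ^F n) ≈ a ^ n
  ^F-proj₁ a b zero = refl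
  ^F-proj₁ a b (suc n) = *-congˡ {a} (^F-proj₁ a b n)

  ^F-proj₂ : ∀ a b n → proj₂ ((a , b) ^F n) ≈ b ^ n
  ^F-proj₂ a b zero = refl
  ^F-proj₂ a b (suc n) = *-congˡ {b} (^F-proj₂ a b n)

  -- The two arguments are treated together because a power of the y-argument alone represents no
  -- power series, its denominator containing y + s.
  represents-pair : ∀ y s j p e → (1# + y * s) * j ≈ 1# → p ℕ.≤ e →
    let yF = toF ((onePlus y Defs.^ 2) * s) /F toF ((y + s) * onePlus (y * s))
        sF = toF (y + s) /F toF (onePlus (y * s)) in
    proj₁ (yF ^F suc p) * proj₁ (sF ^F suc e) ≈ monomial y s j p e * (proj₂ (yF ^F suc p) * proj₂ (sF ^F suc e))
  represents-pair y s j p e kj p≤e = trans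
    (*-cong {proj₁ (yF ^F suc p)} {u ^ suc p} {proj₁ (sF ^F suc e)} {d ^ suc e}
      (trans (^F-proj₁ (proj₁ yF) (proj₂ yF) (suc p)) (^-congˡ (suc p) u≈))
      (trans (^F-proj₁ (proj₁ sF) (proj₂ sF) (suc e)) (^-congˡ (suc e) (*-identityʳ d))))
    (trans (monomial-fraction y s j kj p≤e)
      (*-congˡ {monomial y s j p e} (sym (*-cong {proj₂ (yF ^F suc p)} {(d * k) ^ suc p} {proj₂ (sF ^F suc e)} {k ^ suc e}
        (trans (^F-proj₂ (proj₁ yF) (proj₂ yF) (suc p)) (^-congˡ (suc p) (*-identityˡ (d * k))))
        (trans (^F-proj₂ (proj₁ sF) (proj₂ sF) (suc e)) (^-congˡ (suc e) (*-identityˡ k)))))))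
    where
    yF sF : Frac
    yF = toF ((onePlus y Defs.^ 2) * s) /F toF ((y + s) * onePlus (y * s))
    sF = toF (y + s) /F toF (onePlus (y * s))
    m d k u : Series
    m = 1# + y
    d = y + s
    k = 1# + y * s
    u = m * m * s
    u≈ : (m * (m * 1#)) * s * 1# ≈ u
    u≈ = solve 2 (λ m s → (m :* (m :* con (pos 1))) :* s :* con (pos 1) := m :* m :* s) refl m s

  yArg zArg sArg tArg : Frac
  yArg = toF ((onePlus Y Defs.^ 2) * S) /F toF ((Y + S) * onePlus (Y * S))
  zArg = toF ((onePlus Z Defs.^ 2) * T) /F toF ((Z + T) * onePlus (Z * T))
  sArg = toF (Y + S) /F toF (onePlus (Y * S))
  tArg = toF (Z + T) /F toF (onePlus (Z * T))

  hS hT : List ℕ → Series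
  hS π = monomial Y S Js (pk π) (des π)
  hT π = monomial Z T Jt (pk π) (des π)

  represents-Pn : ∀ n → Represents (Pn n yArg zArg sArg tArg) (∑ (𝔖 n) (λ π → hS π * hT (inverse π)))
  represents-Pn n = represents-sum (λ π → (yArg ^F suc (pk π)) *F (zArg ^F suc (ipk π)) *F (sArg ^F suc (des π)) *F (tArg ^F suc (ides π)))
    (λ π → hS π * hT (inverse π)) (All.universal term (𝔖 n))
    where
    term : ∀ π → Represents ((yArg ^F suc (pk π)) *F (zArg ^F suc (ipk π)) *F (sArg ^F suc (des π)) *F (tArg ^F suc (ides π))) (hS π * hT (inverse π))
    term π = fraction-quadruple
      {proj₁ (yArg ^F suc (pk π))} {proj₁ (zArg ^F suc (ipk π))} {proj₁ (sArg ^F suc (des π))} {proj₁ (tArg ^F suc (ides π))}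
      {proj₂ (yArg ^F suc (pk π))} {proj₂ (zArg ^F suc (ipk π))} {proj₂ (sArg ^F suc (des π))} {proj₂ (tArg ^F suc (ides π))}
      {hS π} {hT (inverse π)}
      (represents-pair Y S Js (pk π) (des π) Ks-inverse (pk≤des π))
      (represents-pair Z T Jt (pk (inverse π)) (des (inverse π)) Kt-inverse (pk≤des (inverse π)))

  monomial-total′ : ∀ y s j n v → length v ≡ suc n → distinct v ≡ true → (1# + y * s) * j ≈ 1# →
    (1# + y * s) ^ suc (suc n) * monomial y s j (pk v) (des v) ≈ (1# + y) * (s * total _<ᵇ_ y s v)
  monomial-total′ y s j _ (a ∷ w) ≡.refl d kj = monomial-total y s j kj a w (distinct⇒Linked (a ∷ w) d)

  D-inverse : (Ds * Dt) * (Es * Et) ≈ 1#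
  D-inverse = trans (solve 4 (λ a b c d → (a :* b) :* (c :* d) := (a :* c) :* (b :* d)) refl Ds Dt Es Et)
    (trans (*-cong {Ds * Es} {1#} {Dt * Et} {1#} Ds-inverse Dt-inverse) (*-identityʳ 1#))

  represents-LHS : ∀ n → Represents (LHSn (suc n)) (G (suc n))
  represents-LHS n = fraction-/ {proj₁ frac} {proj₂ frac} {(Ks * Kt * (Es * Et)) ^ suc (suc n) * H} {(1# + Y) * (1# + Z)} {G (suc n)}
    (represents-* (preF ^F suc (suc n)) (Pn (suc n) yArg zArg sArg tArg) ((Ks * Kt * (Es * Et)) ^ suc (suc n)) H
      (represents-^ preF (Ks * Kt * (Es * Et)) (suc (suc n)) (fraction-unit {Ks * Kt} {Ds * Dt} {Es * Et} D-inverse))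
      (represents-Pn (suc n)))
    -- For index n + 1 the exponent of the prefactor is n + 2, in agreement with the powers of 1 - s
    -- and 1 - t in `G-total` and of 1 + ys and 1 + zt in `monomial-total′`.
    (prefactor (𝔖 (suc n)) {Ks} {Kt} {1# + Y} {1# + Z} {Ds} {Es} {Dt} {Et} {G (suc n)} (suc (suc n))
      hS (λ π → hT (inverse π)) (λ π → S * totS π) (λ π → T * totT (inverse π)) Ds-inverse Dt-inverse (G-total n)
      (∑-𝔖-cong (suc n) (λ π P → *-cong {Ks ^ suc (suc n) * hS π} {(1# + Y) * (S * totS π)} {Kt ^ suc (suc n) * hT (inverse π)} {(1# + Z) * (T * totT (inverse π))}
        (monomial-total′ Y S Js n π (Perm-length P) (Perm-distinct P) Ks-inverse)
        (monomial-total′ Z T Jt n (inverse π) (≡.trans (inverse-length π) (Perm-length P)) (inverse-distinct P) Kt-inverse))))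
    where
    preF frac : Frac
    preF = toF (onePlus (Y * S) * onePlus (Z * T)) /F toF (oneMinus S * oneMinus T)
    frac = (preF ^F suc (suc n)) *F Pn (suc n) yArg zArg sArg tArg
    H : Series
    H = ∑ (𝔖 (suc n)) (λ π → hS π * hT (inverse π))

  sumS-∑ : ∀ {A : Set} (f : A → Series) xs → sumS (map f xs) ≡ ∑ xs f
  sumS-∑ f [] = ≡.refl
  sumS-∑ f (x ∷ xs) = cong (f x +_) (sumS-∑ f xs)

  Eulerian-∑ : ∀ n u → Eulerian (suc n) u ≈ ∑ (𝔖 (suc n)) (λ π → u ^ suc (des π))
  Eulerian-∑ n u = trans (reflexive (sumS-∑ (λ π → u Defs.^ suc (des π)) (𝔖 (suc n))))
    (∑-cong (𝔖 (suc n)) (λ π → reflexive (^-Defs u (suc (des π)))))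

  -- Carlitz's identity A_l(s)/(1-s)^(l+1) = Σ i^l sⁱ, from the case y = 0 of the labelling argument.
  module Carlitz (k : Fin 5) (s : Series) (gen : (ℕ → Series) → Series)
    (gen-cong : ∀ {f g} → (∀ i → f i ≈ g i) → gen f ≈ gen g)
    (gen-+ : ∀ f g → gen (λ i → f i + g i) ≈ gen f + gen g)
    (gen-0 : gen (λ _ → 0#) ≈ 0#)
    (gen-X : ∀ f → gen (X· f) ≈ s * gen f)
    (gen-C : ∀ m → Free k m → gen (C m) ≈ m)
    (gen-∑ : ∀ {A : Set} (xs : List A) (f : ℕ → A → Series) → gen (λ i → ∑ xs (f i)) ≈ ∑ xs (λ x → gen (λ i → f i x)))
    where

    private
      D : Series
      D = 1# - s

      L : ℕ → List ℕ → Series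
      L = layers _<ᵇ_ 0# 1#

      gen-0* : ∀ f → gen (λ i → 0# * f i) ≈ 0# * gen f
      gen-0* f = trans (gen-cong (λ i → zeroˡ (f i))) (trans gen-0 (sym (zeroˡ (gen f))))

      word : ∀ n v → length v ≡ suc n → distinct v ≡ true → ∀ m → Free k m →
        D ^ suc (suc n) * gen (λ i → L i v * m) ≈ s ^ suc (des v) * m
      word _ (x ∷ w) ≡.refl d m h = trans
        (layers-total _<ᵇ_ 0# s gen gen-cong gen-+ gen-0* gen-X m (gen-C m h) x w)
        (*-congʳ {m} (*-congˡ {s} (total-0 s x w (distinct⇒Linked (x ∷ w) d))))

      -- By `permSum-power`, the l-th power of i counts the labellings by 1, ..., i of all
      -- permutations of l letters, so the series can be summed permutation by permutation.
      expand : ∀ l m → gen (λ i → (i × 1#) ^ l * m) ≈ ∑ (𝔖 l) (λ π → gen (λ i → L i π * m))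
      expand l m = trans (gen-cong (λ i → trans (*-congʳ {m} (trans (sym (permSum-power i l)) (sym (∑-𝔖 l (L i)))))
        (sym (∑-*ʳ (𝔖 l) m (L i))))) (gen-∑ (𝔖 l) (λ i π → L i π * m))

    carlitz : ∀ l m → Free k m → D ^ suc l * gen (λ i → (i × 1#) ^ l * m) ≈ Eulerian l s * m
    carlitz zero m h = trans (*-congˡ {D ^ 1} (trans (expand 0 m) (+-identityʳ (gen (λ i → L i [] * m)))))
      (trans (layers-[] _<ᵇ_ 0# s gen gen-cong gen-+ gen-0* gen-X m (gen-C m h)) (sym (*-identityˡ m)))
    carlitz (suc l) m h = begin
      D ^ suc (suc l) * gen (λ i → (i × 1#) ^ suc l * m)
        ≈⟨ *-congˡ {D ^ suc (suc l)} (expand (suc l) m) ⟩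
      D ^ suc (suc l) * ∑ (𝔖 (suc l)) (λ π → gen (λ i → L i π * m))
        ≈⟨ ∑-*ˡ (𝔖 (suc l)) (D ^ suc (suc l)) (λ π → gen (λ i → L i π * m)) ⟨
      ∑ (𝔖 (suc l)) (λ π → D ^ suc (suc l) * gen (λ i → L i π * m))
        ≈⟨ ∑-𝔖-cong (suc l) (λ π P → word l π (Perm-length P) (Perm-distinct P) m h) ⟩
      ∑ (𝔖 (suc l)) (λ π → s ^ suc (des π) * m)
        ≈⟨ ∑-*ʳ (𝔖 (suc l)) m (λ π → s ^ suc (des π)) ⟩
      ∑ (𝔖 (suc l)) (λ π → s ^ suc (des π)) * m
        ≈⟨ *-congʳ {m} (Eulerian-∑ l s) ⟨
      Eulerian (suc l) s * m ∎

  carlitzS : ∀ l m → Free s∙ m → Ds ^ suc l * genS (λ i → (i × 1#) ^ l * m) ≈ Eulerian l S * m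
  carlitzS = Carlitz.carlitz s∙ S genS genS-cong genS-+ genS-0 genS-X genS-C genS-∑

  carlitzT : ∀ l m → Free t∙ m → Dt ^ suc l * genT (λ i → (i × 1#) ^ l * m) ≈ Eulerian l T * m
  carlitzT = Carlitz.carlitz t∙ T genT genT-cong genT-+ genT-0 genT-X genT-C genT-∑

  powerSum : ℕ → Series
  powerSum k = (1# - (- Y) ^ k) * (1# - (- Z) ^ k)

  -- The value at 0 is a placeholder, as `zλ` does not vanish on lists of positive parts.
  reciprocal : ℕ → ℚ
  reciprocal zero = 0ℚ
  reciprocal (suc n) = Q.1/_ (ℕtoℚ (suc n)) {{ℕtoℚ-nonZero (suc n)}}

  reciprocal-* : ∀ n → .{{NonZero n}} → ∀ x → ℕtoℚ n Q.* (reciprocal n Q.* x) ≡ x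
  reciprocal-* (suc n) x = ≡.trans (≡.sym (Qₚ.*-assoc q (Q.1/ q) x)) (≡.trans (cong (Q._* x) (Qₚ.*-inverseʳ q)) (Qₚ.*-identityˡ x))
    where
    q : ℚ
    q = ℕtoℚ (suc n)
    instance _ = ℕtoℚ-nonZero (suc n)

  -- The part of the summand of a partition in (b) that involves neither s nor t.
  w₀ : List ℕ → Series
  w₀ p = scale (reciprocal (zλ p)) (qProduct powerSum p)

  w₀-zλ : ∀ {p} → All (1 ℕ.≤_) p → zλ p × w₀ p ≈ qProduct powerSum p
  w₀-zλ {p} hs w = ≡.trans (×-at (zλ p) (w₀ p) w) (reciprocal-* (zλ p) {{zλ-nonZero hs}} (qProduct powerSum p w))

  w₀-const : ∀ {p} → All (1 ℕ.≤_) p → constℕ (zλ p) * w₀ p ≈ qProduct powerSum p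
  w₀-const {p} hs w = ≡.trans (const-* (ℕtoℚ (zλ p)) (w₀ p) w) (reciprocal-* (zλ p) {{zλ-nonZero hs}} (qProduct powerSum p w))

  powerSum-free : ∀ k n → Free k Y → Free k Z → Free k (powerSum n)
  powerSum-free k n hY hZ = Free-* k {1# - (- Y) ^ n} {1# - (- Z) ^ n} (factor Y hY) (factor Z hZ)
    where
    factor : ∀ y → Free k y → Free k (1# - (- y) ^ n)
    factor y hy = Free-+ k {1#} { - ((- y) ^ n)} (1-free k) (Free-neg k {(- y) ^ n} (Free-^ k { - y} n (Free-neg k {y} hy)))

  w₀-free : ∀ k p → Free k Y → Free k Z → Free k (w₀ p)
  w₀-free k p hY hZ w h = ≡.trans (cong (reciprocal (zλ p) Q.*_) (free p w h)) (Qₚ.*-zeroʳ (reciprocal (zλ p)))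
    where
    free : ∀ p → Free k (qProduct powerSum p)
    free [] = 1-free k
    free (n ∷ p) = Free-* k {powerSum n} {qProduct powerSum p} (powerSum-free k n hY hZ) (free p)

  ℕ-free : ∀ k i l → Free k ((i × 1#) ^ l)
  ℕ-free k i l = Free-^ k {i × 1#} l (free i)
    where
    free : ∀ i → Free k (i × 1#)
    free zero = Free-0 k
    free (suc i) = Free-+ k {1#} {i × 1#} (1-free k) (free i)

  G-part : List ℕ → Series
  G-part p = genT (λ j → genS (λ i → (i × 1#) ^ length p * ((j × 1#) ^ length p * w₀ p)))

  G-partitions : ∀ n → G n ≈ ∑ (partitions n) G-part
  G-partitions n = trans (genT-cong (λ j → genS-cong (λ i → coefficient i j)))
    (genTS-∑ (partitions n) (λ i j p → (i × 1#) ^ length p * ((j × 1#) ^ length p * w₀ p)))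
    where
    coefficient : ∀ i j → xCoeff n (Fser ^ (i ℕ.* j)) ≈ ∑ (partitions n) (λ p → (i × 1#) ^ length p * ((j × 1#) ^ length p * w₀ p))
    coefficient i j = trans (xCoeff-F^ (i ℕ.* j) n) (trans (power-partitions-ij torsionFree Y Z i j w₀ w₀-zλ n)
      (sym (∑-parts n n n (λ p → (i × 1#) ^ length p * ((j × 1#) ^ length p * w₀ p)))))

  G-part-total : ∀ p → Ds ^ suc (length p) * (Dt ^ suc (length p) * G-part p) ≈ Eulerian (length p) S * Eulerian (length p) T * w₀ p
  G-part-total p = generating-product (Free s∙) (Free t∙) genS genT genT-cong {Ds ^ suc l} {Es ^ suc l} {Dt ^ suc l}
    (inverse-^ {Ds} {Es} (suc l) Ds-inverse) (λ i → (i × 1#) ^ l) (λ j → (j × 1#) ^ l) (Eulerian l S) (Eulerian l T) (w₀ p)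
    (carlitzS l) (carlitzT l) (1-free s∙)
    (λ j → Free-* s∙ {(j × 1#) ^ l} {w₀ p} (ℕ-free s∙ j l) (w₀-free s∙ p Y-free-S Z-free-S))
    (Free-* t∙ {genS (λ i → (i × 1#) ^ l * 1#)} {w₀ p} (genS-Free (λ i → Free-* t∙ {(i × 1#) ^ l} {1#} (ℕ-free t∙ i l) (1-free t∙))) (w₀-free t∙ p Y-free-T Z-free-T))
    where
    l : ℕ
    l = length p

  parts-positive : ∀ f n m → All (All (1 ℕ.≤_)) (parts f n m)
  parts-positive zero zero m = [] ∷ []
  parts-positive (suc f) zero m = [] ∷ []
  parts-positive zero (suc n) m = []
  parts-positive (suc f) (suc n) m = Allₚ.concat⁺ (Allₚ.map⁺ {f = λ k → map (k ∷_) (parts f (suc n ℕ.∸ k) k)} (applyUpTo-All ℕ.suc (m ℕ.⊓ suc n) (λ i _ →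
    Allₚ.map⁺ {f = ℕ.suc i ∷_} (All.map (λ hs → s≤s z≤n ∷ hs) (parts-positive f (n ℕ.∸ i) (ℕ.suc i))))))

  -- A copy of the summand local to `RHSb`, to which it is equal by computation.
  bTerm : List ℕ → Frac
  bTerm p =
    (prodS (map (λ k → oneMinus (scale (Q.- 1ℚ) Y Defs.^ k) * oneMinus (scale (Q.- 1ℚ) Z Defs.^ k)) p)
       * Eulerian (length p) S * Eulerian (length p) T)
    , (constℕ (zλ p) * (oneMinus S Defs.^ suc (length p)) * (oneMinus T Defs.^ suc (length p)))

  represents-bTerm : ∀ {p} → All (1 ℕ.≤_) p → Represents (bTerm p) (G-part p)
  represents-bTerm {p} hs = trans
    (*-congʳ {Eulerian l T} (*-congʳ {Eulerian l S} (numerator p)))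
    (trans (partition-fraction {constℕ (zλ p)} {qProduct powerSum p} {Eulerian l S} {Eulerian l T} {Ds ^ suc l} {Dt ^ suc l} {w₀ p} {G-part p} (w₀-const hs) (G-part-total p))
      (*-congˡ {G-part p} (*-cong {constℕ (zλ p) * Ds ^ suc l} {constℕ (zλ p) * (oneMinus S Defs.^ suc l)} {Dt ^ suc l} {oneMinus T Defs.^ suc l}
        (*-congˡ {constℕ (zλ p)} (reflexive (≡.sym (^-Defs Ds (suc l))))) (reflexive (≡.sym (^-Defs Dt (suc l)))))))
    where
    l : ℕ
    l = length p
    numerator : ∀ p → prodS (map (λ k → oneMinus (scale (Q.- 1ℚ) Y Defs.^ k) * oneMinus (scale (Q.- 1ℚ) Z Defs.^ k)) p) ≈ qProduct powerSum p
    numerator [] = refl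
    numerator (k ∷ p) = *-cong {oneMinus (scale (Q.- 1ℚ) Y Defs.^ k) * oneMinus (scale (Q.- 1ℚ) Z Defs.^ k)} {powerSum k}
      (reflexive (cong₂ (λ a b → (1# - a) * (1# - b)) (^-Defs (- Y) k) (^-Defs (- Z) k))) (numerator p)

  represents-RHSb : ∀ n → Represents (RHSb n) (G n)
  represents-RHSb n = trans (represents-sum bTerm G-part (All.map represents-bTerm (parts-positive n n n)))
    (*-congʳ {proj₂ (sumF (map bTerm (partitions n)))} (sym (G-partitions n)))

  represents-0 : Represents (LHSa-coeff 0) (G 0)
  represents-0 = trans (*-identityʳ 1#) (trans (sym G-zero) (solve 3 (λ a b g → a :* (b :* g) := g :* (con (pos 1) :* (a :* b))) refl Ds Dt (G 0)))

  represents-LHSa : ∀ n → Represents (LHSa-coeff n) (G n)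
  represents-LHSa zero = represents-0
  represents-LHSa (suc n) = represents-LHS n

  LHSa-identity : ∀ n → LHSa-coeff n ≈F toF (xCoeff n RHSa)
  LHSa-identity n = trans (*-identityʳ (proj₁ (LHSa-coeff n)))
    (trans (represents-LHSa n) (*-congʳ {proj₂ (LHSa-coeff n)} (sym (xCoeff-RHSa n))))

  LHSn-identity : ∀ n → LHSn (suc n) ≈F RHSb (suc n)
  LHSn-identity n = fraction-cross {proj₁ (LHSn (suc n))} {proj₂ (LHSn (suc n))} {G (suc n)} {proj₁ (RHSb (suc n))} {proj₂ (RHSb (suc n))}
    (represents-LHS n) (represents-RHSb (suc n))

open import Defs
open import Data.Product using (_×_; _,_)

theorem3p1 : ((n : ℕ) → LHSa-coeff n ≈F toF (xCoeff n RHSa))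
    × ((n : ℕ) → LHSn (suc n) ≈F RHSb (suc n))
theorem3p1 = Assembly.LHSa-identity , Assembly.LHSn-identity
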